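{- Let $k$ be a positive integer. There exist $\varepsilon=\varepsilon(k)>0$ and a polynomial $P_k$ with the following property. For any positive integers $s$ and $d\ge P_k(s)$, every graph $G$ with no $K_{s,s}$ subgraph and with maximum average degree $d$ contains either an induced subgraph that is bipartite, has no $C_4$ subgraph, and has average degree at least $k$; or an induced bipartite subgraph $G'$ with bipartition $(A',B')$ such that $|A'|\ge 2^{d^{2\varepsilon}}|B'|$ and $|N(a)\cap B'|=\lfloor d^{\varepsilon}/s^4\rfloor$ for every $a\in A'$.
   Context: "Subgraph" means not necessarily induced subgraph; $C_4$ is the cycle on four vertices. The maximum average degree of $G$ is the maximum of the average degree of $G[X]$ over all nonempty $X\subseteq V(G)$. $N(a)$ denotes the neighbourhood of $a$. -}

module Defs where

open import Data.Nat using (ℕ; zero; suc; _+_; _*_; _^_; _≤_; _<_)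
open import Data.Bool using (Bool; true; false; _∧_; _∨_; if_then_else_)
open import Data.Fin using (Fin; zero; suc)
open import Data.Fin.Subset using (Subset)
open import Data.Vec using (lookup)
open import Data.List using (List; []; _∷_)
open import Data.Product using (Σ; _×_; ∃-syntax)
open import Relation.Binary.PropositionalEquality using (_≡_; _≢_)
open import Relation.Nullary using (¬_)
open import Function.Definitions using (Injective)

record Graph : Set where
  field
    n      : ℕ
    Adj    : Fin n → Fin n → Bool
    sym    : ∀ u v → Adj u v ≡ Adj v u
    irrefl : ∀ v → Adj v v ≡ false
open Graph public

E : (G : Graph) → Fin (n G) → Fin (n G) → Set
E G u v = Adj G u v ≡ true

_∈ₛ_ : ∀ {m} → Fin m → Subset m → Set
v ∈ₛ X = lookup X v ≡ true

sumF : ∀ {m} → (Fin m → ℕ) → ℕ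
sumF {zero}  f = 0
sumF {suc m} f = f zero + sumF (λ i → f (suc i))

countF : ∀ {m} → (Fin m → Bool) → ℕ
countF p = sumF (λ i → if p i then 1 else 0)

size : ∀ {m} → Subset m → ℕ
size X = countF (lookup X)

degIn : (G : Graph) → Subset (n G) → Fin (n G) → ℕ
degIn G X u = countF (λ v → lookup X v ∧ Adj G u v)

degSum : (G : Graph) → Subset (n G) → ℕ
degSum G X = sumF (λ u → if lookup X u then degIn G X u else 0)

-- The maximum average degree of G equals the rational dn/dd (dd > 0):
-- it is attained by some nonempty X and bounds the average degree of every nonempty Y.
IsMad : (G : Graph) → (dn dd : ℕ) → Set
IsMad G dn dd =
  (1 ≤ dd) ×
  (Σ (Subset (n G)) λ X → (1 ≤ size X) × (degSum G X * dd ≡ dn * size X)) ×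
  (∀ (Y : Subset (n G)) → 1 ≤ size Y → degSum G Y * dd ≤ dn * size Y)

HasKss : (G : Graph) → ℕ → Set
HasKss G s = Σ (Fin s → Fin (n G)) λ f → Σ (Fin s → Fin (n G)) λ g →
  Injective _≡_ _≡_ f × Injective _≡_ _≡_ g ×
  (∀ i j → f i ≢ g j) × (∀ i j → E G (f i) (g j))

HasC4In : (G : Graph) → Subset (n G) → Set
HasC4In G X = ∃[ a ] ∃[ b ] ∃[ c ] ∃[ d ]
  ((a ∈ₛ X) × (b ∈ₛ X) × (c ∈ₛ X) × (d ∈ₛ X)) ×
  ((a ≢ b) × (a ≢ c) × (a ≢ d) × (b ≢ c) × (b ≢ d) × (c ≢ d)) ×
  (E G a b × E G b c × E G c d × E G d a)

IsBipartition : (G : Graph) → (X A B : Subset (n G)) → Set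
IsBipartition G X A B =
  (∀ v → lookup X v ≡ (lookup A v ∨ lookup B v)) ×
  (∀ v → (lookup A v ∧ lookup B v) ≡ false) ×
  (∀ u v → u ∈ₛ A → v ∈ₛ A → ¬ E G u v) ×
  (∀ u v → u ∈ₛ B → v ∈ₛ B → ¬ E G u v)

IsBipartiteIn : (G : Graph) → Subset (n G) → Set
IsBipartiteIn G X = Σ (Subset (n G)) λ A → Σ (Subset (n G)) λ B → IsBipartition G X A B

evalPoly : List ℕ → ℕ → ℕ
evalPoly []       x = 0
evalPoly (c ∷ cs) x = c + x * evalPoly cs x

-- With d = dn/dd and ε = p/q:
-- m = ⌊ d^ε / s^4 ⌋   ⇔   (m s^4)^q ≤ d^p < ((m+1) s^4)^q
IsFloorPow : (dn dd p q s m : ℕ) → Set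
IsFloorPow dn dd p q s m =
  ((m * s ^ 4) ^ q * dd ^ p ≤ dn ^ p) × (dn ^ p < (suc m * s ^ 4) ^ q * dd ^ p)

-- x ≥ 2^(d^(2ε)) * y   ⇔   for every rational a/b ≤ d^(2p/q) (a,b naturals, b ≥ 1): 2^a y^b ≤ x^b,
-- where a/b ≤ d^(2p/q) ⇔ (a/b)^q ≤ d^(2p) ⇔ a^q dd^(2p) ≤ dn^(2p) b^q.
GeqExpTimes : (dn dd p q x y : ℕ) → Set
GeqExpTimes dn dd p q x y =
  ∀ (a b : ℕ) → 1 ≤ b → a ^ q * dd ^ (2 * p) ≤ dn ^ (2 * p) * b ^ q →
    2 ^ a * y ^ b ≤ x ^ b

{-# OPTIONS --safe #-}
module Submission where

-- Let T - 1 be the integer part of d^(1/Q) for a large Q = Q(k); all quantities are compared with powers of T.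
-- An extremal set X has minimum degree at least d/2 and only few vertices of degree above Td; let A₀ be the
-- others, and split X into classes B according to the T-adic size of the degree into A₀.
--
-- If the class of degrees above T^(T²) receives many edges, sample it with probability about 1/(Td). A fixed
-- independent m-set in the neighbourhood of a becomes the whole sampled neighbourhood of a with probability
-- T^(-O(m)), which is affordable because the class is smaller than A₀ by a factor T^(T² - O(1)).
--
-- Otherwise some class B receives many edges and the graph between A and B is regular up to factors T^O(1).
-- Sample B with probability η/d for η = T^(-O(k²)) and keep the a ∈ A with exactly k sampled neighbours.
-- Adjacent survivors and survivors with two common sampled neighbours are in conflict; η is so small that a
-- conflict-free set of survivors outnumbers the sample, unless some two neighbourhoods are dense to each other.
--
-- In a dense pair, K_{s,s}-freeness makes non-edges abundant in all large sets, so that independent tuples with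
-- many common neighbours exist, and one finds the incidence graph of a fixed linear system with k points on
-- each line as an induced subgraph. The same applies if a neighbourhood has no independent m-set.

open import Defs hiding (sym)
open import Data.Nat using (ℕ; zero; suc; _+_; _*_; _∸_; _^_; _≤_; _<_; _≤ᵇ_; _<ᵇ_; _≡ᵇ_; z≤n; s≤s; NonZero; >-nonZero; _≤?_; _<?_)
open import Data.Nat.Properties
open import Data.Nat.Tactic.RingSolver using (solve-∀)
open import Data.Bool using (Bool; true; false; _∧_; _∨_; not; if_then_else_)
import Data.Bool
open import Data.Fin using (Fin; zero; suc; toℕ)
import Data.Fin as Fin
import Data.Fin.Properties as Fin
open import Data.Fin.Subset using (Subset)
open import Data.Vec using (Vec; []; _∷_; lookup; tabulate; insertAt)
open import Data.Vec.Properties using (lookup∘tabulate; insertAt-lookup; insertAt-punchIn)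
open import Data.List using (List; []; _∷_)
open import Data.Product using (Σ; ∃; _×_; _,_; proj₁; proj₂)
open import Data.Sum using (_⊎_; inj₁; inj₂)
open import Data.Empty using (⊥; ⊥-elim)
open import Data.Unit using (tt)
open import Function using (case_of_)
open import Function.Definitions using (Injective)
open import Relation.Nullary using (¬_; Dec; yes; no; contradiction)
open import Relation.Binary.Definitions using (Tri; tri<; tri≈; tri>)
open import Relation.Binary.PropositionalEquality using (_≡_; _≢_; refl; sym; trans; cong; cong₂; subst; subst₂; module ≡-Reasoning)

-- Sums over finite types and over decidable subsets

-- The sampled part has to be independent although degrees inside its class are unbounded. A bounded
-- maximum average degree gives an orientation with outdegrees at most `T ^ (5 + R)`; a sampled
-- vertex is dropped if one of its out-neighbours is sampled. Of two adjacent vertices at least one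
-- goes, while a prescribed neighbourhood survives if only a few vertices are missed, which costs a
-- factor 2.
--
-- Why a small η helps: the number of candidates scales like η^k, and a conflict between adjacent
-- candidates with disjoint sampled neighbourhoods needs 2k sampled vertices, hence scales like
-- η^(2k). A conflict-free set has size about candidates² / conflicts, which does not depend on η,
-- while the sample shrinks in proportion to η. Conflicts through one or two common sampled
-- neighbours scale only like η and η²; to make these as rare, pairs of neighbourhoods must be
-- sparser by a factor η^(2k), and that is where dense pairs enter.
--
-- All of this is arithmetic in ℕ: expectations are multiplied by the total weight, and estimates
-- become comparisons of exponents of `T`.

𝟙 : Bool → ℕ
𝟙 b = if b then 1 else 0

sumOver : ∀ {n} → (Fin n → Bool) → (Fin n → ℕ) → ℕ
sumOver X f = sumF (λ u → if X u then f u else 0)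

sumF-cong : ∀ {n} {f g : Fin n → ℕ} → (∀ i → f i ≡ g i) → sumF f ≡ sumF g
sumF-cong {zero}  e = refl
sumF-cong {suc n} e = cong₂ _+_ (e zero) (sumF-cong (λ i → e (suc i)))

sumF-mono : ∀ {n} {f g : Fin n → ℕ} → (∀ i → f i ≤ g i) → sumF f ≤ sumF g
sumF-mono {zero}  e = z≤n
sumF-mono {suc n} e = +-mono-≤ (e zero) (sumF-mono (λ i → e (suc i)))

sumF-+ : ∀ {n} (f g : Fin n → ℕ) → sumF (λ i → f i + g i) ≡ sumF f + sumF g
sumF-+ {zero}  f g = refl
sumF-+ {suc n} f g rewrite sumF-+ (λ i → f (suc i)) (λ i → g (suc i)) =
  interchange (f zero) (g zero) (sumF (λ i → f (suc i))) (sumF (λ i → g (suc i)))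
  where
  interchange : ∀ a b c d → a + b + (c + d) ≡ a + c + (b + d)
  interchange = solve-∀

sumF-*ˡ : ∀ {n} c (f : Fin n → ℕ) → sumF (λ i → c * f i) ≡ c * sumF f
sumF-*ˡ {zero}  c f = sym (*-zeroʳ c)
sumF-*ˡ {suc n} c f rewrite sumF-*ˡ c (λ i → f (suc i)) = sym (*-distribˡ-+ c (f zero) _)

sumF-*ʳ : ∀ {n} (f : Fin n → ℕ) c → sumF (λ i → f i * c) ≡ sumF f * c
sumF-*ʳ f c = trans (sumF-cong (λ i → *-comm (f i) c)) (trans (sumF-*ˡ c f) (*-comm c _))

sumF-zero : ∀ n → sumF {n} (λ _ → 0) ≡ 0
sumF-zero zero    = refl
sumF-zero (suc n) = sumF-zero n

sumF-const : ∀ n c → sumF {n} (λ _ → c) ≡ n * c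
sumF-const zero    c = refl
sumF-const (suc n) c = cong (c +_) (sumF-const n c)

sumF-swap : ∀ {m n} (f : Fin m → Fin n → ℕ) →
  sumF (λ i → sumF (f i)) ≡ sumF (λ j → sumF (λ i → f i j))
sumF-swap {zero}  {n} f = sym (sumF-zero n)
sumF-swap {suc m} {n} f =
  trans (cong (sumF (f zero) +_) (sumF-swap (λ i → f (suc i))))
        (sym (sumF-+ (f zero) (λ j → sumF (λ i → f (suc i) j))))

sumF-member : ∀ {n} (f : Fin n → ℕ) i → f i ≤ sumF f
sumF-member f zero    = m≤m+n _ _
sumF-member f (suc i) = ≤-trans (sumF-member (λ j → f (suc j)) i) (m≤n+m _ _)

sumF-<⇒∃< : ∀ {n} (f g : Fin n → ℕ) → sumF f < sumF g → ∃ λ i → f i < g i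
sumF-<⇒∃< {suc n} f g lt with f zero <? g zero
... | yes p = zero , p
... | no ¬p with sumF (λ i → f (suc i)) <? sumF (λ i → g (suc i))
...   | yes q = let (i , r) = sumF-<⇒∃< _ _ q in suc i , r
...   | no ¬q = contradiction lt (≤⇒≯ (+-mono-≤ (≮⇒≥ ¬p) (≮⇒≥ ¬q)))

sumF≡0⇒≡0 : ∀ {n} (f : Fin n → ℕ) → sumF f ≡ 0 → ∀ i → f i ≡ 0
sumF≡0⇒≡0 f e i = n≤0⇒n≡0 (subst (f i ≤_) e (sumF-member f i))

∧-split : ∀ {a b} → a ∧ b ≡ true → a ≡ true × b ≡ true
∧-split {true} {true} e = refl , refl

∧-join : ∀ {a b} → a ≡ true → b ≡ true → a ∧ b ≡ true
∧-join refl refl = refl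

true≢false : ∀ {b} → b ≡ true → b ≡ false → ⊥
true≢false refl ()

≢true⇒≡false : ∀ {b} → ¬ (b ≡ true) → b ≡ false
≢true⇒≡false {true}  h = ⊥-elim (h refl)
≢true⇒≡false {false} h = refl

not-true : ∀ {b} → b ≡ false → not b ≡ true
not-true refl = refl

not-true⁻¹ : ∀ {b} → not b ≡ true → b ≡ false
not-true⁻¹ {false} h = refl

Bool-ext : ∀ {a b} → (a ≡ true → b ≡ true) → (b ≡ true → a ≡ true) → a ≡ b
Bool-ext {true}  {b}     f g = sym (f refl)
Bool-ext {false} {true}  f g = g refl
Bool-ext {false} {false} f g = refl

𝟙≤ : ∀ b {c} → (b ≡ true → 1 ≤ c) → 𝟙 b ≤ c
𝟙≤ true  h = h refl
𝟙≤ false h = z≤n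

𝟙≤1 : ∀ b → 𝟙 b ≤ 1
𝟙≤1 true  = ≤-refl
𝟙≤1 false = z≤n

𝟙-true : ∀ {b} → b ≡ true → 1 ≤ 𝟙 b
𝟙-true refl = ≤-refl

𝟙-true⁻¹ : ∀ {b c} → c < 𝟙 b → b ≡ true
𝟙-true⁻¹ {true} p = refl

𝟙≡0 : ∀ {b} → 𝟙 b ≡ 0 → b ≡ false
𝟙≡0 {false} e = refl

𝟙-mono : ∀ {a b} → (a ≡ true → b ≡ true) → 𝟙 a ≤ 𝟙 b
𝟙-mono {a} h = 𝟙≤ a (λ e → 𝟙-true (h e))

𝟙-∧ : ∀ a b → 𝟙 (a ∧ b) ≡ 𝟙 a * 𝟙 b
𝟙-∧ true  b = sym (+-identityʳ _)
𝟙-∧ false b = refl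

if≡𝟙* : ∀ b c → (if b then c else 0) ≡ 𝟙 b * c
if≡𝟙* true  c = sym (+-identityʳ c)
if≡𝟙* false c = refl

countF-mono : ∀ {n} {P Q : Fin n → Bool} → (∀ i → P i ≡ true → Q i ≡ true) → countF P ≤ countF Q
countF-mono h = sumF-mono (λ i → 𝟙-mono (h i))

countF-cong : ∀ {n} {P Q : Fin n → Bool} → (∀ i → P i ≡ Q i) → countF P ≡ countF Q
countF-cong h = sumF-cong (λ i → cong 𝟙 (h i))

sumOver-mono : ∀ {n} (X : Fin n → Bool) {f g : Fin n → ℕ} →
  (∀ u → X u ≡ true → f u ≤ g u) → sumOver X f ≤ sumOver X g
sumOver-mono X {f} {g} h = sumF-mono (λ u → aux u (X u) refl)
  where
  aux : ∀ u b → X u ≡ b → (if b then f u else 0) ≤ (if b then g u else 0)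
  aux u true  e = h u e
  aux u false e = z≤n

sumOver-cong : ∀ {n} (X : Fin n → Bool) {f g : Fin n → ℕ} → (∀ u → f u ≡ g u) → sumOver X f ≡ sumOver X g
sumOver-cong X h = sumF-cong (λ u → cong (λ x → if X u then x else 0) (h u))

sumOver-monoˢ : ∀ {n} {X Y : Fin n → Bool} (f : Fin n → ℕ) →
  (∀ u → X u ≡ true → Y u ≡ true) → sumOver X f ≤ sumOver Y f
sumOver-monoˢ {X = X} {Y} f h = sumF-mono (λ u → aux u (X u) refl)
  where
  aux : ∀ u b → X u ≡ b → (if b then f u else 0) ≤ (if Y u then f u else 0)
  aux u true  e rewrite h u e = ≤-refl
  aux u false e = z≤n

sumOver-*ˡ : ∀ {n} (X : Fin n → Bool) c (f : Fin n → ℕ) → sumOver X (λ u → c * f u) ≡ c * sumOver X f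
sumOver-*ˡ X c f = trans (sumF-cong (λ u → aux (X u))) (sumF-*ˡ c (λ u → if X u then f u else 0))
  where
  aux : ∀ b {x} → (if b then c * x else 0) ≡ c * (if b then x else 0)
  aux true  = refl
  aux false = sym (*-zeroʳ c)

sumOver-const : ∀ {n} (X : Fin n → Bool) c → sumOver X (λ _ → c) ≡ countF X * c
sumOver-const X c = trans (sumF-cong (λ u → if≡𝟙* (X u) c)) (sumF-*ʳ (λ u → 𝟙 (X u)) c)

sumOver-≤const : ∀ {n} (X : Fin n → Bool) {f : Fin n → ℕ} c →
  (∀ u → X u ≡ true → f u ≤ c) → sumOver X f ≤ countF X * c
sumOver-≤const X c h = subst (_ ≤_) (sumOver-const X c) (sumOver-mono X h)

sumOver-≥const : ∀ {n} (X : Fin n → Bool) {f : Fin n → ℕ} c →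
  (∀ u → X u ≡ true → c ≤ f u) → countF X * c ≤ sumOver X f
sumOver-≥const X c h = subst (_≤ _) (sumOver-const X c) (sumOver-mono X h)

sumOver-+ : ∀ {n} (X : Fin n → Bool) (f g : Fin n → ℕ) →
  sumOver X (λ u → f u + g u) ≡ sumOver X f + sumOver X g
sumOver-+ X f g = trans (sumF-cong (λ u → aux (X u) {f u} {g u}))
  (sumF-+ (λ u → if X u then f u else 0) (λ u → if X u then g u else 0))
  where
  aux : ∀ b {x y} → (if b then x + y else 0) ≡ (if b then x else 0) + (if b then y else 0)
  aux true  = refl
  aux false = refl

sumOver-swap : ∀ {m n} (X : Fin m → Bool) (Y : Fin n → Bool) (f : Fin m → Fin n → ℕ) →
  sumOver X (λ u → sumOver Y (f u)) ≡ sumOver Y (λ v → sumOver X (λ u → f u v))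
sumOver-swap X Y f = begin
  sumOver X (λ u → sumOver Y (f u))
    ≡⟨ sumF-cong (λ u → push (X u) (λ v → if Y v then f u v else 0)) ⟩
  sumF (λ u → sumF (λ v → if X u then (if Y v then f u v else 0) else 0))
    ≡⟨ sumF-swap (λ u v → if X u then (if Y v then f u v else 0) else 0) ⟩
  sumF (λ v → sumF (λ u → if X u then (if Y v then f u v else 0) else 0))
    ≡⟨ sumF-cong (λ v → trans (sumF-cong (λ u → flip-if (X u) (Y v))) (sym (push (Y v) (λ u → if X u then f u v else 0)))) ⟩
  sumOver Y (λ v → sumOver X (λ u → f u v)) ∎
  where
  open ≡-Reasoning
  push : ∀ {k} b (g : Fin k → ℕ) → (if b then sumF g else 0) ≡ sumF (λ i → if b then g i else 0)
  push {k} true  g = refl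
  push {k} false g = sym (sumF-zero k)
  flip-if : ∀ a b {x : ℕ} →
    (if a then (if b then x else 0) else 0) ≡ (if b then (if a then x else 0) else 0)
  flip-if true  b     = refl
  flip-if false true  = refl
  flip-if false false = refl

sumOver-sumF-swap : ∀ {m n} (X : Fin m → Bool) (f : Fin m → Fin n → ℕ) →
  sumOver X (λ u → sumF (f u)) ≡ sumF (λ v → sumOver X (λ u → f u v))
sumOver-sumF-swap X f = trans (sumF-cong (λ u → push (X u) (f u))) (sumF-swap (λ u v → if X u then f u v else 0))
  where
  push : ∀ {k} b (g : Fin k → ℕ) → (if b then sumF g else 0) ≡ sumF (λ i → if b then g i else 0)
  push {k} true  g = refl
  push {k} false g = sym (sumF-zero k)

sumOver-∧ : ∀ {n} (X Y : Fin n → Bool) (f : Fin n → ℕ) →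
  sumOver (λ u → X u ∧ Y u) f ≡ sumOver X (λ u → if Y u then f u else 0)
sumOver-∧ X Y f = sumF-cong (λ u → aux (X u) (Y u))
  where
  aux : ∀ a b {x : ℕ} → (if a ∧ b then x else 0) ≡ (if a then (if b then x else 0) else 0)
  aux true  b = refl
  aux false b = refl

sumOver-<⇒∃< : ∀ {n} (X : Fin n → Bool) (f g : Fin n → ℕ) → sumOver X f < sumOver X g →
  ∃ λ u → X u ≡ true × f u < g u
sumOver-<⇒∃< X f g lt with sumF-<⇒∃< (λ u → if X u then f u else 0) (λ u → if X u then g u else 0) lt
... | u , p = u , aux (X u) p
  where
  aux : ∀ b → (if b then f u else 0) < (if b then g u else 0) → b ≡ true × f u < g u
  aux true p = refl , p

-- Decidable quantifiers, equality and subsets of Fin n as Booleans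

anyF : ∀ {n} → (Fin n → Bool) → Bool
anyF {zero}  p = false
anyF {suc n} p = p zero ∨ anyF (λ i → p (suc i))

anyF-intro : ∀ {n} (p : Fin n → Bool) i → p i ≡ true → anyF p ≡ true
anyF-intro p zero    e rewrite e = refl
anyF-intro p (suc i) e with p zero
... | true  = refl
... | false = anyF-intro (λ j → p (suc j)) i e

anyF-elim : ∀ {n} (p : Fin n → Bool) → anyF p ≡ true → ∃ λ i → p i ≡ true
anyF-elim {suc n} p e with p zero in e₀
... | true  = zero , e₀
... | false = let (i , q) = anyF-elim (λ j → p (suc j)) e in suc i , q

anyF-false : ∀ {n} (p : Fin n → Bool) → anyF p ≡ false → ∀ i → p i ≡ false
anyF-false p e i = ≢true⇒≡false (λ q → true≢false (anyF-intro p i q) e)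

allF : ∀ {n} → (Fin n → Bool) → Bool
allF {zero}  p = true
allF {suc n} p = p zero ∧ allF (λ i → p (suc i))

allF-intro : ∀ {n} (p : Fin n → Bool) → (∀ i → p i ≡ true) → allF p ≡ true
allF-intro {zero}  p h = refl
allF-intro {suc n} p h = ∧-join (h zero) (allF-intro _ (λ i → h (suc i)))

allF-elim : ∀ {n} (p : Fin n → Bool) → allF p ≡ true → ∀ i → p i ≡ true
allF-elim p e zero    = proj₁ (∧-split e)
allF-elim p e (suc i) = allF-elim (λ j → p (suc j)) (proj₂ (∧-split {p zero} e)) i

_==_ : ∀ {n} → Fin n → Fin n → Bool
zero  == zero  = true
zero  == suc j = false
suc i == zero  = false
suc i == suc j = i == j

==-refl : ∀ {n} (i : Fin n) → (i == i) ≡ true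
==-refl zero    = refl
==-refl (suc i) = ==-refl i

==⇒≡ : ∀ {n} (i j : Fin n) → (i == j) ≡ true → i ≡ j
==⇒≡ zero    zero    e = refl
==⇒≡ (suc i) (suc j) e = cong suc (==⇒≡ i j e)

≢⇒==false : ∀ {n} {i j : Fin n} → i ≢ j → (i == j) ≡ false
≢⇒==false {i = i} {j} h = ≢true⇒≡false (λ e → h (==⇒≡ i j e))

==false⇒≢ : ∀ {n} {i j : Fin n} → (i == j) ≡ false → i ≢ j
==false⇒≢ {i = i} e refl = true≢false (==-refl i) e

∅ : ∀ {n} → Fin n → Bool
∅ _ = false

insert : ∀ {n} → Fin n → (Fin n → Bool) → Fin n → Bool
insert j W i = (j == i) ∨ W i

insert-elim : ∀ {n} (j : Fin n) W i → insert j W i ≡ true → i ≡ j ⊎ W i ≡ true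
insert-elim j W i e with j == i in q
... | true  = inj₁ (sym (==⇒≡ j i q))
... | false = inj₂ e

insert-here : ∀ {n} (j : Fin n) W → insert j W j ≡ true
insert-here j W rewrite ==-refl j = refl

insert-there : ∀ {n} (j : Fin n) W i → W i ≡ true → insert j W i ≡ true
insert-there j W i e with j == i
... | true  = refl
... | false = e

countF-insert : ∀ {n} (j : Fin n) W → W j ≡ false → countF (insert j W) ≡ suc (countF W)
countF-insert zero    W e rewrite e = refl
countF-insert (suc j) W e =
  trans (cong (𝟙 (W zero) +_) (countF-insert j (λ i → W (suc i)) e)) (+-suc _ _)

countF-insert≤ : ∀ {n} (j : Fin n) W → countF (insert j W) ≤ suc (countF W)
countF-insert≤ {suc n} zero W with W zero
... | true  = n≤1+n _
... | false = ≤-refl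
countF-insert≤ (suc j) W =
  ≤-trans (+-monoʳ-≤ (𝟙 (W zero)) (countF-insert≤ j (λ i → W (suc i)))) (≤-reflexive (+-suc _ _))

countF-∅ : ∀ n → countF {n} ∅ ≡ 0
countF-∅ n = sumF-zero n

_⊆ᵇ_ : ∀ {n} → (Fin n → Bool) → (Fin n → Bool) → Bool
_⊆ᵇ_ {zero}  W S = true
_⊆ᵇ_ {suc n} W S = (not (W zero) ∨ S zero) ∧ ((λ i → W (suc i)) ⊆ᵇ (λ i → S (suc i)))

⊆ᵇ-intro : ∀ {n} (W S : Fin n → Bool) → (∀ i → W i ≡ true → S i ≡ true) → (W ⊆ᵇ S) ≡ true
⊆ᵇ-intro {zero}  W S h = refl
⊆ᵇ-intro {suc n} W S h = ∧-join (aux (W zero) (h zero)) (⊆ᵇ-intro _ _ (λ i → h (suc i)))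
  where
  aux : ∀ b {c} → (b ≡ true → c ≡ true) → not b ∨ c ≡ true
  aux true  h = h refl
  aux false h = refl

⊆ᵇ-elim : ∀ {n} (W S : Fin n → Bool) → (W ⊆ᵇ S) ≡ true → ∀ i → W i ≡ true → S i ≡ true
⊆ᵇ-elim W S e zero    w with ∧-split {not (W zero) ∨ S zero} e
... | p , q rewrite w = p
⊆ᵇ-elim W S e (suc i) w = ⊆ᵇ-elim _ _ (proj₂ (∧-split {not (W zero) ∨ S zero} e)) i w

≤ᵇ-intro : ∀ {a b} → a ≤ b → (a ≤ᵇ b) ≡ true
≤ᵇ-intro {a} {b} p with a ≤ᵇ b | ≤⇒≤ᵇ p
... | true | _ = refl

≤ᵇ-elim : ∀ {a b} → (a ≤ᵇ b) ≡ true → a ≤ b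
≤ᵇ-elim {a} {b} e = ≤ᵇ⇒≤ a b (subst Data.Bool.T (sym e) tt)

≡ᵇ-intro : ∀ {a b} → a ≡ b → (a ≡ᵇ b) ≡ true
≡ᵇ-intro {a} {b} p with a ≡ᵇ b | ≡⇒≡ᵇ a b p
... | true | _ = refl

≡ᵇ-elim : ∀ {a b} → (a ≡ᵇ b) ≡ true → a ≡ b
≡ᵇ-elim {a} {b} e = ≡ᵇ⇒≡ a b (subst Data.Bool.T (sym e) tt)

<ᵇ-intro : ∀ {a b} → a < b → (a <ᵇ b) ≡ true
<ᵇ-intro {a} {b} p with a <ᵇ b | <⇒<ᵇ p
... | true | _ = refl

<ᵇ-elim : ∀ {a b} → (a <ᵇ b) ≡ true → a < b
<ᵇ-elim {a} {b} e = <ᵇ⇒< a b (subst Data.Bool.T (sym e) tt)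

<ᵇ-false : ∀ {a b} → (a <ᵇ b) ≡ false → b ≤ a
<ᵇ-false e = ≮⇒≥ (λ p → true≢false (<ᵇ-intro p) e)

-- Sizes of images of finite families

image : ∀ {k n} → (Fin k → Fin n) → Fin n → Bool
image f v = anyF (λ i → f i == v)

image-intro : ∀ {k n} (f : Fin k → Fin n) i → image f (f i) ≡ true
image-intro f i = anyF-intro (λ j → f j == f i) i (==-refl (f i))

image-elim : ∀ {k n} (f : Fin k → Fin n) v → image f v ≡ true → ∃ λ i → f i ≡ v
image-elim f v e = let (i , q) = anyF-elim (λ j → f j == v) e in i , ==⇒≡ (f i) v q

countF-image≤ : ∀ {k n} (f : Fin k → Fin n) → countF (image f) ≤ k
countF-image≤ {zero}  {n} f = ≤-reflexive (sumF-zero n)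
countF-image≤ {suc k} f =
  ≤-trans (countF-insert≤ (f zero) (image (λ i → f (suc i)))) (s≤s (countF-image≤ (λ i → f (suc i))))

countF-image : ∀ {k n} (f : Fin k → Fin n) → Injective _≡_ _≡_ f → countF (image f) ≡ k
countF-image {zero}  {n} f inj = sumF-zero n
countF-image {suc k} f inj =
  trans (countF-insert (f zero) (image (λ i → f (suc i))) fresh)
        (cong suc (countF-image (λ i → f (suc i)) (λ e → Fin.suc-injective (inj e))))
  where
  fresh : image (λ i → f (suc i)) (f zero) ≡ false
  fresh = ≢true⇒≡false λ e → case image-elim (λ i → f (suc i)) (f zero) e of λ (i , q) →
    case inj q of λ ()

injection⇒≤countF : ∀ {k n} (P : Fin n → Bool) (f : Fin k → Fin n) → Injective _≡_ _≡_ f →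
  (∀ i → P (f i) ≡ true) → k ≤ countF P
injection⇒≤countF P f inj h = subst (_≤ countF P) (countF-image f inj)
  (countF-mono λ v e → let (i , q) = image-elim f v e in subst (λ x → P x ≡ true) q (h i))

≤countF⇒injection : ∀ {n} (P : Fin n → Bool) k → k ≤ countF P →
  ∃ λ (f : Fin k → Fin n) → Injective _≡_ _≡_ f × (∀ i → P (f i) ≡ true)
≤countF⇒injection P zero h = (λ ()) , (λ {}) , λ ()
≤countF⇒injection {suc n} P (suc k) h with P zero in e
... | false = let (f , inj , p) = ≤countF⇒injection (λ i → P (suc i)) (suc k) h in
  (λ i → suc (f i)) , (λ q → inj (Fin.suc-injective q)) , p
... | true with ≤countF⇒injection (λ i → P (suc i)) k (≤-pred h)
...   | f , inj , p = g , (λ {x} {y} → g-inj x y) , g-in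
  where
  g : Fin (suc k) → Fin (suc n)
  g zero    = zero
  g (suc i) = suc (f i)
  g-inj : ∀ x y → g x ≡ g y → x ≡ y
  g-inj zero    zero    q = refl
  g-inj (suc x) (suc y) q = cong suc (inj (Fin.suc-injective q))
  g-in : ∀ i → P (g i) ≡ true
  g-in zero    = e
  g-in (suc i) = p i

1≤countF⇒∃ : ∀ {n} (P : Fin n → Bool) → 1 ≤ countF P → ∃ λ i → P i ≡ true
1≤countF⇒∃ P h = let (f , _ , p) = ≤countF⇒injection P 1 h in f zero , p zero

∃⇒1≤countF : ∀ {n} (P : Fin n → Bool) i → P i ≡ true → 1 ≤ countF P
∃⇒1≤countF P i e = ≤-trans (𝟙-true e) (sumF-member (λ j → 𝟙 (P j)) i)

allF-false : ∀ {n} (p : Fin n → Bool) → allF p ≡ false → ∃ λ i → p i ≡ false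
allF-false {suc n} p e with p zero in e₀
... | false = zero , e₀
... | true  = let (i , q) = allF-false (λ i → p (suc i)) e in suc i , q

∨-elim : ∀ {a b} → a ∨ b ≡ true → a ≡ true ⊎ b ≡ true
∨-elim {true}  e = inj₁ refl
∨-elim {false} e = inj₂ e

∨-introˡ : ∀ {a b} → a ≡ true → a ∨ b ≡ true
∨-introˡ refl = refl

∨-introʳ : ∀ {a b} → b ≡ true → a ∨ b ≡ true
∨-introʳ {true}  e = refl
∨-introʳ {false} e = e

-- Powers

^-distribʳ-* : ∀ r a b → (a * b) ^ r ≡ a ^ r * b ^ r
^-distribʳ-* zero    a b = refl
^-distribʳ-* (suc r) a b = trans (cong (a * b *_) (^-distribʳ-* r a b)) (interchange a b (a ^ r) (b ^ r))
  where
  interchange : ∀ a b c d → a * b * (c * d) ≡ a * c * (b * d)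
  interchange = solve-∀

-- Only the difference of the two exponents matters. Avoiding subtraction lets each estimate be
-- adapted by an identity between sums of exponents.
rescale : ∀ T .{{_ : NonZero T}} a b c d {l p} → T ^ a * l ≤ T ^ b * p → c + b ≤ d + a →
  T ^ c * l ≤ T ^ d * p
rescale T a b c d {l} {p} h e = *-cancelˡ-≤ (T ^ a) {{m^n≢0 T a}} (begin
  T ^ a * (T ^ c * l) ≡⟨ swap₃ (T ^ a) (T ^ c) l ⟩
  T ^ c * (T ^ a * l) ≤⟨ *-monoʳ-≤ (T ^ c) h ⟩
  T ^ c * (T ^ b * p) ≡⟨ merge (T ^ c) (T ^ b) p (^-distribˡ-+-* T c b) ⟩
  T ^ (c + b) * p ≤⟨ *-monoˡ-≤ p (^-monoʳ-≤ T e) ⟩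
  T ^ (d + a) * p ≡⟨ sym (merge (T ^ d) (T ^ a) p (^-distribˡ-+-* T d a)) ⟩
  T ^ d * (T ^ a * p) ≡⟨ swap₃ (T ^ d) (T ^ a) p ⟩
  T ^ a * (T ^ d * p) ∎)
  where
  open ≤-Reasoning
  swap₃ : ∀ a b c → a * (b * c) ≡ b * (a * c)
  swap₃ = solve-∀
  merge : ∀ x y p {z} → z ≡ x * y → x * (y * p) ≡ z * p
  merge x y p refl = sym (*-assoc x y p)

-- 𝔼 c f is (1+c)ⁿ times the expectation of f S when every element of Fin n belongs to the random
-- set S independently with probability 1/(1+c).

_◁_ : ∀ {n} → Bool → (Fin n → Bool) → Fin (suc n) → Bool
(b ◁ S) zero    = b
(b ◁ S) (suc i) = S i

𝔼 : ∀ {n} → ℕ → ((Fin n → Bool) → ℕ) → ℕ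
𝔼 {zero}  c f = f ∅
𝔼 {suc n} c f = 𝔼 c (λ S → f (true ◁ S)) + c * 𝔼 c (λ S → f (false ◁ S))

𝔼-mono : ∀ {n} c {f g : (Fin n → Bool) → ℕ} → (∀ S → f S ≤ g S) → 𝔼 c f ≤ 𝔼 c g
𝔼-mono {zero}  c h = h ∅
𝔼-mono {suc n} c h =
  +-mono-≤ (𝔼-mono c (λ S → h (true ◁ S))) (*-monoʳ-≤ c (𝔼-mono c (λ S → h (false ◁ S))))

𝔼-cong : ∀ {n} c {f g : (Fin n → Bool) → ℕ} → (∀ S → f S ≡ g S) → 𝔼 c f ≡ 𝔼 c g
𝔼-cong {zero}  c h = h ∅
𝔼-cong {suc n} c h =
  cong₂ _+_ (𝔼-cong c (λ S → h (true ◁ S))) (cong (c *_) (𝔼-cong c (λ S → h (false ◁ S))))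

𝔼-+ : ∀ {n} c (f g : (Fin n → Bool) → ℕ) → 𝔼 c (λ S → f S + g S) ≡ 𝔼 c f + 𝔼 c g
𝔼-+ {zero}  c f g = refl
𝔼-+ {suc n} c f g
  rewrite 𝔼-+ c (λ S → f (true ◁ S)) (λ S → g (true ◁ S))
        | 𝔼-+ c (λ S → f (false ◁ S)) (λ S → g (false ◁ S)) =
  rearrange c (𝔼 c (λ S → f (true ◁ S))) (𝔼 c (λ S → g (true ◁ S)))
              (𝔼 c (λ S → f (false ◁ S))) (𝔼 c (λ S → g (false ◁ S)))
  where
  rearrange : ∀ c x y z w → x + y + c * (z + w) ≡ x + c * z + (y + c * w)
  rearrange = solve-∀

𝔼-*ˡ : ∀ {n} c x (f : (Fin n → Bool) → ℕ) → 𝔼 c (λ S → x * f S) ≡ x * 𝔼 c f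
𝔼-*ˡ {zero}  c x f = refl
𝔼-*ˡ {suc n} c x f
  rewrite 𝔼-*ˡ c x (λ S → f (true ◁ S)) | 𝔼-*ˡ c x (λ S → f (false ◁ S)) =
  rearrange c x (𝔼 c (λ S → f (true ◁ S))) (𝔼 c (λ S → f (false ◁ S)))
  where
  rearrange : ∀ c x y z → x * y + c * (x * z) ≡ x * (y + c * z)
  rearrange = solve-∀

𝔼-const : ∀ {n} c x → 𝔼 {n} c (λ _ → x) ≡ x * suc c ^ n
𝔼-const {zero}  c x = sym (*-identityʳ x)
𝔼-const {suc n} c x rewrite 𝔼-const {n} c x = rearrange c x (suc c ^ n)
  where
  rearrange : ∀ c x y → x * y + c * (x * y) ≡ x * ((1 + c) * y)
  rearrange = solve-∀

𝔼-sumF : ∀ {n m} c (f : Fin m → (Fin n → Bool) → ℕ) →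
  𝔼 c (λ S → sumF (λ i → f i S)) ≡ sumF (λ i → 𝔼 c (f i))
𝔼-sumF {n} {zero} c f = trans (𝔼-const {n} c 0) refl
𝔼-sumF {m = suc m} c f =
  trans (𝔼-+ c (f zero) (λ S → sumF (λ i → f (suc i) S)))
        (cong (𝔼 c (f zero) +_) (𝔼-sumF c (λ i → f (suc i))))

𝔼-sumOver : ∀ {n m} c (X : Fin m → Bool) (f : Fin m → (Fin n → Bool) → ℕ) →
  𝔼 c (λ S → sumOver X (λ i → f i S)) ≡ sumOver X (λ i → 𝔼 c (f i))
𝔼-sumOver {n} c X f =
  trans (𝔼-sumF c (λ i S → if X i then f i S else 0)) (sumF-cong (λ i → aux (X i) (f i)))
  where
  aux : ∀ b (g : (Fin n → Bool) → ℕ) → 𝔼 c (λ S → if b then g S else 0) ≡ (if b then 𝔼 c g else 0)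
  aux true  g = refl
  aux false g = 𝔼-const {n} c 0

𝔼-*-sumOver : ∀ {n m} c M (X : Fin m → Bool) (f : Fin m → (Fin n → Bool) → ℕ) →
  M * 𝔼 c (λ S → sumOver X (λ i → f i S)) ≡ sumOver X (λ i → M * 𝔼 c (f i))
𝔼-*-sumOver c M X f = trans (cong (M *_) (𝔼-sumOver c X f)) (sym (sumOver-*ˡ X M (λ i → 𝔼 c (f i))))

𝔼-<⇒∃< : ∀ {n} c (f g : (Fin n → Bool) → ℕ) → 𝔼 c f < 𝔼 c g → ∃ λ S → f S < g S
𝔼-<⇒∃< {zero}  c f g lt = ∅ , lt
𝔼-<⇒∃< {suc n} c f g lt with 𝔼 c (λ S → f (true ◁ S)) <? 𝔼 c (λ S → g (true ◁ S))
... | yes p = let (S , q) = 𝔼-<⇒∃< c (λ S → f (true ◁ S)) (λ S → g (true ◁ S)) p in true ◁ S , q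
... | no ¬p with 𝔼 c (λ S → f (false ◁ S)) <? 𝔼 c (λ S → g (false ◁ S))
...   | yes p = let (S , q) = 𝔼-<⇒∃< c (λ S → f (false ◁ S)) (λ S → g (false ◁ S)) p in false ◁ S , q
...   | no ¬q = contradiction lt (≤⇒≯ (+-mono-≤ (≮⇒≥ ¬p) (*-monoʳ-≤ c (≮⇒≥ ¬q))))

-- Adding 1 to `g` reduces this to the strict version, because the total weight `suc c ^ n` is
-- positive.
𝔼-≤⇒∃≤ : ∀ {n} c (f g : (Fin n → Bool) → ℕ) → 𝔼 c f ≤ 𝔼 c g → ∃ λ S → f S ≤ g S
𝔼-≤⇒∃≤ {n} c f g le = let (S , p) = 𝔼-<⇒∃< c f (λ S → 1 + g S) lt in S , ≤-pred p
  where
  open ≤-Reasoning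
  lt : 𝔼 c f < 𝔼 c (λ S → 1 + g S)
  lt = begin-strict
    𝔼 c f ≤⟨ le ⟩
    𝔼 c g <⟨ m<n+m (𝔼 c g) (m^n>0 (suc c) n) ⟩
    suc c ^ n + 𝔼 c g ≡⟨ cong (_+ 𝔼 c g) (trans (sym (*-identityˡ _)) (sym (𝔼-const {n} c 1))) ⟩
    𝔼 {n} c (λ _ → 1) + 𝔼 c g ≡⟨ sym (𝔼-+ c (λ _ → 1) g) ⟩
    𝔼 c (λ S → 1 + g S) ∎

-- Each coordinate in `W` contributes weight 1 instead of `1 + c`: the probability of containment is
-- `(1 + c) ^ -|W|`, cleared of its denominator.
𝔼-⊆ : ∀ {n} c (W : Fin n → Bool) → 𝔼 c (λ S → 𝟙 (W ⊆ᵇ S)) * suc c ^ countF W ≡ suc c ^ n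
𝔼-⊆ {zero}  c W = refl
𝔼-⊆ {suc n} c W with W zero
... | true  = trans (rearrange c (𝔼 c (λ S → 𝟙 (W′ ⊆ᵇ S))) (𝔼 {n} c (λ _ → 0)) (suc c ^ countF W′) (𝔼-const {n} c 0))
                    (cong (suc c *_) (𝔼-⊆ c W′))
  where
  W′ : Fin n → Bool
  W′ i = W (suc i)
  rearrange : ∀ c x z y → z ≡ 0 → (x + c * z) * ((1 + c) * y) ≡ (1 + c) * (x * y)
  rearrange c x .0 y refl = solve c x y
    where
    solve : ∀ c x y → (x + c * 0) * ((1 + c) * y) ≡ (1 + c) * (x * y)
    solve = solve-∀
... | false = trans (rearrange c (𝔼 c (λ S → 𝟙 (W′ ⊆ᵇ S))) (suc c ^ countF W′)) (cong (suc c *_) (𝔼-⊆ c W′))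
  where
  W′ : Fin n → Bool
  W′ i = W (suc i)
  rearrange : ∀ c x y → (x + c * x) * y ≡ (1 + c) * (x * y)
  rearrange = solve-∀

countF-∩ : ∀ {n} → (Fin n → Bool) → (Fin n → Bool) → ℕ
countF-∩ P S = countF (λ x → P x ∧ S x)

private
  -- One new element of `P`: if it is sampled, the threshold drops from `suc i` to `i`, otherwise it
  -- stays. The two bounds add up because `p ^ i + p ^ suc i ≤ suc p ^ suc i`.
  tail-step : ∀ c a b i p X Y → a * (suc c ^ i * X) ≤ p ^ i * Y →
    b * (suc c ^ suc i * X) ≤ p ^ suc i * Y →
    (a + c * b) * (suc c ^ suc i * X) ≤ suc p ^ suc i * (suc c * Y)
  tail-step c a b i p X Y ha hb = begin
    (a + c * b) * (suc c ^ suc i * X)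
      ≡⟨ rearrange₁ c a b (suc c ^ i) X ⟩
    suc c * (a * (suc c ^ i * X)) + c * (b * (suc c ^ suc i * X))
      ≤⟨ +-mono-≤ (*-monoʳ-≤ (suc c) ha) (≤-trans (*-monoʳ-≤ c hb) (*-monoˡ-≤ (p ^ suc i * Y) (n≤1+n c))) ⟩
    suc c * (p ^ i * Y) + suc c * (p ^ suc i * Y)
      ≡⟨ rearrange₂ c p (p ^ i) Y ⟩
    suc p * p ^ i * (suc c * Y)
      ≤⟨ *-monoˡ-≤ (suc c * Y) (*-monoʳ-≤ (suc p) (^-monoˡ-≤ i (n≤1+n p))) ⟩
    suc p ^ suc i * (suc c * Y) ∎
    where
    open ≤-Reasoning
    rearrange₁ : ∀ c a b m X →
      (a + c * b) * ((1 + c) * m * X) ≡ (1 + c) * (a * (m * X)) + c * (b * ((1 + c) * m * X))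
    rearrange₁ = solve-∀
    rearrange₂ : ∀ c p q Y → (1 + c) * (q * Y) + (1 + c) * (p * q * Y) ≡ (1 + p) * q * ((1 + c) * Y)
    rearrange₂ = solve-∀

-- For disjoint sets the two tails are independent, so the union bounds over `i`-subsets of `P` and
-- `j`-subsets of `Q` multiply. Induction on the ground set avoids binomial coefficients.
𝔼-tails : ∀ {n} c i j (P Q : Fin n → Bool) → (∀ x → P x ≡ true → Q x ≡ false) →
  𝔼 c (λ S → 𝟙 (i ≤ᵇ countF-∩ P S) * 𝟙 (j ≤ᵇ countF-∩ Q S)) * (suc c ^ i * suc c ^ j)
    ≤ countF P ^ i * (countF Q ^ j * suc c ^ n)
𝔼-tails {zero} c zero    zero    P Q d = ≤-refl
𝔼-tails {zero} c zero    (suc j) P Q d = z≤n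
𝔼-tails {zero} c (suc i) j       P Q d = z≤n
𝔼-tails {suc n} c i₀ j₀ P Q d = cases i₀ j₀ (P zero) (Q zero) refl refl
  where
  open ≤-Reasoning
  P′ Q′ : Fin n → Bool
  P′ x = P (suc x)
  Q′ x = Q (suc x)
  t : ℕ → ℕ → ℕ
  t i j = 𝔼 c (λ S → 𝟙 (i ≤ᵇ countF-∩ P′ S) * 𝟙 (j ≤ᵇ countF-∩ Q′ S))
  ih : ∀ i j → t i j * (suc c ^ i * suc c ^ j) ≤ countF P′ ^ i * (countF Q′ ^ j * suc c ^ n)
  ih i j = 𝔼-tails c i j P′ Q′ (λ x → d (suc x))
  swap₃ : ∀ a b c → a * (b * c) ≡ b * (a * c)
  swap₃ = solve-∀
  drop : ∀ i {k} → 𝟙 (suc i ≤ᵇ suc k) ≤ 𝟙 (i ≤ᵇ k)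
  drop i = 𝟙-mono (λ e → ≤ᵇ-intro (≤-pred (≤ᵇ-elim {suc i} e)))
  cases : ∀ i j a b → P zero ≡ a → Q zero ≡ b →
    𝔼 c (λ S → 𝟙 (i ≤ᵇ countF-∩ P S) * 𝟙 (j ≤ᵇ countF-∩ Q S)) * (suc c ^ i * suc c ^ j)
      ≤ countF P ^ i * (countF Q ^ j * suc c ^ suc n)
  cases i j true  true  ep eq = ⊥-elim (true≢false eq (d zero ep))
  cases i j false false ep eq rewrite ep | eq = begin
    (t i j + c * t i j) * (suc c ^ i * suc c ^ j)
      ≡⟨ r₁ c (t i j) (suc c ^ i * suc c ^ j) ⟩
    suc c * (t i j * (suc c ^ i * suc c ^ j))
      ≤⟨ *-monoʳ-≤ (suc c) (ih i j) ⟩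
    suc c * (countF P′ ^ i * (countF Q′ ^ j * suc c ^ n))
      ≡⟨ r₂ (suc c) (countF P′ ^ i) (countF Q′ ^ j) (suc c ^ n) ⟩
    countF P′ ^ i * (countF Q′ ^ j * (suc c * suc c ^ n)) ∎
    where
    r₁ : ∀ c x y → (x + c * x) * y ≡ (1 + c) * (x * y)
    r₁ = solve-∀
    r₂ : ∀ m x y z → m * (x * (y * z)) ≡ x * (y * (m * z))
    r₂ = solve-∀
  cases zero j true false ep eq rewrite eq = begin
    (t 0 j + c * t 0 j) * (1 * suc c ^ j)
      ≡⟨ r₁ c (t 0 j) (suc c ^ j) ⟩
    suc c * (t 0 j * (1 * suc c ^ j))
      ≤⟨ *-monoʳ-≤ (suc c) (ih 0 j) ⟩
    suc c * (1 * (countF Q′ ^ j * suc c ^ n))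
      ≡⟨ r₂ (suc c) (countF Q′ ^ j) (suc c ^ n) ⟩
    1 * (countF Q′ ^ j * (suc c * suc c ^ n)) ∎
    where
    r₁ : ∀ c x y → (x + c * x) * (1 * y) ≡ (1 + c) * (x * (1 * y))
    r₁ = solve-∀
    r₂ : ∀ m y z → m * (1 * (y * z)) ≡ 1 * (y * (m * z))
    r₂ = solve-∀
  cases (suc i) j true false ep eq rewrite ep | eq = begin
    (𝔼 c (λ S → 𝟙 (suc i ≤ᵇ suc (countF-∩ P′ S)) * 𝟙 (j ≤ᵇ countF-∩ Q′ S)) + c * t (suc i) j)
      * (suc c ^ suc i * suc c ^ j)
      ≤⟨ *-monoˡ-≤ (suc c ^ suc i * suc c ^ j)
           (+-monoˡ-≤ (c * t (suc i) j)
             (𝔼-mono c (λ S → *-monoˡ-≤ (𝟙 (j ≤ᵇ countF-∩ Q′ S)) (drop i)))) ⟩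
    (t i j + c * t (suc i) j) * (suc c ^ suc i * suc c ^ j)
      ≤⟨ tail-step c (t i j) (t (suc i) j) i (countF P′) (suc c ^ j) (countF Q′ ^ j * suc c ^ n)
           (ih i j) (ih (suc i) j) ⟩
    suc (countF P′) ^ suc i * (suc c * (countF Q′ ^ j * suc c ^ n))
      ≡⟨ cong (suc (countF P′) ^ suc i *_) (swap₃ (suc c) (countF Q′ ^ j) (suc c ^ n)) ⟩
    suc (countF P′) ^ suc i * (countF Q′ ^ j * (suc c * suc c ^ n)) ∎
  cases i zero false true ep eq rewrite ep = begin
    (t i 0 + c * t i 0) * (suc c ^ i * 1)
      ≡⟨ r₁ c (t i 0) (suc c ^ i) ⟩
    suc c * (t i 0 * (suc c ^ i * 1))
      ≤⟨ *-monoʳ-≤ (suc c) (ih i 0) ⟩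
    suc c * (countF P′ ^ i * (1 * suc c ^ n))
      ≡⟨ r₂ (suc c) (countF P′ ^ i) (suc c ^ n) ⟩
    countF P′ ^ i * (1 * (suc c * suc c ^ n)) ∎
    where
    r₁ : ∀ c x y → (x + c * x) * (y * 1) ≡ (1 + c) * (x * (y * 1))
    r₁ = solve-∀
    r₂ : ∀ m y z → m * (y * (1 * z)) ≡ y * (1 * (m * z))
    r₂ = solve-∀
  cases i (suc j) false true ep eq rewrite ep | eq = begin
    (𝔼 c (λ S → 𝟙 (i ≤ᵇ countF-∩ P′ S) * 𝟙 (suc j ≤ᵇ suc (countF-∩ Q′ S))) + c * t i (suc j))
      * (suc c ^ i * suc c ^ suc j)
      ≤⟨ *-monoˡ-≤ (suc c ^ i * suc c ^ suc j)
           (+-monoˡ-≤ (c * t i (suc j))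
             (𝔼-mono c (λ S → *-monoʳ-≤ (𝟙 (i ≤ᵇ countF-∩ P′ S)) (drop j)))) ⟩
    (t i j + c * t i (suc j)) * (suc c ^ i * suc c ^ suc j)
      ≡⟨ cong ((t i j + c * t i (suc j)) *_) (*-comm (suc c ^ i) (suc c ^ suc j)) ⟩
    (t i j + c * t i (suc j)) * (suc c ^ suc j * suc c ^ i)
      ≤⟨ tail-step c (t i j) (t i (suc j)) j (countF Q′) (suc c ^ i) (countF P′ ^ i * suc c ^ n)
           (flipped j) (flipped (suc j)) ⟩
    suc (countF Q′) ^ suc j * (suc c * (countF P′ ^ i * suc c ^ n))
      ≡⟨ r (suc (countF Q′) ^ suc j) (suc c) (countF P′ ^ i) (suc c ^ n) ⟩
    countF P′ ^ i * (suc (countF Q′) ^ suc j * (suc c * suc c ^ n)) ∎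
    where
    r : ∀ a m x y → a * (m * (x * y)) ≡ x * (a * (m * y))
    r = solve-∀
    flipped : ∀ j → t i j * (suc c ^ j * suc c ^ i) ≤ countF Q′ ^ j * (countF P′ ^ i * suc c ^ n)
    flipped j = subst₂ _≤_ (cong (t i j *_) (*-comm (suc c ^ i) (suc c ^ j)))
      (swap₃ (countF P′ ^ i) (countF Q′ ^ j) (suc c ^ n)) (ih i j)

𝔼-single : ∀ {n} c (u : Fin n) → 𝔼 c (λ S → 𝟙 (S u)) * suc c ≡ suc c ^ n
𝔼-single {n} c u = begin
  𝔼 c (λ S → 𝟙 (S u)) * suc c
    ≡⟨ cong₂ _*_ (𝔼-cong c (λ S → cong 𝟙 (same S)))
         (sym (trans (cong (suc c ^_) size₁) (*-identityʳ (suc c)))) ⟩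
  𝔼 c (λ S → 𝟙 (insert u ∅ ⊆ᵇ S)) * suc c ^ countF (insert u ∅)
    ≡⟨ 𝔼-⊆ c (insert u ∅) ⟩
  suc c ^ n ∎
  where
  open ≡-Reasoning
  size₁ : countF (insert u ∅) ≡ 1
  size₁ = trans (countF-insert u ∅ refl) (cong suc (countF-∅ n))
  same : ∀ S → S u ≡ (insert u ∅ ⊆ᵇ S)
  same S = Bool-ext
    (λ e → ⊆ᵇ-intro _ S (λ i q → case insert-elim u ∅ i q of λ { (inj₁ refl) → e }))
    (λ e → ⊆ᵇ-elim (insert u ∅) S e u (insert-here u ∅))

𝔼-members : ∀ {n} c (X : Fin n → Bool) → suc c * 𝔼 c (λ S → sumOver X (λ v → 𝟙 (S v))) ≡ countF X * suc c ^ n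
𝔼-members {n} c X = begin
  suc c * 𝔼 c (λ S → sumOver X (λ v → 𝟙 (S v)))
    ≡⟨ 𝔼-*-sumOver c (suc c) X (λ v S → 𝟙 (S v)) ⟩
  sumOver X (λ v → suc c * 𝔼 {n} c (λ S → 𝟙 (S v)))
    ≡⟨ sumOver-cong X (λ v → trans (*-comm (suc c) _) (𝔼-single c v)) ⟩
  sumOver X (λ v → suc c ^ n)
    ≡⟨ sumOver-const X (suc c ^ n) ⟩
  countF X * suc c ^ n ∎
  where open ≡-Reasoning

𝔼-pair : ∀ {n} c (u v : Fin n) → u ≢ v → 𝔼 c (λ S → 𝟙 (S u ∧ S v)) * (suc c * suc c) ≡ suc c ^ n
𝔼-pair {n} c u v u≢v = begin
  𝔼 c (λ S → 𝟙 (S u ∧ S v)) * (suc c * suc c)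
    ≡⟨ cong₂ _*_ (𝔼-cong c (λ S → cong 𝟙 (same S)))
         (sym (trans (cong (suc c ^_) size₂) (cong (suc c *_) (*-identityʳ (suc c))))) ⟩
  𝔼 c (λ S → 𝟙 (W ⊆ᵇ S)) * suc c ^ countF W
    ≡⟨ 𝔼-⊆ c W ⟩
  suc c ^ n ∎
  where
  open ≡-Reasoning
  W : Fin n → Bool
  W = insert u (insert v ∅)
  fresh : insert v ∅ u ≡ false
  fresh = ≢true⇒≡false λ e → case insert-elim v ∅ u e of λ { (inj₁ q) → u≢v q }
  size₂ : countF W ≡ 2
  size₂ = trans (countF-insert u (insert v ∅) fresh)
    (cong suc (trans (countF-insert v ∅ refl) (cong suc (countF-∅ n))))
  same : ∀ S → (S u ∧ S v) ≡ (W ⊆ᵇ S)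
  same S = Bool-ext
    (λ e → ⊆ᵇ-intro W S (λ i q → case insert-elim u (insert v ∅) i q of λ
      { (inj₁ refl) → proj₁ (∧-split e)
      ; (inj₂ q′) → case insert-elim v ∅ i q′ of λ { (inj₁ refl) → proj₂ (∧-split {S u} e) } }))
    (λ e → ∧-join (⊆ᵇ-elim W S e u (insert-here u (insert v ∅)))
      (⊆ᵇ-elim W S e v (insert-there u (insert v ∅) v (insert-here v ∅))))

-- Thinning a conflict graph

conflicts : ∀ {n} → (Fin n → Fin n → Bool) → (Fin n → Bool) → ℕ
conflicts R C = sumOver C (λ u → countF (λ v → C v ∧ R u v))

-- Keep each element of C with probability 1/(1+c) and then discard every kept element that is in
-- conflict with another one.
turán : ∀ {n} (R : Fin n → Fin n → Bool) → (∀ v → R v v ≡ false) → ∀ (C : Fin n → Bool) c →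
  ∃ λ (I : Fin n → Bool) → (∀ u → I u ≡ true → C u ≡ true) ×
    (∀ u v → I u ≡ true → I v ≡ true → R u v ≡ false) ×
    suc c * countF C ≤ suc c * suc c * countF I + conflicts R C
turán {n} R irr C c =
  let (S , p) = 𝔼-≤⇒∃≤ {n} c (λ _ → suc c * countF C) (λ S → suc c * suc c * countF (I S) + conflicts R C) bound
  in I S , (λ u e → proj₁ (∧-split (proj₁ (∧-split e)))) , indep S , p
  where
  I : (Fin n → Bool) → Fin n → Bool
  I S u = (C u ∧ S u) ∧ not (anyF (λ v → (C v ∧ S v) ∧ R u v))
  indep : ∀ S u v → I S u ≡ true → I S v ≡ true → R u v ≡ false
  indep S u v eu ev = ≢true⇒≡false λ r → true≢false
    (anyF-intro (λ v → (C v ∧ S v) ∧ R u v) v (∧-join (proj₁ (∧-split ev)) r))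
    (not-true⁻¹ (proj₂ (∧-split {C u ∧ S u} eu)))
  bad : Fin n → (Fin n → Bool) → ℕ
  bad u S = sumOver (λ v → C v ∧ R u v) (λ v → 𝟙 (S u ∧ S v))
  -- A sampled element of `C` that is discarded has a sampled partner in conflict with it, and `bad`
  -- counts such partners.
  pointwise : ∀ S u → (if C u then 𝟙 (S u) else 0) ≤ 𝟙 (I S u) + (if C u then bad u S else 0)
  pointwise S u with C u
  ... | false = z≤n
  ... | true with S u
  ...   | false = z≤n
  ...   | true with anyF (λ v → (C v ∧ S v) ∧ R u v) in e
  ...     | false = m≤m+n 1 _
  ...     | true = let (v , q) = anyF-elim (λ v → (C v ∧ S v) ∧ R u v) e in
    ≤-trans (hit (C v) (S v) (R u v) q)
      (sumF-member (λ v → if C v ∧ R u v then 𝟙 (S v) else 0) v)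
    where
    hit : ∀ a b c → (a ∧ b) ∧ c ≡ true → 1 ≤ (if a ∧ c then 𝟙 b else 0)
    hit true true true q = ≤-refl
  w : ℕ
  w = suc c ^ n
  LL : ℕ
  LL = suc c * suc c
  size-𝔼 : LL * 𝔼 {n} c (λ S → sumOver C (λ u → 𝟙 (S u))) ≡ suc c * countF C * w
  size-𝔼 = trans (*-assoc (suc c) (suc c) _)
    (trans (cong (suc c *_) (𝔼-members c C)) (sym (*-assoc (suc c) (countF C) w)))
  bad-𝔼 : ∀ u → LL * 𝔼 c (bad u) ≡ countF (λ v → C v ∧ R u v) * w
  bad-𝔼 u = begin
    LL * 𝔼 c (bad u)
      ≡⟨ 𝔼-*-sumOver c LL CR (λ v S → 𝟙 (S u ∧ S v)) ⟩
    sumOver CR (λ v → LL * 𝔼 {n} c (λ S → 𝟙 (S u ∧ S v)))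
      ≡⟨ sumF-cong (λ v → aux v (CR v) refl) ⟩
    sumOver CR (λ _ → w)
      ≡⟨ sumOver-const CR w ⟩
    countF CR * w ∎
    where
    open ≡-Reasoning
    CR : Fin n → Bool
    CR v = C v ∧ R u v
    aux : ∀ v b → CR v ≡ b → (if b then LL * 𝔼 {n} c (λ S → 𝟙 (S u ∧ S v)) else 0) ≡ (if b then w else 0)
    aux v false e = refl
    aux v true  e = trans (*-comm LL _) (𝔼-pair c u v λ { refl →
      true≢false (proj₂ (∧-split {C u} e)) (irr u) })
  conf-𝔼 : LL * 𝔼 {n} c (λ S → sumOver C (λ u → bad u S)) ≡ conflicts R C * w
  conf-𝔼 = begin
    LL * 𝔼 {n} c (λ S → sumOver C (λ u → bad u S))
      ≡⟨ 𝔼-*-sumOver c LL C bad ⟩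
    sumOver C (λ u → LL * 𝔼 c (bad u))
      ≡⟨ sumOver-cong C (λ u → trans (bad-𝔼 u) (*-comm _ w)) ⟩
    sumOver C (λ u → w * countF (λ v → C v ∧ R u v))
      ≡⟨ sumOver-*ˡ C w (λ u → countF (λ v → C v ∧ R u v)) ⟩
    w * conflicts R C
      ≡⟨ *-comm w _ ⟩
    conflicts R C * w ∎
    where open ≡-Reasoning
  bound : 𝔼 {n} c (λ _ → suc c * countF C) ≤ 𝔼 c (λ S → LL * countF (I S) + conflicts R C)
  bound = begin
    𝔼 {n} c (λ _ → suc c * countF C)
      ≡⟨ 𝔼-const {n} c (suc c * countF C) ⟩
    suc c * countF C * w
      ≡⟨ sym size-𝔼 ⟩
    LL * 𝔼 {n} c (λ S → sumOver C (λ u → 𝟙 (S u)))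
      ≤⟨ *-monoʳ-≤ LL (𝔼-mono c (λ S → ≤-trans (sumF-mono (pointwise S))
           (≤-reflexive (sumF-+ (λ u → 𝟙 (I S u)) (λ u → if C u then bad u S else 0))))) ⟩
    LL * 𝔼 {n} c (λ S → countF (I S) + sumOver C (λ u → bad u S))
      ≡⟨ cong (LL *_) (𝔼-+ c (λ S → countF (I S)) (λ S → sumOver C (λ u → bad u S))) ⟩
    LL * (𝔼 {n} c (λ S → countF (I S)) + 𝔼 {n} c (λ S → sumOver C (λ u → bad u S)))
      ≡⟨ *-distribˡ-+ LL (𝔼 {n} c (λ S → countF (I S))) _ ⟩
    LL * 𝔼 {n} c (λ S → countF (I S)) + LL * 𝔼 {n} c (λ S → sumOver C (λ u → bad u S))
      ≡⟨ cong₂ _+_ (sym (𝔼-*ˡ c LL (λ S → countF (I S)))) conf-𝔼 ⟩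
    𝔼 {n} c (λ S → LL * countF (I S)) + conflicts R C * w
      ≡⟨ cong (𝔼 {n} c (λ S → LL * countF (I S)) +_) (sym (𝔼-const {n} c (conflicts R C))) ⟩
    𝔼 {n} c (λ S → LL * countF (I S)) + 𝔼 {n} c (λ _ → conflicts R C)
      ≡⟨ sym (𝔼-+ c (λ S → LL * countF (I S)) (λ _ → conflicts R C)) ⟩
    𝔼 c (λ S → LL * countF (I S) + conflicts R C) ∎
    where open ≤-Reasoning

-- Degrees, independent sets and K_{s,s}-freeness

VSet : Graph → Set
VSet G = Fin (n G) → Bool

deg : (G : Graph) → VSet G → Fin (n G) → ℕ
deg G X u = countF (λ v → X v ∧ Adj G u v)

Independent : (G : Graph) → VSet G → Set
Independent G X = ∀ u v → X u ≡ true → X v ≡ true → Adj G u v ≡ false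

C4FreeSubgraph : Graph → ℕ → Set
C4FreeSubgraph G k = Σ (Subset (n G)) λ X →
  (1 ≤ size X) × IsBipartiteIn G X × ¬ HasC4In G X × (k * size X ≤ degSum G X)

deg-mono : ∀ G {X Y : VSet G} u → (∀ v → X v ≡ true → Y v ≡ true) → deg G X u ≤ deg G Y u
deg-mono G {X} u h = countF-mono λ v e → ∧-join (h v (proj₁ (∧-split e))) (proj₂ (∧-split {X v} e))

sumOver-deg-comm : ∀ G (X Y : VSet G) → sumOver Y (deg G X) ≡ sumOver X (deg G Y)
sumOver-deg-comm G X Y = begin
  sumOver Y (deg G X)
    ≡⟨ sumOver-cong Y (λ u → sumOver-∧ X (Adj G u) (λ _ → 1)) ⟩
  sumOver Y (λ u → sumOver X (λ v → 𝟙 (Adj G u v)))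
    ≡⟨ sumOver-swap Y X (λ u v → 𝟙 (Adj G u v)) ⟩
  sumOver X (λ v → sumOver Y (λ u → 𝟙 (Adj G u v)))
    ≡⟨ sumOver-cong X (λ v →
         trans (sumF-cong (λ u → cong (λ b → if Y u then 𝟙 b else 0) (Graph.sym G u v)))
                (sym (sumOver-∧ Y (Adj G v) (λ _ → 1)))) ⟩
  sumOver X (deg G Y) ∎
  where open ≡-Reasoning

adj⇒≢ : ∀ G {u v} → Adj G u v ≡ true → u ≢ v
adj⇒≢ G {u} e refl = true≢false e (irrefl G u)

adj-sym : ∀ G {u v} → Adj G u v ≡ true → Adj G v u ≡ true
adj-sym G {u} {v} e = trans (Graph.sym G v u) e

IsBipartition-tabulate : ∀ G (A B : VSet G) → (∀ v → A v ≡ true → B v ≡ false) →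
  Independent G A → Independent G B →
  IsBipartition G (tabulate (λ v → A v ∨ B v)) (tabulate A) (tabulate B)
IsBipartition-tabulate G A B disj indA indB =
    (λ v → trans (lookup∘tabulate (λ v → A v ∨ B v) v) (sym (cong₂ _∨_ (lookup∘tabulate A v) (lookup∘tabulate B v))))
  , (λ v → trans (cong₂ _∧_ (lookup∘tabulate A v) (lookup∘tabulate B v))
      (≢true⇒≡false λ e → true≢false (proj₂ (∧-split {A v} e)) (disj v (proj₁ (∧-split e)))))
  , (λ u v a b e → true≢false e (indA u v (untabulate A u a) (untabulate A v b)))
  , (λ u v a b e → true≢false e (indB u v (untabulate B u a) (untabulate B v b)))
  where
  untabulate : ∀ (P : VSet G) v → lookup (tabulate P) v ≡ true → P v ≡ true
  untabulate P v e = trans (sym (lookup∘tabulate P v)) e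

-- Twice the number of edges is at least `2 * k * |A|`, and `|B| ≤ |A|` makes this at least
-- `k * (|A| + |B|)`. A four-cycle alternates between the two sides, so its opposite pairs
-- contradict the last hypothesis.
C4FreeSubgraph-intro : ∀ G k (A B : VSet G) → (∀ v → A v ≡ true → B v ≡ false) →
  Independent G A → Independent G B → (∀ a → A a ≡ true → k ≤ deg G B a) →
  countF B ≤ countF A → 1 ≤ countF A →
  (∀ a a′ b b′ → A a ≡ true → A a′ ≡ true → B b ≡ true → B b′ ≡ true → a ≢ a′ → b ≢ b′ →
    Adj G a b ≡ true → Adj G a b′ ≡ true → Adj G a′ b ≡ true → Adj G a′ b′ ≡ true → ⊥) →
  C4FreeSubgraph G k
C4FreeSubgraph-intro G k A B disj indA indB k≤deg B≤A 1≤A linear =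
  X , 1≤X , (tabulate A , tabulate B , IsBipartition-tabulate G A B disj indA indB) , noC4 , dense
  where
  X : Subset (n G)
  X = tabulate (λ v → A v ∨ B v)
  X≡ : ∀ v → lookup X v ≡ A v ∨ B v
  X≡ = lookup∘tabulate (λ v → A v ∨ B v)
  in-X : ∀ {v} → lookup X v ≡ true → A v ≡ true ⊎ B v ≡ true
  in-X {v} e = ∨-elim (trans (sym (X≡ v)) e)
  X-of-A : ∀ v → A v ≡ true → lookup X v ≡ true
  X-of-A v e = trans (X≡ v) (∨-introˡ e)
  X-of-B : ∀ v → B v ≡ true → lookup X v ≡ true
  X-of-B v e = trans (X≡ v) (∨-introʳ e)
  1≤X : 1 ≤ size X
  1≤X = ≤-trans 1≤A (countF-mono X-of-A)
  across-A : ∀ {u v} → lookup X v ≡ true → Adj G u v ≡ true → A u ≡ true → B v ≡ true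
  across-A xv e au with in-X xv
  ... | inj₁ av = ⊥-elim (true≢false e (indA _ _ au av))
  ... | inj₂ bv = bv
  across-B : ∀ {u v} → lookup X v ≡ true → Adj G u v ≡ true → B u ≡ true → A v ≡ true
  across-B xv e bu with in-X xv
  ... | inj₁ av = av
  ... | inj₂ bv = ⊥-elim (true≢false e (indB _ _ bu bv))
  noC4 : ¬ HasC4In G X
  noC4 (a , b , c , d , (xa , xb , xc , xd) , (_ , a≢c , _ , _ , b≢d , _) , (ab , bc , cd , da)) with in-X xa
  ... | inj₁ aa =
    let bb = across-A xb ab aa ; ac = across-B xc bc bb ; bd = across-A xd cd ac in
    linear a c b d aa ac bb bd a≢c b≢d ab (adj-sym G da) (adj-sym G bc) cd
  ... | inj₂ ba =
    let ab′ = across-B xb ab ba ; bc′ = across-A xc bc ab′ ; ad = across-B xd cd bc′ in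
    linear b d a c ab′ ad ba bc′ b≢d a≢c (adj-sym G ab) bc da (adj-sym G cd)
  pointwise : ∀ u → (if A u then deg G B u else 0) + (if B u then deg G A u else 0)
    ≤ (if lookup X u then degIn G X u else 0)
  pointwise u with A u in ea | B u in eb
  ... | true  | true  = ⊥-elim (true≢false eb (disj u ea))
  ... | true  | false rewrite X-of-A u ea | +-identityʳ (deg G B u) = deg-mono G u X-of-B
  ... | false | true  rewrite X-of-B u eb = deg-mono G u X-of-A
  ... | false | false = z≤n
  size≤ : size X ≤ countF A + countF B
  size≤ = ≤-trans (sumF-mono (λ v → 𝟙≤ (lookup X v) (λ e → aux v (in-X e))))
    (≤-reflexive (sumF-+ (λ v → 𝟙 (A v)) (λ v → 𝟙 (B v))))
    where
    aux : ∀ v → A v ≡ true ⊎ B v ≡ true → 1 ≤ 𝟙 (A v) + 𝟙 (B v)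
    aux v (inj₁ e) = ≤-trans (𝟙-true e) (m≤m+n _ _)
    aux v (inj₂ e) = ≤-trans (𝟙-true e) (m≤n+m _ _)
  dense : k * size X ≤ degSum G X
  dense = begin
    k * size X ≤⟨ *-monoʳ-≤ k size≤ ⟩
    k * (countF A + countF B) ≤⟨ *-monoʳ-≤ k (+-monoʳ-≤ (countF A) B≤A) ⟩
    k * (countF A + countF A) ≡⟨ r k (countF A) ⟩
    countF A * k + countF A * k ≤⟨ +-mono-≤ (sumOver-≥const A k k≤deg) (sumOver-≥const A k k≤deg) ⟩
    sumOver A (deg G B) + sumOver A (deg G B) ≡⟨ cong (sumOver A (deg G B) +_) (sumOver-deg-comm G B A) ⟩
    sumOver A (deg G B) + sumOver B (deg G A) ≡⟨ sym (sumF-+ (λ u → if A u then deg G B u else 0) (λ u → if B u then deg G A u else 0)) ⟩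
    sumF (λ u → (if A u then deg G B u else 0) + (if B u then deg G A u else 0)) ≤⟨ sumF-mono pointwise ⟩
    degSum G X ∎
    where
    open ≤-Reasoning
    r : ∀ k a → k * (a + a) ≡ a * k + a * k
    r = solve-∀

miss : (G : Graph) → VSet G → Fin (n G) → ℕ
miss G W v = countF (λ y → W y ∧ not (Adj G v y))

-- The size condition is part of the predicate so that `few-nearlyComplete` holds for every `W`; for
-- small `W` no vertex is nearly complete.
nearlyComplete : (G : Graph) → ℕ → VSet G → Fin (n G) → Bool
nearlyComplete G T W v = (T * T ≤ᵇ countF W) ∧ (T * miss G W v <ᵇ countF W)

-- s nearly complete vertices would have T > s common neighbours in W.
few-nearlyComplete : ∀ G s T → s < T → ¬ HasKss G s → ∀ W → countF (nearlyComplete G T W) ≤ s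
few-nearlyComplete G zero    T s<T noK W =
  ⊥-elim (noK ((λ ()) , (λ ()) , (λ {}) , (λ {}) , (λ ()) , (λ ())))
few-nearlyComplete G s@(suc _) T s<T noK W = ≮⇒≥ λ lt → noK (kss (<⇒≤ lt))
  where
  kss : s ≤ countF (nearlyComplete G T W) → HasKss G s
  kss h with ≤countF⇒injection (nearlyComplete G T W) s h
  ... | f , f-inj , f-bad =
    let (g , g-inj , g-in) = ≤countF⇒injection Z s (≤-trans (<⇒≤ s<T) T≤Z) in
    f , g , f-inj , g-inj , (λ i j → adj⇒≢ G (common g-in i j)) , common g-in
    where
    Z : VSet G
    Z y = W y ∧ allF (λ i → Adj G (f i) y)
    common : ∀ {g : Fin s → Fin (n G)} → (∀ i → Z (g i) ≡ true) → ∀ i j → Adj G (f i) (g j) ≡ true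
    common {g} g-in i j = allF-elim (λ i → Adj G (f i) (g j)) (proj₂ (∧-split {W (g j)} (g-in j))) i
    TT≤W : T * T ≤ countF W
    TT≤W = ≤ᵇ-elim (proj₁ (∧-split (f-bad zero)))
    f-miss : ∀ i → T * miss G W (f i) ≤ countF W
    f-miss i = <⇒≤ (<ᵇ-elim (proj₂ (∧-split {T * T ≤ᵇ countF W} (f-bad i))))
    pointwise : ∀ y → 𝟙 (W y) ≤ 𝟙 (Z y) + sumF (λ i → 𝟙 (W y ∧ not (Adj G (f i) y)))
    pointwise y with W y
    ... | false = z≤n
    ... | true with allF (λ i → Adj G (f i) y) in e
    ...   | true  = m≤m+n 1 _
    ...   | false = let (i , q) = allF-false (λ i → Adj G (f i) y) e in
      ≤-trans (𝟙-true (not-true q)) (sumF-member (λ i → 𝟙 (not (Adj G (f i) y))) i)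
    cover : countF W ≤ countF Z + sumF (λ i → miss G W (f i))
    cover = begin
      countF W ≤⟨ sumF-mono pointwise ⟩
      sumF (λ y → 𝟙 (Z y) + sumF (λ i → 𝟙 (W y ∧ not (Adj G (f i) y))))
        ≡⟨ sumF-+ (λ y → 𝟙 (Z y)) (λ y → sumF (λ i → 𝟙 (W y ∧ not (Adj G (f i) y)))) ⟩
      countF Z + sumF (λ y → sumF (λ i → 𝟙 (W y ∧ not (Adj G (f i) y))))
        ≡⟨ cong (countF Z +_) (sumF-swap (λ y i → 𝟙 (W y ∧ not (Adj G (f i) y)))) ⟩
      countF Z + sumF (λ i → miss G W (f i)) ∎
      where open ≤-Reasoning
    W≤TZ : countF W ≤ T * countF Z
    -- The `s` vertices together miss at most `s * |W| / T` elements, which leaves one of the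
    -- `suc s` copies of `|W|`.
    W≤TZ = +-cancelʳ-≤ (s * countF W) (countF W) (T * countF Z) (begin
      countF W + s * countF W ≤⟨ *-monoˡ-≤ (countF W) s<T ⟩
      T * countF W ≤⟨ *-monoʳ-≤ T cover ⟩
      T * (countF Z + sumF (λ i → miss G W (f i))) ≡⟨ *-distribˡ-+ T (countF Z) _ ⟩
      T * countF Z + T * sumF (λ i → miss G W (f i)) ≡⟨ cong (T * countF Z +_) (sym (sumF-*ˡ T (λ i → miss G W (f i)))) ⟩
      T * countF Z + sumF (λ i → T * miss G W (f i)) ≤⟨ +-monoʳ-≤ (T * countF Z) (sumF-mono f-miss) ⟩
      T * countF Z + sumF {s} (λ i → countF W) ≡⟨ cong (T * countF Z +_) (sumF-const s (countF W)) ⟩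
      T * countF Z + s * countF W ∎)
      where open ≤-Reasoning
    T≤Z : T ≤ countF Z
    T≤Z = *-cancelˡ-≤ T {{>-nonZero (≤-trans (s≤s z≤n) s<T)}} (≤-trans TT≤W W≤TZ)

miss-bound : ∀ G T W v → T * T ≤ countF W → nearlyComplete G T W v ≡ false → countF W ≤ T * miss G W v
miss-bound G T W v h e = <ᵇ-false (trans (sym (cong (_∧ (T * miss G W v <ᵇ countF W)) (≤ᵇ-intro h))) e)

-- Greedy choice: at most `e * s < T * T` vertices are nearly complete to one of the later sets, so
-- the first set contains a vertex that is not. Passing to its non-neighbours shrinks each later set
-- by at most a factor `T`, which the exponent `suc e` allows for.
independent-representatives : ∀ G s T → s < T → ¬ HasKss G s → ∀ e → e < T →
  (W : Fin e → VSet G) → (∀ i → T ^ suc e ≤ countF (W i)) →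
  ∃ λ (y : Fin e → Fin (n G)) → (∀ i → W i (y i) ≡ true) × (∀ i j → Adj G (y i) (y j) ≡ false)
independent-representatives G s T s<T noK zero    e<T W large = (λ ()) , (λ ()) , (λ ())
independent-representatives G s T s<T noK (suc e) e<T W large = y , y-in , y-indep
  where
  instance
    T≢0 : NonZero T
    T≢0 = >-nonZero (≤-trans (s≤s z≤n) s<T)
  TT≤ : ∀ i → T * T ≤ countF (W i)
  TT≤ i = ≤-trans (≤-reflexive (cong (T *_) (sym (*-identityʳ T))))
    (≤-trans (^-monoʳ-≤ T (s≤s (s≤s (z≤n {e})))) (large i))
  first : ∃ λ v → W zero v ≡ true × (∀ i → nearlyComplete G T (W (suc i)) v ≡ false)
  first with sumF-<⇒∃< (λ v → sumF (λ i → 𝟙 (nearlyComplete G T (W (suc i)) v))) (λ v → 𝟙 (W zero v)) lt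
    where
    open ≤-Reasoning
    lt : sumF (λ v → sumF (λ i → 𝟙 (nearlyComplete G T (W (suc i)) v))) < countF (W zero)
    lt = begin-strict
      sumF (λ v → sumF (λ i → 𝟙 (nearlyComplete G T (W (suc i)) v)))
        ≡⟨ sumF-swap (λ v i → 𝟙 (nearlyComplete G T (W (suc i)) v)) ⟩
      sumF (λ i → countF (nearlyComplete G T (W (suc i))))
        ≤⟨ sumF-mono (λ i → few-nearlyComplete G s T s<T noK (W (suc i))) ⟩
      sumF {e} (λ _ → s) ≡⟨ sumF-const e s ⟩
      e * s ≤⟨ *-monoʳ-≤ e (<⇒≤ s<T) ⟩
      e * T <⟨ *-monoˡ-< T (<-trans (n<1+n e) e<T) ⟩
      T * T ≤⟨ TT≤ zero ⟩
      countF (W zero) ∎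
  ... | v , p = v , 𝟙-true⁻¹ p , λ i →
    𝟙≡0 (sumF≡0⇒≡0 (λ i → 𝟙 (nearlyComplete G T (W (suc i)) v))
      (n<1⇒n≡0 (≤-trans p (𝟙≤1 (W zero v)))) i)
  y₀ : Fin (n G)
  y₀ = proj₁ first
  W′ : Fin e → VSet G
  W′ i x = W (suc i) x ∧ not (Adj G y₀ x)
  large′ : ∀ i → T ^ suc e ≤ countF (W′ i)
  large′ i = *-cancelˡ-≤ T (≤-trans (large (suc i))
    (miss-bound G T (W (suc i)) y₀ (TT≤ (suc i)) (proj₂ (proj₂ first) i)))
  rec = independent-representatives G s T s<T noK e (<-trans (n<1+n e) e<T) W′ large′
  y : Fin (suc e) → Fin (n G)
  y zero    = y₀
  y (suc i) = proj₁ rec i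
  y-in : ∀ i → W i (y i) ≡ true
  y-in zero    = proj₁ (proj₂ first)
  y-in (suc i) = proj₁ (∧-split (proj₁ (proj₂ rec) i))
  avoid : ∀ i → Adj G y₀ (y (suc i)) ≡ false
  avoid i = not-true⁻¹ (proj₂ (∧-split {W (suc i) (y (suc i))} (proj₁ (proj₂ rec) i)))
  y-indep : ∀ i j → Adj G (y i) (y j) ≡ false
  y-indep zero    zero    = irrefl G y₀
  y-indep zero    (suc j) = avoid j
  y-indep (suc i) zero    = trans (Graph.sym G _ _) (avoid i)
  y-indep (suc i) (suc j) = proj₂ (proj₂ rec) i j

-- Sums over tuples, and the number of independent tuples

sumT : ∀ {n} r → (Vec (Fin n) r → ℕ) → ℕ
sumT zero    f = f []
sumT (suc r) f = sumF (λ v → sumT r (λ w → f (v ∷ w)))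

sumT-mono : ∀ {n} r {f g : Vec (Fin n) r → ℕ} → (∀ w → f w ≤ g w) → sumT r f ≤ sumT r g
sumT-mono zero    h = h []
sumT-mono (suc r) h = sumF-mono (λ v → sumT-mono r (λ w → h (v ∷ w)))

sumT-cong : ∀ {n} r {f g : Vec (Fin n) r → ℕ} → (∀ w → f w ≡ g w) → sumT r f ≡ sumT r g
sumT-cong zero    h = h []
sumT-cong (suc r) h = sumF-cong (λ v → sumT-cong r (λ w → h (v ∷ w)))

sumT-+ : ∀ {n} r (f g : Vec (Fin n) r → ℕ) → sumT r (λ w → f w + g w) ≡ sumT r f + sumT r g
sumT-+ zero    f g = refl
sumT-+ (suc r) f g =
  trans (sumF-cong (λ v → sumT-+ r (λ w → f (v ∷ w)) (λ w → g (v ∷ w))))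
        (sumF-+ (λ v → sumT r (λ w → f (v ∷ w))) (λ v → sumT r (λ w → g (v ∷ w))))

sumT-*ˡ : ∀ {n} r c (f : Vec (Fin n) r → ℕ) → sumT r (λ w → c * f w) ≡ c * sumT r f
sumT-*ˡ zero    c f = refl
sumT-*ˡ (suc r) c f =
  trans (sumF-cong (λ v → sumT-*ˡ r c (λ w → f (v ∷ w)))) (sumF-*ˡ c (λ v → sumT r (λ w → f (v ∷ w))))

sumT-zero : ∀ {n} r → sumT {n} r (λ _ → 0) ≡ 0
sumT-zero zero        = refl
sumT-zero {n} (suc r) = trans (sumF-cong {n} (λ v → sumT-zero r)) (sumF-zero n)

sumF-sumT-swap : ∀ {m n} r (f : Fin m → Vec (Fin n) r → ℕ) →
  sumF (λ i → sumT r (f i)) ≡ sumT r (λ w → sumF (λ i → f i w))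
sumF-sumT-swap zero    f = refl
sumF-sumT-swap (suc r) f =
  trans (sumF-swap (λ i v → sumT r (λ w → f i (v ∷ w))))
        (sumF-cong (λ v → sumF-sumT-swap r (λ i w → f i (v ∷ w))))

sumOver-sumT-swap : ∀ {m n} r (Y : Fin m → Bool) (f : Fin m → Vec (Fin n) r → ℕ) →
  sumOver Y (λ i → sumT r (f i)) ≡ sumT r (λ w → sumOver Y (λ i → f i w))
sumOver-sumT-swap {n = n} r Y f =
  trans (sumF-cong (λ i → push (Y i) (f i))) (sumF-sumT-swap r (λ i w → if Y i then f i w else 0))
  where
  push : ∀ b (g : Vec (Fin n) r → ℕ) → (if b then sumT r g else 0) ≡ sumT r (λ w → if b then g w else 0)
  push true  g = refl
  push false g = sym (sumT-zero {n} r)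

sumT-<⇒∃< : ∀ {n} r (f g : Vec (Fin n) r → ℕ) → sumT r f < sumT r g → ∃ λ w → f w < g w
sumT-<⇒∃< zero    f g lt = [] , lt
sumT-<⇒∃< (suc r) f g lt =
  let (v , p) = sumF-<⇒∃< (λ v → sumT r (λ w → f (v ∷ w))) (λ v → sumT r (λ w → g (v ∷ w))) lt
      (w , q) = sumT-<⇒∃< r (λ w → f (v ∷ w)) (λ w → g (v ∷ w)) p
  in v ∷ w , q

𝔼-sumT : ∀ {n m} c r (f : Vec (Fin m) r → (Fin n → Bool) → ℕ) →
  𝔼 c (λ S → sumT r (λ w → f w S)) ≡ sumT r (λ w → 𝔼 c (f w))
𝔼-sumT c zero    f = refl
𝔼-sumT c (suc r) f =
  trans (𝔼-sumF c (λ v S → sumT r (λ w → f (v ∷ w) S))) (sumF-cong (λ v → 𝔼-sumT c r (λ w → f (v ∷ w))))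

inAll : ∀ {n r} → (Fin n → Bool) → Vec (Fin n) r → Bool
inAll X []      = true
inAll X (v ∷ w) = X v ∧ inAll X w

inAll-intro : ∀ {n r} (X : Fin n → Bool) (w : Vec (Fin n) r) →
  (∀ i → X (lookup w i) ≡ true) → inAll X w ≡ true
inAll-intro X []      h = refl
inAll-intro X (v ∷ w) h = ∧-join (h zero) (inAll-intro X w (λ i → h (suc i)))

inAll-elim : ∀ {n r} (X : Fin n → Bool) (w : Vec (Fin n) r) →
  inAll X w ≡ true → ∀ i → X (lookup w i) ≡ true
inAll-elim X (v ∷ w) e zero    = proj₁ (∧-split e)
inAll-elim X (v ∷ w) e (suc i) = inAll-elim X w (proj₂ (∧-split {X v} e)) i

sumT-inAll : ∀ {n} r (X : Fin n → Bool) → sumT r (λ w → 𝟙 (inAll X w)) ≡ countF X ^ r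
sumT-inAll zero    X = refl
sumT-inAll {n} (suc r) X = begin
  sumF (λ v → sumT r (λ w → 𝟙 (X v ∧ inAll X w)))
    ≡⟨ sumF-cong (λ v → trans (sumT-cong r (λ w → 𝟙-∧ (X v) (inAll X w)))
         (trans (sumT-*ˡ r (𝟙 (X v)) (λ w → 𝟙 (inAll X w))) (cong (𝟙 (X v) *_) (sumT-inAll r X)))) ⟩
  sumF (λ v → 𝟙 (X v) * countF X ^ r)
    ≡⟨ sumF-*ʳ (λ v → 𝟙 (X v)) (countF X ^ r) ⟩
  countF X * countF X ^ r ∎
  where open ≡-Reasoning

-- With the other coordinates fixed, at most `c` values at position `l` are counted, so a factor
-- `|X|` is replaced by `c`. Multiplying by `|X|` keeps the exponent free of subtraction.
sumT-coordinate : ∀ {n} h (l : Fin (suc h)) (X : Fin n → Bool) c (g : Vec (Fin n) (suc h) → Bool) →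
  (∀ w → countF (λ v → g (insertAt w l v)) ≤ c) →
  countF X * sumT (suc h) (λ w → 𝟙 (inAll X w ∧ g w)) ≤ c * countF X ^ suc h
sumT-coordinate h zero X c g hyp = begin
  countF X * sumF (λ v → sumT h (λ w → 𝟙 ((X v ∧ inAll X w) ∧ g (v ∷ w))))
    ≤⟨ *-monoʳ-≤ (countF X) (sumF-mono (λ v → sumT-mono h (λ w → forget (X v) (inAll X w) (g (v ∷ w))))) ⟩
  countF X * sumF (λ v → sumT h (λ w → 𝟙 (inAll X w) * 𝟙 (g (v ∷ w))))
    ≡⟨ cong (countF X *_) (sumF-sumT-swap h (λ v w → 𝟙 (inAll X w) * 𝟙 (g (v ∷ w)))) ⟩
  countF X * sumT h (λ w → sumF (λ v → 𝟙 (inAll X w) * 𝟙 (g (v ∷ w))))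
    ≤⟨ *-monoʳ-≤ (countF X) (sumT-mono h (λ w → ≤-trans
         (≤-reflexive (sumF-*ˡ (𝟙 (inAll X w)) (λ v → 𝟙 (g (v ∷ w)))))
         (≤-trans (*-monoʳ-≤ (𝟙 (inAll X w)) (hyp w)) (≤-reflexive (*-comm _ c))))) ⟩
  countF X * sumT h (λ w → c * 𝟙 (inAll X w))
    ≡⟨ cong (countF X *_) (trans (sumT-*ˡ h c (λ w → 𝟙 (inAll X w))) (cong (c *_) (sumT-inAll h X))) ⟩
  countF X * (c * countF X ^ h)
    ≡⟨ r (countF X) c (countF X ^ h) ⟩
  c * countF X ^ suc h ∎
  where
  open ≤-Reasoning
  forget : ∀ a b c → 𝟙 ((a ∧ b) ∧ c) ≤ 𝟙 b * 𝟙 c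
  forget true  b c = ≤-reflexive (𝟙-∧ b c)
  forget false b c = z≤n
  r : ∀ x c y → x * (c * y) ≡ c * (x * y)
  r = solve-∀
sumT-coordinate {n} (suc h) (suc l) X c g hyp = begin
  countF X * sumF (λ v → sumT (suc h) (λ w → 𝟙 ((X v ∧ inAll X w) ∧ g (v ∷ w))))
    ≡⟨ sym (sumF-*ˡ (countF X) (λ v → sumT (suc h) (λ w → 𝟙 ((X v ∧ inAll X w) ∧ g (v ∷ w))))) ⟩
  sumF (λ v → countF X * sumT (suc h) (λ w → 𝟙 ((X v ∧ inAll X w) ∧ g (v ∷ w))))
    ≤⟨ sumF-mono (λ v → slice v (X v)) ⟩
  sumOver X (λ v → c * countF X ^ suc h)
    ≡⟨ sumOver-const X (c * countF X ^ suc h) ⟩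
  countF X * (c * countF X ^ suc h)
    ≡⟨ r (countF X) c (countF X ^ suc h) ⟩
  c * countF X ^ suc (suc h) ∎
  where
  open ≤-Reasoning
  r : ∀ x c y → x * (c * y) ≡ c * (x * y)
  r = solve-∀
  slice : ∀ v b → countF X * sumT (suc h) (λ w → 𝟙 ((b ∧ inAll X w) ∧ g (v ∷ w)))
    ≤ (if b then c * countF X ^ suc h else 0)
  slice v true  = sumT-coordinate h l X c (λ w → g (v ∷ w)) (λ w → hyp (v ∷ w))
  slice v false = ≤-reflexive (trans (cong (countF X *_) (sumT-zero {n} (suc h))) (*-zeroʳ (countF X)))

nonNeighbours : (G : Graph) → VSet G → Fin (n G) → VSet G
nonNeighbours G U v x = U x ∧ (not (Adj G v x) ∧ not (v == x))

-- The tail is required to lie in the non-neighbours of the head, so that tuples can be counted by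
-- recursion on a shrinking set; non-adjacency and distinctness of all entries are recovered below.
independentTuple : ∀ (G : Graph) {r} → VSet G → Vec (Fin (n G)) r → Bool
independentTuple G U []      = true
independentTuple G U (v ∷ w) = U v ∧ independentTuple G (nonNeighbours G U v) w

independentTuple-in : ∀ G {r} (U : VSet G) (w : Vec (Fin (n G)) r) → independentTuple G U w ≡ true →
  ∀ i → U (lookup w i) ≡ true
independentTuple-in G U (v ∷ w) e zero    = proj₁ (∧-split e)
independentTuple-in G U (v ∷ w) e (suc i) =
  proj₁ (∧-split (independentTuple-in G (nonNeighbours G U v) w (proj₂ (∧-split {U v} e)) i))

independentTuple-adj : ∀ G {r} (U : VSet G) (w : Vec (Fin (n G)) r) → independentTuple G U w ≡ true →
  ∀ i j → Adj G (lookup w i) (lookup w j) ≡ false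
independentTuple-adj G U (v ∷ w) e zero    zero    = irrefl G v
independentTuple-adj G U (v ∷ w) e zero    (suc j) = not-true⁻¹ (proj₁ (∧-split (proj₂ (∧-split {U (lookup w j)}
  (independentTuple-in G (nonNeighbours G U v) w (proj₂ (∧-split {U v} e)) j)))))
independentTuple-adj G U (v ∷ w) e (suc i) zero    =
  trans (Graph.sym G _ _) (independentTuple-adj G U (v ∷ w) e zero (suc i))
independentTuple-adj G U (v ∷ w) e (suc i) (suc j) =
  independentTuple-adj G (nonNeighbours G U v) w (proj₂ (∧-split {U v} e)) i j

independentTuple-injective : ∀ G {r} (U : VSet G) (w : Vec (Fin (n G)) r) → independentTuple G U w ≡ true →
  Injective _≡_ _≡_ (lookup w)
independentTuple-injective G U w e {i} {j} = aux U w e i j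
  where
  fresh : ∀ {r} (U : VSet G) v (w : Vec (Fin (n G)) r) → independentTuple G U (v ∷ w) ≡ true →
    ∀ j → v ≢ lookup w j
  fresh U v w e j = ==false⇒≢ (not-true⁻¹ (proj₂ (∧-split {not (Adj G v (lookup w j))}
    (proj₂ (∧-split {U (lookup w j)}
      (independentTuple-in G (nonNeighbours G U v) w (proj₂ (∧-split {U v} e)) j))))))
  aux : ∀ {r} (U : VSet G) (w : Vec (Fin (n G)) r) → independentTuple G U w ≡ true →
    ∀ i j → lookup w i ≡ lookup w j → i ≡ j
  aux U (v ∷ w) e zero    zero    q = refl
  aux U (v ∷ w) e zero    (suc j) q = ⊥-elim (fresh U v w e j q)
  aux U (v ∷ w) e (suc i) zero    q = ⊥-elim (fresh U v w e i (sym q))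
  aux U (v ∷ w) e (suc i) (suc j) q =
    cong suc (aux (nonNeighbours G U v) w (proj₂ (∧-split {U v} e)) i j q)

-- Discards an exceptional part that makes up at most a `T`-th of the whole, at the price of one
-- factor `T`.
absorb : ∀ {T u x} → 2 ≤ T → T * u ≤ u + x → u ≤ x
absorb {T} {u} {x} 2≤T h = +-cancelˡ-≤ u u x (begin
  u + u ≡⟨ cong (u +_) (sym (+-identityʳ u)) ⟩
  2 * u ≤⟨ *-monoˡ-≤ u 2≤T ⟩
  T * u ≤⟨ h ⟩
  u + x ∎)
  where open ≤-Reasoning

-- At least `|U| / T` vertices are not nearly complete to `U`, and each of them has at least
-- `|U| / (T * T)` non-neighbours for the remaining `r` entries. A further entry thus costs
-- `1 + 2 * r` in the exponent, and these numbers add up to squares.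
many-independentTuples : ∀ G s T → 2 ≤ T → s < T → ¬ HasKss G s → ∀ r (U : VSet G) →
  T ^ (2 * r) ≤ countF U →
  countF U ^ r ≤ T ^ (r * r) * sumT r (λ w → 𝟙 (independentTuple G U w))
many-independentTuples G s T 2≤T s<T noK zero    U large = ≤-refl
many-independentTuples G s T 2≤T s<T noK (suc r) U large = begin
  u * u ^ r
    ≤⟨ *-monoˡ-≤ (u ^ r) u≤TN ⟩
  T * countF N * u ^ r
    ≡⟨ *-assoc T (countF N) (u ^ r) ⟩
  T * (countF N * u ^ r)
    ≤⟨ *-monoʳ-≤ T (sumOver-≥const N (u ^ r) extend) ⟩
  T * sumOver N (λ v → T ^ (2 * r) * (T ^ (r * r) * F v))
    ≤⟨ *-monoʳ-≤ T (sumOver-monoˢ (λ v → T ^ (2 * r) * (T ^ (r * r) * F v)) (λ v e → proj₁ (∧-split e))) ⟩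
  T * sumOver U (λ v → T ^ (2 * r) * (T ^ (r * r) * F v))
    ≡⟨ cong (T *_) (trans (sumOver-*ˡ U (T ^ (2 * r)) (λ v → T ^ (r * r) * F v))
         (cong (T ^ (2 * r) *_) (sumOver-*ˡ U (T ^ (r * r)) F))) ⟩
  T * (T ^ (2 * r) * (T ^ (r * r) * sumOver U F))
    ≡⟨ exponents ⟩
  T ^ (suc r * suc r) * sumOver U F
    ≤⟨ *-monoʳ-≤ (T ^ (suc r * suc r)) (sumF-mono (λ v → pull (U v) v)) ⟩
  T ^ (suc r * suc r) * sumF (λ v → sumT r (λ w → 𝟙 (U v ∧ independentTuple G (nonNeighbours G U v) w))) ∎
  where
  open ≤-Reasoning
  u = countF U
  F : Fin (n G) → ℕ
  F v = sumT r (λ w → 𝟙 (independentTuple G (nonNeighbours G U v) w))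
  N : VSet G
  N v = U v ∧ not (nearlyComplete G T U v)
  instance
    T≢0 : NonZero T
    T≢0 = >-nonZero (≤-trans (s≤s z≤n) s<T)
  pull : ∀ b v → (if b then F v else 0) ≤ sumT r (λ w → 𝟙 (b ∧ independentTuple G (nonNeighbours G U v) w))
  pull true  v = ≤-refl
  pull false v = z≤n
  T^2r : T * T * T ^ (2 * r) ≤ u
  T^2r = subst (_≤ u) (trans (cong (T ^_) (*-suc 2 r)) (sym (*-assoc T T (T ^ (2 * r))))) large
  TT≤u : T * T ≤ u
  TT≤u = ≤-trans (m≤m*n (T * T) (T ^ (2 * r)) {{m^n≢0 T (2 * r)}}) T^2r
  u≤TN : u ≤ T * countF N
  u≤TN = absorb 2≤T (begin
    T * u ≤⟨ *-monoʳ-≤ T (sumF-mono split) ⟩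
    T * sumF (λ v → 𝟙 (nearlyComplete G T U v) + 𝟙 (N v))
      ≡⟨ cong (T *_) (sumF-+ (λ v → 𝟙 (nearlyComplete G T U v)) (λ v → 𝟙 (N v))) ⟩
    T * (countF (nearlyComplete G T U) + countF N)
      ≤⟨ *-monoʳ-≤ T (+-monoˡ-≤ (countF N) (≤-trans (few-nearlyComplete G s T s<T noK U) (<⇒≤ s<T))) ⟩
    T * (T + countF N) ≡⟨ *-distribˡ-+ T T (countF N) ⟩
    T * T + T * countF N ≤⟨ +-monoˡ-≤ (T * countF N) TT≤u ⟩
    u + T * countF N ∎)
    where
    split : ∀ v → 𝟙 (U v) ≤ 𝟙 (nearlyComplete G T U v) + 𝟙 (N v)
    split v with U v | nearlyComplete G T U v
    ... | false | _     = z≤n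
    ... | true  | true  = ≤-refl
    ... | true  | false = ≤-refl
  rest-large : ∀ v → N v ≡ true → u ≤ T * T * countF (nonNeighbours G U v)
  rest-large v e = absorb 2≤T (begin
    T * u
      ≤⟨ *-monoʳ-≤ T (miss-bound G T U v TT≤u (not-true⁻¹ (proj₂ (∧-split {U v} e)))) ⟩
    T * (T * miss G U v)
      ≤⟨ *-monoʳ-≤ T (*-monoʳ-≤ T (≤-trans (countF-mono covered) (countF-insert≤ v (nonNeighbours G U v)))) ⟩
    T * (T * suc (countF (nonNeighbours G U v)))
      ≡⟨ r₁ T (countF (nonNeighbours G U v)) ⟩
    T * T + T * T * countF (nonNeighbours G U v)
      ≤⟨ +-monoˡ-≤ (T * T * countF (nonNeighbours G U v)) TT≤u ⟩
    u + T * T * countF (nonNeighbours G U v) ∎)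
    where
    r₁ : ∀ T x → T * (T * (1 + x)) ≡ T * T + T * T * x
    r₁ = solve-∀
    covered : ∀ y → U y ∧ not (Adj G v y) ≡ true → insert v (nonNeighbours G U v) y ≡ true
    covered y q with v == y
    ... | true  = refl
    ... | false = ∧-join (proj₁ (∧-split {U y} q)) (∧-join (proj₂ (∧-split {U y} q)) refl)
  extend : ∀ v → N v ≡ true → u ^ r ≤ T ^ (2 * r) * (T ^ (r * r) * F v)
  extend v e = begin
    u ^ r
      ≤⟨ ^-monoˡ-≤ r (rest-large v e) ⟩
    (T * T * countF (nonNeighbours G U v)) ^ r
      ≡⟨ ^-distribʳ-* r (T * T) (countF (nonNeighbours G U v)) ⟩
    (T * T) ^ r * countF (nonNeighbours G U v) ^ r
      ≡⟨ cong (_* countF (nonNeighbours G U v) ^ r)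
           (trans (cong (_^ r) (cong (T *_) (sym (*-identityʳ T)))) (^-*-assoc T 2 r)) ⟩
    T ^ (2 * r) * countF (nonNeighbours G U v) ^ r
      ≤⟨ *-monoʳ-≤ (T ^ (2 * r)) (many-independentTuples G s T 2≤T s<T noK r (nonNeighbours G U v)
           (*-cancelˡ-≤ (T * T) {{m*n≢0 T T}} (≤-trans T^2r (rest-large v e)))) ⟩
    T ^ (2 * r) * (T ^ (r * r) * F v) ∎
  exponents : T * (T ^ (2 * r) * (T ^ (r * r) * sumOver U F)) ≡ T ^ (suc r * suc r) * sumOver U F
  exponents = sym (begin-equality
    T ^ (suc r * suc r) * sumOver U F
      ≡⟨ cong (λ x → T ^ x * sumOver U F) (sq r) ⟩
    T * T ^ (2 * r + r * r) * sumOver U F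
      ≡⟨ cong (λ x → T * x * sumOver U F) (^-distribˡ-+-* T (2 * r) (r * r)) ⟩
    T * (T ^ (2 * r) * T ^ (r * r)) * sumOver U F
      ≡⟨ r₂ T (T ^ (2 * r)) (T ^ (r * r)) (sumOver U F) ⟩
    T * (T ^ (2 * r) * (T ^ (r * r) * sumOver U F)) ∎)
    where
    sq : ∀ r → (1 + r) * (1 + r) ≡ 1 + (2 * r + r * r)
    sq = solve-∀
    r₂ : ∀ a b c d → a * (b * c) * d ≡ a * (b * (c * d))
    r₂ = solve-∀

-- Dense pairs

-- A partial linear space. Its incidence graph has no four-cycle by `linear`, and `k` points on each
-- line together with `points≤lines` give it average degree at least `k`.
record LinearSystem (k : ℕ) : Set where
  field
    points lines     : ℕ
    inc              : Fin lines → Fin points → Bool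
    point            : Fin lines → Fin k → Fin points
    point-injective  : ∀ ℓ → Injective _≡_ _≡_ (point ℓ)
    point-inc        : ∀ ℓ i → inc ℓ (point ℓ i) ≡ true
    linear           : ∀ ℓ ℓ′ p p′ → ℓ ≢ ℓ′ → p ≢ p′ → inc ℓ p ≡ true → inc ℓ p′ ≡ true →
                       inc ℓ′ p ≡ true → inc ℓ′ p′ ≡ true → ⊥
    points≤lines     : points ≤ lines
    1≤lines          : 1 ≤ lines

-- Points (i , c) with i < k, c < k³, and lines c = m i + b with m , b < k².
linearSystem : ∀ k → 1 ≤ k → LinearSystem k
linearSystem k 1≤k = record
  { points          = k * (k * K)
  ; lines           = K * K
  ; inc             = inc
  ; point           = point
  ; point-injective = λ ℓ {i} {j} e → proj₁ (Fin.combine-injective i (column ℓ i) j (column ℓ j) e)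
  ; point-inc       = point-inc
  ; linear          = linear
  ; points≤lines    = ≤-reflexive (sym (*-assoc k k K))
  ; 1≤lines         = *-mono-≤ (*-mono-≤ 1≤k 1≤k) (*-mono-≤ 1≤k 1≤k)
  }
  where
  K : ℕ
  K = k * k
  slope offset : Fin (K * K) → Fin K
  slope ℓ  = proj₁ (Fin.remQuot {K} K ℓ)
  offset ℓ = proj₂ (Fin.remQuot {K} K ℓ)
  abscissa : Fin (k * (k * K)) → Fin k
  abscissa p = proj₁ (Fin.remQuot (k * K) p)
  ordinate : Fin (k * (k * K)) → Fin (k * K)
  ordinate p = proj₂ (Fin.remQuot {k} (k * K) p)
  value : Fin (K * K) → Fin k → ℕ
  value ℓ i = toℕ (slope ℓ) * toℕ i + toℕ (offset ℓ)
  inc : Fin (K * K) → Fin (k * (k * K)) → Bool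
  inc ℓ p = toℕ (ordinate p) ≡ᵇ value ℓ (abscissa p)
  value< : ∀ ℓ i → value ℓ i < k * K
  value< ℓ i = begin-strict
    toℕ (slope ℓ) * toℕ i + toℕ (offset ℓ)
      <⟨ +-mono-≤-< (*-monoˡ-≤ (toℕ i) (<⇒≤ (Fin.toℕ<n (slope ℓ)))) (Fin.toℕ<n (offset ℓ)) ⟩
    K * toℕ i + K ≡⟨ trans (+-comm (K * toℕ i) K) (sym (*-suc K (toℕ i))) ⟩
    K * suc (toℕ i) ≤⟨ *-monoʳ-≤ K (Fin.toℕ<n i) ⟩
    K * k ≡⟨ *-comm K k ⟩
    k * K ∎
    where open ≤-Reasoning
  column : Fin (K * K) → Fin k → Fin (k * K)
  column ℓ i = Fin.fromℕ< (value< ℓ i)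
  point : Fin (K * K) → Fin k → Fin (k * (k * K))
  point ℓ i = Fin.combine i (column ℓ i)
  point-inc : ∀ ℓ i → inc ℓ (point ℓ i) ≡ true
  point-inc ℓ i = ≡ᵇ-intro (trans (cong (λ x → toℕ (proj₂ x)) (Fin.remQuot-combine i (column ℓ i)))
    (trans (Fin.toℕ-fromℕ< (value< ℓ i))
      (cong (λ x → value ℓ (proj₁ x)) (sym (Fin.remQuot-combine i (column ℓ i))))))
  slopes : ∀ m m′ b b′ i δ → m * i + b ≡ m′ * i + b′ →
    m * (i + suc δ) + b ≡ m′ * (i + suc δ) + b′ → m ≡ m′
  slopes m m′ b b′ i δ e₁ e₂ = *-cancelʳ-≡ m m′ (suc δ)
    (+-cancelˡ-≡ (m * i + b) (m * suc δ) (m′ * suc δ)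
      (trans (r m i b (suc δ)) (trans e₂ (trans (sym (r m′ i b′ (suc δ))) (cong (_+ m′ * suc δ) (sym e₁))))))
    where
    r : ∀ m i b d → m * i + b + m * d ≡ m * (i + d) + b
    r = solve-∀
  coefficients : ∀ m m′ b b′ i j → i < j → m * i + b ≡ m′ * i + b′ → m * j + b ≡ m′ * j + b′ →
    m ≡ m′ × b ≡ b′
  coefficients m m′ b b′ i j i<j e₁ e₂ with slopes m m′ b b′ i (j ∸ suc i) e₁
    (subst (λ x → m * x + b ≡ m′ * x + b′) (sym (trans (+-suc i (j ∸ suc i)) (m+[n∸m]≡n i<j))) e₂)
  ... | refl = refl , +-cancelˡ-≡ (m * i) b b′ e₁
  linear : ∀ ℓ ℓ′ p p′ → ℓ ≢ ℓ′ → p ≢ p′ → inc ℓ p ≡ true → inc ℓ p′ ≡ true →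
    inc ℓ′ p ≡ true → inc ℓ′ p′ ≡ true → ⊥
  linear ℓ ℓ′ p p′ ℓ≢ℓ′ p≢p′ a b c d = cases (<-cmp (toℕ (abscissa p)) (toℕ (abscissa p′)))
    where
    at-p : value ℓ (abscissa p) ≡ value ℓ′ (abscissa p)
    at-p = trans (sym (≡ᵇ-elim {toℕ (ordinate p)} a)) (≡ᵇ-elim c)
    at-p′ : value ℓ (abscissa p′) ≡ value ℓ′ (abscissa p′)
    at-p′ = trans (sym (≡ᵇ-elim {toℕ (ordinate p′)} b)) (≡ᵇ-elim d)
    same : ∀ i j → i < j →
      toℕ (slope ℓ) * i + toℕ (offset ℓ) ≡ toℕ (slope ℓ′) * i + toℕ (offset ℓ′) →
      toℕ (slope ℓ) * j + toℕ (offset ℓ) ≡ toℕ (slope ℓ′) * j + toℕ (offset ℓ′) → ⊥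
    same i j i<j e₁ e₂ with coefficients (toℕ (slope ℓ)) (toℕ (slope ℓ′)) (toℕ (offset ℓ)) (toℕ (offset ℓ′)) i j i<j e₁ e₂
    ... | m≡ , b≡ = ℓ≢ℓ′ (trans (sym (Fin.combine-remQuot {K} K ℓ))
      (trans (cong₂ (Fin.combine {K} {K}) (Fin.toℕ-injective m≡) (Fin.toℕ-injective b≡)) (Fin.combine-remQuot {K} K ℓ′)))
    cases : Tri (toℕ (abscissa p) < toℕ (abscissa p′)) (toℕ (abscissa p) ≡ toℕ (abscissa p′))
      (toℕ (abscissa p′) < toℕ (abscissa p)) → ⊥
    cases (tri< lt _ _) = same _ _ lt at-p at-p′
    cases (tri> _ _ gt) = same _ _ gt at-p′ at-p
    -- Two points of one line with the same abscissa have the same ordinate, so they coincide.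
    cases (tri≈ _ eq _) = p≢p′ (trans (sym (Fin.combine-remQuot {k} (k * K) p))
      (trans (cong₂ Fin.combine i≡ (Fin.toℕ-injective
          (trans (≡ᵇ-elim {toℕ (ordinate p)} a) (trans (cong (value ℓ) i≡) (sym (≡ᵇ-elim {toℕ (ordinate p′)} b))))))
        (Fin.combine-remQuot {k} (k * K) p′)))
      where
      i≡ : abscissa p ≡ abscissa p′
      i≡ = Fin.toℕ-injective eq

allF-cong : ∀ {n} {p q : Fin n → Bool} → (∀ i → p i ≡ q i) → allF p ≡ allF q
allF-cong {zero}  h = refl
allF-cong {suc n} h = cong₂ _∧_ (h zero) (allF-cong (λ i → h (suc i)))

fits : ∀ {h} → (G : Graph) → (Fin h → Bool) → ℕ → Vec (Fin (n G)) h → Fin (n G) → Fin h → Bool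
fits G J l w y i = if J i then Adj G (lookup w i) y else not (toℕ i <ᵇ l) ∨ not (Adj G (lookup w i) y)

-- For l = h these are the vertices of Y whose adjacency to the entries of w is exactly J; a smaller l
-- imposes non-adjacency only on the first l entries.
trace : ∀ {h} → (G : Graph) → VSet G → (Fin h → Bool) → ℕ → Vec (Fin (n G)) h → VSet G
trace G Y J l w y = Y y ∧ allF (fits G J l w y)

-- If entry `l` is not to be adjacent to the representative and the tuple is not bad at `l`, then
-- imposing this non-adjacency costs a large trace at most a factor `T`.
badTuple : ∀ {h} → (G : Graph) → ℕ → VSet G → (Fin h → Bool) → Fin h → Vec (Fin (n G)) h → Bool
badTuple G T Y J l w = not (J l) ∧ nearlyComplete G T (trace G Y J (toℕ l) w) (lookup w l)

nearlyComplete-cong : ∀ G T {W W′ : VSet G} v → (∀ y → W y ≡ W′ y) →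
  nearlyComplete G T W v ≡ nearlyComplete G T W′ v
nearlyComplete-cong G T v h = cong₂ _∧_
  (cong (T * T ≤ᵇ_) (countF-cong h))
  (cong₂ _<ᵇ_ (cong (T *_) (countF-cong (λ y → cong (_∧ not (Adj G v y)) (h y)))) (countF-cong h))

-- Any vertex `v₀` can serve as a dummy; if there is none, nothing is counted.
countF≤-uniform : ∀ {n} (g : Fin n → Bool) (g′ : Fin n → Fin n → Bool) c →
  (∀ v₀ v → g v ≡ true → g′ v₀ v ≡ true) → (∀ v₀ → countF (g′ v₀) ≤ c) → countF g ≤ c
countF≤-uniform {zero}  g g′ c imp le = z≤n
countF≤-uniform {suc n} g g′ c imp le = ≤-trans (countF-mono (imp zero)) (le zero)

-- The trace at stage `toℕ l` does not look at entry `l`: as `J l` is false no adjacency to it is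
-- required, and non-adjacency is imposed only on earlier entries. Hence the bad values at position
-- `l` are nearly complete to one fixed set.
badTuple-coordinate : ∀ G s T → s < T → ¬ HasKss G s → ∀ (Y : VSet G) {h} (J : Fin (suc h) → Bool) l w →
  countF (λ v → badTuple G T Y J l (insertAt w l v)) ≤ s
badTuple-coordinate G s T s<T noK Y {h} J l w = countF≤-uniform _
  (λ v₀ → nearlyComplete G T (trace G Y J (toℕ l) (insertAt w l v₀))) s imp
  (λ v₀ → few-nearlyComplete G s T s<T noK (trace G Y J (toℕ l) (insertAt w l v₀)))
  where
  same-lookup : ∀ v v₀ i → i ≢ l → lookup (insertAt w l v) i ≡ lookup (insertAt w l v₀) i
  same-lookup v v₀ i i≢l = trans (other v) (sym (other v₀))
    where
    other : ∀ x → lookup (insertAt w l x) i ≡ lookup w (Fin.punchOut (λ e → i≢l (sym e)))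
    other x = trans (cong (lookup (insertAt w l x)) (sym (Fin.punchIn-punchOut (λ e → i≢l (sym e)))))
      (insertAt-punchIn w l x _)
  l≮l : (toℕ l <ᵇ toℕ l) ≡ false
  l≮l = ≢true⇒≡false λ e → <-irrefl refl (<ᵇ-elim {toℕ l} e)
  same-fits : J l ≡ false → ∀ v v₀ y i →
    fits G J (toℕ l) (insertAt w l v) y i ≡ fits G J (toℕ l) (insertAt w l v₀) y i
  same-fits Jl v v₀ y i with i Fin.≟ l
  ... | yes refl rewrite Jl | l≮l = refl
  ... | no i≢l rewrite same-lookup v v₀ i i≢l = refl
  imp : ∀ v₀ v → badTuple G T Y J l (insertAt w l v) ≡ true →
    nearlyComplete G T (trace G Y J (toℕ l) (insertAt w l v₀)) v ≡ true
  imp v₀ v e = trans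
    (nearlyComplete-cong G T v (λ y → cong (Y y ∧_)
      (allF-cong (same-fits (not-true⁻¹ (proj₁ (∧-split {not (J l)} e))) v₀ v y))))
    (subst (λ x → nearlyComplete G T (trace G Y J (toℕ l) (insertAt w l v)) x ≡ true)
      (insertAt-lookup w l v) (proj₂ (∧-split {not (J l)} e)))

few-badTuples : ∀ G s T → s < T → ¬ HasKss G s → ∀ (X Y : VSet G) {h} (J : Fin h → Bool) l →
  countF X * sumT h (λ w → 𝟙 (inAll X w ∧ badTuple G T Y J l w)) ≤ s * countF X ^ h
few-badTuples G s T s<T noK X Y {suc h} J l =
  sumT-coordinate h l X s (badTuple G T Y J l) (badTuple-coordinate G s T s<T noK Y J l)

-- The non-adjacencies are imposed one entry at a time, each for a factor `T` since the tuple is not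
-- bad; entries in `J` are free. At least two spare powers keep the trace above `T * T`, where
-- failing to be nearly complete is informative.
trace-large : ∀ G T .{{_ : NonZero T}} (Y : VSet G) {h} (J : Fin h → Bool) (w : Vec (Fin (n G)) h) c →
  (∀ l → badTuple G T Y J l w ≡ false) → T ^ (h + suc (suc c)) ≤ countF (trace G Y J 0 w) →
  ∀ l d → l + d ≡ h → T ^ (d + suc (suc c)) ≤ countF (trace G Y J l w)
trace-large G T Y J w c good large zero    d refl = large
trace-large G T Y {h} J w c good large (suc l) d e = step (J i) refl
  where
  l<h : l < h
  l<h = subst (suc l ≤_) e (m≤m+n (suc l) d)
  i : Fin h
  i = Fin.fromℕ< l<h
  i≡l : toℕ i ≡ l
  i≡l = Fin.toℕ-fromℕ< l<h
  previous : T ^ (suc d + suc (suc c)) ≤ countF (trace G Y J l w)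
  previous = trace-large G T Y J w c good large l (suc d) (trans (+-suc l d) e)
  extend : ∀ y → (∀ j → toℕ j ≡ l → J j ≡ false → Adj G (lookup w j) y ≡ false) →
    trace G Y J l w y ≡ true → trace G Y J (suc l) w y ≡ true
  extend y new q = ∧-join (proj₁ (∧-split q)) (allF-intro (fits G J (suc l) w y) λ j →
    aux j (allF-elim (fits G J l w y) (proj₂ (∧-split {Y y} q)) j))
    where
    aux : ∀ j → fits G J l w y j ≡ true → fits G J (suc l) w y j ≡ true
    aux j f with J j in Jj
    ... | true  = f
    ... | false with toℕ j <? l
    ...   | yes lt rewrite <ᵇ-intro lt = ∨-introʳ f
    ...   | no ¬lt with toℕ j ≟ l
    ...     | yes eq = ∨-introʳ {not (toℕ j <ᵇ suc l)} (not-true (new j eq Jj))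
    ...     | no neq = ∨-introˡ (not-true (≢true⇒≡false λ q′ →
      neq (≤-antisym (≤-pred (<ᵇ-elim {toℕ j} q′)) (≮⇒≥ ¬lt))))
  step : ∀ b → J i ≡ b → T ^ (d + suc (suc c)) ≤ countF (trace G Y J (suc l) w)
  step true Ji = ≤-trans (^-monoʳ-≤ T (n≤1+n (d + suc (suc c)))) (≤-trans previous
    (countF-mono λ y → extend y λ j j≡l Jj → ⊥-elim
      (true≢false (subst (λ x → J x ≡ true) (Fin.toℕ-injective (trans i≡l (sym j≡l))) Ji) Jj)))
  step false Ji = *-cancelˡ-≤ T (begin
    T * T ^ (d + suc (suc c)) ≤⟨ previous ⟩
    countF (trace G Y J l w) ≤⟨ miss-bound G T (trace G Y J l w) (lookup w i) TT≤ not-nearly ⟩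
    T * miss G (trace G Y J l w) (lookup w i) ≤⟨ *-monoʳ-≤ T (countF-mono λ y q →
      extend y (λ j j≡l Jj → subst (λ x → Adj G (lookup w x) y ≡ false)
        (Fin.toℕ-injective (trans i≡l (sym j≡l))) (not-true⁻¹ (proj₂ (∧-split {trace G Y J l w y} q))))
      (proj₁ (∧-split q))) ⟩
    T * countF (trace G Y J (suc l) w) ∎)
    where
    open ≤-Reasoning
    TT≤ : T * T ≤ countF (trace G Y J l w)
    TT≤ = ≤-trans (≤-trans (≤-reflexive (cong (T *_) (sym (*-identityʳ T))))
      (^-monoʳ-≤ T (m≤n⇒m≤o+n (suc d) (s≤s (s≤s z≤n))))) previous
    not-nearly : nearlyComplete G T (trace G Y J l w) (lookup w i) ≡ false
    not-nearly = subst (λ x → nearlyComplete G T (trace G Y J x w) (lookup w i) ≡ false) i≡l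
      (trans (sym (cong (λ b → not b ∧ nearlyComplete G T (trace G Y J (toℕ i) w) (lookup w i)) Ji)) (good i))

-- A `T ^ -(1 + a)` fraction of the vertices `z` sees that same fraction of `X`; raised to the power
-- `h` this gives `suc a * h`, and independence costs `h * h`. The outer `suc` is a spare factor `T`
-- that beats the two penalties.
denseExponent : ℕ → ℕ → ℕ
denseExponent h a = suc (suc a * h + h * h + suc a)

-- For a suitable z ∈ Y, most independent h-tuples in the neighbourhood of z have many common
-- neighbours in Y and are not bad; for such a tuple every line of the linear system has a large
-- trace, and independent representatives of the traces complete the required incidence graph.
module DensePair (G : Graph) (s T k : ℕ) (2≤k : 2 ≤ k) (LS : LinearSystem k) (3≤T : 3 ≤ T) (s<T : s < T)
  (noK : ¬ HasKss G s) (lines<T : LinearSystem.lines LS < T)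
  (incidences≤T : LinearSystem.lines LS * LinearSystem.points LS ≤ T)
  (a : ℕ) (X Y : VSet G) where

  open LinearSystem LS renaming (points to h; lines to e)

  private
    V : Set
    V = Fin (n G)
    β x y : ℕ
    β = denseExponent h a
    x = countF X
    y = countF Y
    instance
      T≢0 : NonZero T
      T≢0 = >-nonZero (≤-trans (s≤s z≤n) s<T)
    U : V → VSet G
    U z v = X v ∧ Adj G z v
    codegree : Vec V h → ℕ
    codegree w = countF (λ z → Y z ∧ inAll (Adj G z) w)
    poor : Vec V h → Bool
    poor w = T ^ β * codegree w <ᵇ y
    -- Values of the gain are 0 or 1, so at a pair of a vertex `z` and a tuple where the penalty is
    -- smaller, the penalty vanishes altogether. Bad tuples are charged in `penalty₂` for every `z`,
    -- since badness does not depend on `z`.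
    gain penalty₁ penalty : V → Vec V h → ℕ
    gain z w = 𝟙 (independentTuple G (U z) w)
    penalty₁ z w = 𝟙 (inAll (U z) w ∧ poor w)
    penalty₂ : Vec V h → ℕ
    penalty₂ w = sumF (λ ℓ → sumF (λ l → 𝟙 (inAll X w ∧ badTuple G T Y (inc ℓ) l w)))
    penalty z w = penalty₁ z w + penalty₂ w

    inAll-U : ∀ z (w : Vec V h) → inAll (U z) w ≡ true → inAll X w ≡ true × inAll (Adj G z) w ≡ true
    inAll-U z w q =
      inAll-intro X w (λ i → proj₁ (∧-split (inAll-elim (U z) w q i))) ,
      inAll-intro (Adj G z) w (λ i → proj₂ (∧-split {X (lookup w i)} (inAll-elim (U z) w q i)))

    -- Dependent random choice: a tuple with few common neighbours in `Y` lies in the neighbourhoods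
    -- of only those few `z`.
    penalty₁-bound : T ^ β * sumOver Y (λ z → sumT h (penalty₁ z)) ≤ x ^ h * y
    penalty₁-bound = begin
      T ^ β * sumOver Y (λ z → sumT h (penalty₁ z))
        ≡⟨ cong (T ^ β *_) (sumOver-sumT-swap h Y penalty₁) ⟩
      T ^ β * sumT h (λ w → sumOver Y (λ z → penalty₁ z w))
        ≡⟨ sym (sumT-*ˡ h (T ^ β) (λ w → sumOver Y (λ z → penalty₁ z w))) ⟩
      sumT h (λ w → T ^ β * sumOver Y (λ z → penalty₁ z w))
        ≤⟨ sumT-mono h pointwise ⟩
      sumT h (λ w → y * 𝟙 (inAll X w))
        ≡⟨ trans (sumT-*ˡ h y (λ w → 𝟙 (inAll X w))) (trans (cong (y *_) (sumT-inAll h X)) (*-comm y _)) ⟩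
      x ^ h * y ∎
      where
      open ≤-Reasoning
      vanish : ∀ w → (∀ z → inAll (U z) w ∧ poor w ≡ false) → sumOver Y (λ z → penalty₁ z w) ≡ 0
      vanish w q = trans (sumF-cong (λ z → aux (Y z) z)) (sumF-zero (n G))
        where
        aux : ∀ b z → (if b then penalty₁ z w else 0) ≡ 0
        aux true  z = cong 𝟙 (q z)
        aux false z = refl
      pointwise : ∀ w → T ^ β * sumOver Y (λ z → penalty₁ z w) ≤ y * 𝟙 (inAll X w)
      pointwise w = cases (inAll X w) (poor w) refl refl
        where
        zero-case : (∀ z → inAll (U z) w ∧ poor w ≡ false) → T ^ β * sumOver Y (λ z → penalty₁ z w) ≤ y * 𝟙 (inAll X w)
        zero-case q = ≤-trans (≤-reflexive (trans (cong (T ^ β *_) (vanish w q)) (*-zeroʳ (T ^ β)))) z≤n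
        cases : ∀ b c → inAll X w ≡ b → poor w ≡ c → T ^ β * sumOver Y (λ z → penalty₁ z w) ≤ y * 𝟙 (inAll X w)
        cases false c eb ec = zero-case λ z → ≢true⇒≡false λ q →
          true≢false (proj₁ (inAll-U z w (proj₁ (∧-split q)))) eb
        cases true false eb ec = zero-case λ z → ≢true⇒≡false λ q →
          true≢false (proj₂ (∧-split {inAll (U z) w} q)) ec
        cases true true eb ec = begin
          T ^ β * sumOver Y (λ z → penalty₁ z w) ≤⟨ *-monoʳ-≤ (T ^ β) (sumF-mono λ z → count (Y z) z) ⟩
          T ^ β * codegree w ≤⟨ <⇒≤ (<ᵇ-elim ec) ⟩
          y ≡⟨ sym (*-identityʳ y) ⟩
          y * 1 ≡⟨ cong (λ b → y * 𝟙 b) (sym eb) ⟩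
          y * 𝟙 (inAll X w) ∎
          where
          count : ∀ b z → (if b then penalty₁ z w else 0) ≤ 𝟙 (b ∧ inAll (Adj G z) w)
          count true  z = 𝟙-mono (λ q → proj₂ (inAll-U z w (proj₁ (∧-split q))))
          count false z = z≤n

  module _ (dense : x * y ≤ T ^ a * sumOver Y (deg G X))
    (large-X : T ^ (β + (2 * h + 3)) ≤ x) (large-Y : T ^ (β + (h + suc (suc e))) ≤ y) where

    private
      instance
        x≢0 : NonZero x
        x≢0 = >-nonZero (≤-trans (m^n>0 T (β + (2 * h + 3))) large-X)
        y≢0 : NonZero y
        y≢0 = >-nonZero (≤-trans (m^n>0 T (β + (h + suc (suc e)))) large-Y)

      -- The bad tuples are at most a fraction `e * h * s / x` of all, where `e * h * s ≤ T * T` and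
      -- `x` is at least `T ^ (2 + β)`.
      penalty₂-bound : T ^ β * sumOver Y (λ z → sumT h penalty₂) ≤ x ^ h * y
      penalty₂-bound = begin
        T ^ β * sumOver Y (λ z → Q) ≡⟨ cong (T ^ β *_) (trans (sumOver-const Y Q) (*-comm y Q)) ⟩
        T ^ β * (Q * y) ≡⟨ sym (*-assoc (T ^ β) Q y) ⟩
        T ^ β * Q * y ≤⟨ *-monoˡ-≤ y T^βQ ⟩
        x ^ h * y ∎
        where
        open ≤-Reasoning
        Q : ℕ
        Q = sumT h penalty₂
        term : Fin e → Fin h → Vec V h → ℕ
        term ℓ l w = 𝟙 (inAll X w ∧ badTuple G T Y (inc ℓ) l w)
        Q-sum : x * Q ≡ sumF (λ ℓ → sumF (λ l → x * sumT h (term ℓ l)))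
        Q-sum = sym (trans
          (trans (sumF-cong (λ ℓ → trans (sumF-*ˡ x (λ l → sumT h (term ℓ l))) (cong (x *_) (sumF-sumT-swap h (term ℓ)))))
                 (sumF-*ˡ x (λ ℓ → sumT h (λ w → sumF (λ l → term ℓ l w)))))
          (cong (x *_) (sumF-sumT-swap h (λ ℓ w → sumF (λ l → term ℓ l w)))))
        xQ : x * Q ≤ T * T * x ^ h
        xQ = begin
          x * Q ≡⟨ Q-sum ⟩
          sumF (λ ℓ → sumF (λ l → x * sumT h (term ℓ l)))
            ≤⟨ sumF-mono (λ ℓ → sumF-mono (λ l → few-badTuples G s T s<T noK X Y (inc ℓ) l)) ⟩
          sumF {e} (λ ℓ → sumF {h} (λ l → s * x ^ h))
            ≡⟨ trans (sumF-cong {e} (λ ℓ → sumF-const h (s * x ^ h))) (sumF-const e (h * (s * x ^ h))) ⟩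
          e * (h * (s * x ^ h))
            ≡⟨ trans (sym (*-assoc e h _)) (sym (*-assoc (e * h) s (x ^ h))) ⟩
          e * h * s * x ^ h
            ≤⟨ *-monoˡ-≤ (x ^ h) (*-mono-≤ incidences≤T (<⇒≤ s<T)) ⟩
          T * T * x ^ h ∎
        T^βQ : T ^ β * Q ≤ x ^ h
        T^βQ = *-cancelˡ-≤ (T * T) {{m*n≢0 T T}} (begin
          T * T * (T ^ β * Q) ≡⟨ trans (sym (*-assoc (T * T) (T ^ β) Q)) (cong (_* Q) (*-assoc T T (T ^ β))) ⟩
          T ^ (2 + β) * Q ≤⟨ *-monoˡ-≤ Q (≤-trans (^-monoʳ-≤ T exponent) large-X) ⟩
          x * Q ≤⟨ xQ ⟩
          T * T * x ^ h ∎)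
          where
          exponent : 2 + β ≤ β + (2 * h + 3)
          exponent = ≤-trans (≤-reflexive (+-comm 2 β)) (+-monoʳ-≤ β (≤-trans (s≤s (s≤s z≤n)) (m≤n+m 3 (2 * h))))

      gain-bound : T * (x ^ h * y) ≤ T ^ β * sumOver Y (λ z → sumT h (gain z))
      gain-bound = begin
        T * (x ^ h * y) ≤⟨ *-monoʳ-≤ T step ⟩
        T * (T ^ β′ * L) ≡⟨ sym (*-assoc T (T ^ β′) L) ⟩
        T ^ β * L ∎
        where
        open ≤-Reasoning
        β′ L : ℕ
        β′ = suc a * h + h * h + suc a
        L  = sumOver Y (λ z → sumT h (gain z))
        rich : V → Bool
        rich z = x ≤ᵇ T ^ suc a * deg G X z
        Y₁ : VSet G
        Y₁ z = Y z ∧ rich z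
        per-vertex : ∀ z → (if Y z then T ^ suc a * deg G X z else 0) ≤ (if Y₁ z then T ^ suc a * x else 0) + (if Y z then x else 0)
        per-vertex z with Y z
        ... | false = z≤n
        ... | true with rich z in q
        ...   | true  = ≤-trans (*-monoʳ-≤ (T ^ suc a) (countF-mono {P = U z} {Q = X} (λ v r → proj₁ (∧-split r)))) (m≤m+n _ x)
        ...   | false = <⇒≤ (≰⇒> (λ r → true≢false (≤ᵇ-intro r) q))
        many-rich : y ≤ T ^ suc a * countF Y₁
        many-rich = *-cancelˡ-≤ x (absorb {T} (≤-trans (s≤s (s≤s z≤n)) 3≤T) (begin
          T * (x * y) ≤⟨ *-monoʳ-≤ T dense ⟩
          T * (T ^ a * sumOver Y (deg G X)) ≡⟨ sym (*-assoc T (T ^ a) _) ⟩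
          T ^ suc a * sumOver Y (deg G X) ≡⟨ sym (sumOver-*ˡ Y (T ^ suc a) (deg G X)) ⟩
          sumOver Y (λ z → T ^ suc a * deg G X z) ≤⟨ sumF-mono per-vertex ⟩
          sumF (λ z → (if Y₁ z then T ^ suc a * x else 0) + (if Y z then x else 0))
            ≡⟨ sumF-+ (λ z → if Y₁ z then T ^ suc a * x else 0) (λ z → if Y z then x else 0) ⟩
          sumOver Y₁ (λ _ → T ^ suc a * x) + sumOver Y (λ _ → x)
            ≡⟨ cong₂ _+_ (sumOver-const Y₁ (T ^ suc a * x)) (sumOver-const Y x) ⟩
          countF Y₁ * (T ^ suc a * x) + y * x ≡⟨ r (countF Y₁) (T ^ suc a) x y ⟩
          x * y + x * (T ^ suc a * countF Y₁) ∎))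
          where
          r : ∀ c t x y → c * (t * x) + y * x ≡ x * y + x * (t * c)
          r = solve-∀
        T^2h : ∀ z → rich z ≡ true → T ^ (2 * h) ≤ deg G X z
        T^2h z q = *-cancelˡ-≤ (T ^ suc a) {{m^n≢0 T (suc a)}} (begin
          T ^ suc a * T ^ (2 * h) ≡⟨ sym (^-distribˡ-+-* T (suc a) (2 * h)) ⟩
          T ^ (suc a + 2 * h) ≤⟨ ^-monoʳ-≤ T (+-mono-≤ (≤-trans (m≤n+m (suc a) (suc a * h + h * h)) (n≤1+n _)) (m≤m+n (2 * h) 3)) ⟩
          T ^ (β + (2 * h + 3)) ≤⟨ large-X ⟩
          x ≤⟨ ≤ᵇ-elim q ⟩
          T ^ suc a * deg G X z ∎)
        per-rich : ∀ z → Y₁ z ≡ true → x ^ h ≤ T ^ (suc a * h + h * h) * sumT h (gain z)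
        per-rich z q = begin
          x ^ h ≤⟨ ^-monoˡ-≤ h (≤ᵇ-elim (proj₂ (∧-split {Y z} q))) ⟩
          (T ^ suc a * deg G X z) ^ h ≡⟨ ^-distribʳ-* h (T ^ suc a) (deg G X z) ⟩
          (T ^ suc a) ^ h * deg G X z ^ h ≡⟨ cong (_* deg G X z ^ h) (^-*-assoc T (suc a) h) ⟩
          T ^ (suc a * h) * deg G X z ^ h ≤⟨ *-monoʳ-≤ (T ^ (suc a * h)) (many-independentTuples G s T
            (≤-trans (s≤s (s≤s z≤n)) 3≤T) s<T noK h (U z) (T^2h z (proj₂ (∧-split {Y z} q)))) ⟩
          T ^ (suc a * h) * (T ^ (h * h) * sumT h (gain z)) ≡⟨ sym (*-assoc (T ^ (suc a * h)) (T ^ (h * h)) _) ⟩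
          T ^ (suc a * h) * T ^ (h * h) * sumT h (gain z) ≡⟨ cong (_* sumT h (gain z)) (sym (^-distribˡ-+-* T (suc a * h) (h * h))) ⟩
          T ^ (suc a * h + h * h) * sumT h (gain z) ∎
        step : x ^ h * y ≤ T ^ β′ * L
        step = begin
          x ^ h * y ≤⟨ *-monoʳ-≤ (x ^ h) many-rich ⟩
          x ^ h * (T ^ suc a * countF Y₁) ≡⟨ r (x ^ h) (T ^ suc a) (countF Y₁) ⟩
          T ^ suc a * (countF Y₁ * x ^ h) ≤⟨ *-monoʳ-≤ (T ^ suc a) (sumOver-≥const Y₁ (x ^ h) per-rich) ⟩
          T ^ suc a * sumOver Y₁ (λ z → T ^ γ * sumT h (gain z))
            ≤⟨ *-monoʳ-≤ (T ^ suc a) (sumOver-monoˢ (λ z → T ^ γ * sumT h (gain z)) (λ z q → proj₁ (∧-split q))) ⟩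
          T ^ suc a * sumOver Y (λ z → T ^ γ * sumT h (gain z))
            ≡⟨ cong (T ^ suc a *_) (sumOver-*ˡ Y (T ^ γ) (λ z → sumT h (gain z))) ⟩
          T ^ suc a * (T ^ γ * L) ≡⟨ trans (sym (*-assoc (T ^ suc a) (T ^ γ) L)) (cong (_* L) (*-comm (T ^ suc a) (T ^ γ))) ⟩
          T ^ γ * T ^ suc a * L ≡⟨ cong (_* L) (sym (^-distribˡ-+-* T γ (suc a))) ⟩
          T ^ β′ * L ∎
          where
          γ : ℕ
          γ = suc a * h + h * h
          r : ∀ p t c → p * (t * c) ≡ t * (c * p)
          r = solve-∀

      penalty<gain : sumOver Y (λ z → sumT h (penalty z)) < sumOver Y (λ z → sumT h (gain z))
      penalty<gain = *-cancelˡ-< (T ^ β) _ _ (begin-strict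
        T ^ β * sumOver Y (λ z → sumT h (penalty z))
          ≡⟨ cong (T ^ β *_) (trans (sumOver-cong Y (λ z → sumT-+ h (penalty₁ z) penalty₂))
               (sumOver-+ Y (λ z → sumT h (penalty₁ z)) (λ z → sumT h penalty₂))) ⟩
        T ^ β * (sumOver Y (λ z → sumT h (penalty₁ z)) + sumOver Y (λ z → sumT h penalty₂))
          ≡⟨ *-distribˡ-+ (T ^ β) (sumOver Y (λ z → sumT h (penalty₁ z))) _ ⟩
        T ^ β * sumOver Y (λ z → sumT h (penalty₁ z)) + T ^ β * sumOver Y (λ z → sumT h penalty₂)
          ≤⟨ +-mono-≤ penalty₁-bound penalty₂-bound ⟩
        x ^ h * y + x ^ h * y ≡⟨ cong (x ^ h * y +_) (sym (+-identityʳ (x ^ h * y))) ⟩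
        2 * (x ^ h * y) <⟨ *-monoˡ-< (x ^ h * y) {{m*n≢0 (x ^ h) y {{m^n≢0 x h}}}} 3≤T ⟩
        T * (x ^ h * y) ≤⟨ gain-bound ⟩
        T ^ β * sumOver Y (λ z → sumT h (gain z)) ∎)
        where open ≤-Reasoning

      good-tuple : ∃ λ (w : Vec V h) → (∀ i j → Adj G (lookup w i) (lookup w j) ≡ false) ×
        Injective _≡_ _≡_ (lookup w) × y ≤ T ^ β * codegree w ×
        (∀ ℓ l → badTuple G T Y (inc ℓ) l w ≡ false)
      good-tuple with sumOver-<⇒∃< Y (λ z → sumT h (penalty z)) (λ z → sumT h (gain z)) penalty<gain
      ... | z , _ , p with sumT-<⇒∃< h (penalty z) (gain z) p
      ... | w , q = w , independentTuple-adj G (U z) w indep , independentTuple-injective G (U z) w indep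
                  , <ᵇ-false not-poor , not-bad
        where
        indep : independentTuple G (U z) w ≡ true
        indep = 𝟙-true⁻¹ q
        in-U : inAll (U z) w ≡ true
        in-U = inAll-intro (U z) w (independentTuple-in G (U z) w indep)
        no-penalty : penalty z w ≡ 0
        no-penalty = n<1⇒n≡0 (≤-trans q (𝟙≤1 (independentTuple G (U z) w)))
        not-poor : poor w ≡ false
        not-poor = trans (sym (cong (_∧ poor w) in-U)) (𝟙≡0 (m+n≡0⇒m≡0 (penalty₁ z w) no-penalty))
        not-bad : ∀ ℓ l → badTuple G T Y (inc ℓ) l w ≡ false
        not-bad ℓ l = trans (sym (cong (_∧ badTuple G T Y (inc ℓ) l w) (proj₁ (inAll-U z w in-U))))
          (𝟙≡0 (sumF≡0⇒≡0 (λ l → 𝟙 (inAll X w ∧ badTuple G T Y (inc ℓ) l w))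
            (sumF≡0⇒≡0 (λ ℓ → sumF (λ l → 𝟙 (inAll X w ∧ badTuple G T Y (inc ℓ) l w)))
              (m+n≡0⇒n≡0 (penalty₁ z w) no-penalty) ℓ) l))

    private
      -- The common neighbours of all entries lie in the stage 0 trace of every line, because that
      -- stage asks only for the adjacencies.
      traces-large : ∀ w → y ≤ T ^ β * codegree w → (∀ ℓ l → badTuple G T Y (inc ℓ) l w ≡ false) →
        ∀ ℓ → T ^ suc e ≤ countF (trace G Y (inc ℓ) h w)
      traces-large w rich not-bad = large
        where
        open ≤-Reasoning
        start-large : ∀ ℓ → T ^ (h + suc (suc e)) ≤ countF (trace G Y (inc ℓ) 0 w)
        start-large ℓ = *-cancelˡ-≤ (T ^ β) {{m^n≢0 T β}} (begin
          T ^ β * T ^ (h + suc (suc e)) ≡⟨ sym (^-distribˡ-+-* T β (h + suc (suc e))) ⟩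
          T ^ (β + (h + suc (suc e))) ≤⟨ large-Y ⟩
          y ≤⟨ rich ⟩
          T ^ β * codegree w ≤⟨ *-monoʳ-≤ (T ^ β) (countF-mono {P = λ z → Y z ∧ inAll (Adj G z) w} {Q = trace G Y (inc ℓ) 0 w} λ z q →
            ∧-join (proj₁ (∧-split q)) (allF-intro (fits G (inc ℓ) 0 w z) λ i →
              fit ℓ z i (inAll-elim (Adj G z) w (proj₂ (∧-split {Y z} q)) i))) ⟩
          T ^ β * countF (trace G Y (inc ℓ) 0 w) ∎)
          where
          fit : ∀ ℓ z i → Adj G z (lookup w i) ≡ true → fits G (inc ℓ) 0 w z i ≡ true
          fit ℓ z i q with inc ℓ i
          ... | true  = adj-sym G q
          ... | false = refl
        large : ∀ ℓ → T ^ suc e ≤ countF (trace G Y (inc ℓ) h w)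
        large ℓ = ≤-trans (^-monoʳ-≤ T (n≤1+n (suc e)))
          (trace-large G T Y (inc ℓ) w e (not-bad ℓ) (start-large ℓ) h 0 (+-identityʳ h))

      -- Two lines with the same representative would share the two points `first` and `second`, so
      -- `ys` is injective. A representative is adjacent to some entry of `w`, hence not itself an
      -- entry, as these are independent.
      assemble : ∀ w → (∀ i j → Adj G (lookup w i) (lookup w j) ≡ false) → Injective _≡_ _≡_ (lookup w) →
        (ys : Fin e → V) → (∀ ℓ → trace G Y (inc ℓ) h w (ys ℓ) ≡ true) →
        (∀ ℓ ℓ′ → Adj G (ys ℓ) (ys ℓ′) ≡ false) → C4FreeSubgraph G k
      assemble w w-indep w-inj ys ys-in ys-indep =
        C4FreeSubgraph-intro G k A B disjoint indepA indepB k≤deg B≤A 1≤A lin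
        where
        A B : VSet G
        A = image ys
        B = image (lookup w)
        fit : ∀ ℓ i → fits G (inc ℓ) h w (ys ℓ) i ≡ true
        fit ℓ = allF-elim (fits G (inc ℓ) h w (ys ℓ)) (proj₂ (∧-split {Y (ys ℓ)} (ys-in ℓ)))
        inc⇒adj : ∀ ℓ i → inc ℓ i ≡ true → Adj G (ys ℓ) (lookup w i) ≡ true
        inc⇒adj ℓ i q = adj-sym G (trans
          (sym (cong (λ b → if b then Adj G (lookup w i) (ys ℓ) else not (toℕ i <ᵇ h) ∨ not (Adj G (lookup w i) (ys ℓ))) q))
          (fit ℓ i))
        adj⇒inc : ∀ ℓ i → Adj G (ys ℓ) (lookup w i) ≡ true → inc ℓ i ≡ true
        adj⇒inc ℓ i q with inc ℓ i | fit ℓ i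
        ... | true  | _ = refl
        ... | false | f rewrite <ᵇ-intro (Fin.toℕ<n i) | adj-sym G q = f
        first second : Fin k
        first  = Fin.fromℕ< (≤-trans (s≤s z≤n) 2≤k)
        second = Fin.fromℕ< 2≤k
        first≢second : first ≢ second
        first≢second q = case trans (sym (Fin.toℕ-fromℕ< (≤-trans (s≤s z≤n) 2≤k)))
          (trans (cong toℕ q) (Fin.toℕ-fromℕ< 2≤k)) of λ ()
        shared : ∀ ℓ ℓ′ i i′ → ℓ ≢ ℓ′ → i ≢ i′ →
          Adj G (ys ℓ) (lookup w i) ≡ true → Adj G (ys ℓ) (lookup w i′) ≡ true →
          Adj G (ys ℓ′) (lookup w i) ≡ true → Adj G (ys ℓ′) (lookup w i′) ≡ true → ⊥
        shared ℓ ℓ′ i i′ ≢ℓ ≢i p q r t = linear ℓ ℓ′ i i′ ≢ℓ ≢i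
          (adj⇒inc ℓ i p) (adj⇒inc ℓ i′ q) (adj⇒inc ℓ′ i r) (adj⇒inc ℓ′ i′ t)
        ys-inj : Injective _≡_ _≡_ ys
        ys-inj {ℓ} {ℓ′} eq with ℓ Fin.≟ ℓ′
        ... | yes q = q
        ... | no ≢ℓ = ⊥-elim (shared ℓ ℓ′ (point ℓ first) (point ℓ second) ≢ℓ
          (λ q → first≢second (point-injective ℓ q)) (on first) (on second)
          (on′ first) (on′ second))
          where
          on : ∀ i → Adj G (ys ℓ) (lookup w (point ℓ i)) ≡ true
          on i = inc⇒adj ℓ (point ℓ i) (point-inc ℓ i)
          on′ : ∀ i → Adj G (ys ℓ′) (lookup w (point ℓ i)) ≡ true
          on′ i = subst (λ v → Adj G v (lookup w (point ℓ i)) ≡ true) eq (on i)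
        disjoint : ∀ v → A v ≡ true → B v ≡ false
        disjoint v av = ≢true⇒≡false λ bv → aux v (image-elim ys v av) (image-elim (lookup w) v bv)
          where
          aux : ∀ v → (∃ λ ℓ → ys ℓ ≡ v) → (∃ λ i → lookup w i ≡ v) → ⊥
          aux v (ℓ , refl) (i , q) = true≢false
            (subst (λ x → Adj G x (lookup w (point ℓ first)) ≡ true) (sym q)
              (inc⇒adj ℓ (point ℓ first) (point-inc ℓ first)))
            (w-indep i (point ℓ first))
        indepA : Independent G A
        indepA u v au av with image-elim ys u au | image-elim ys v av
        ... | ℓ , refl | ℓ′ , refl = ys-indep ℓ ℓ′
        indepB : Independent G B
        indepB u v bu bv with image-elim (lookup w) u bu | image-elim (lookup w) v bv
        ... | i , refl | j , refl = w-indep i j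
        k≤deg : ∀ v → A v ≡ true → k ≤ deg G B v
        k≤deg v av with image-elim ys v av
        ... | ℓ , refl = injection⇒≤countF (λ v → B v ∧ Adj G (ys ℓ) v) (λ i → lookup w (point ℓ i))
          (λ q → point-injective ℓ (w-inj q))
          (λ i → ∧-join (image-intro (lookup w) (point ℓ i)) (inc⇒adj ℓ (point ℓ i) (point-inc ℓ i)))
        size-A : countF A ≡ e
        size-A = countF-image ys ys-inj
        B≤A : countF B ≤ countF A
        B≤A = ≤-trans (countF-image≤ (lookup w)) (≤-trans points≤lines (≤-reflexive (sym size-A)))
        1≤A : 1 ≤ countF A
        1≤A = ≤-trans 1≤lines (≤-reflexive (sym size-A))
        lin : ∀ a a′ b b′ → A a ≡ true → A a′ ≡ true → B b ≡ true → B b′ ≡ true → a ≢ a′ → b ≢ b′ →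
          Adj G a b ≡ true → Adj G a b′ ≡ true → Adj G a′ b ≡ true → Adj G a′ b′ ≡ true → ⊥
        lin a a′ b b′ pa pa′ pb pb′ a≢ b≢
          with image-elim ys a pa | image-elim ys a′ pa′ | image-elim (lookup w) b pb | image-elim (lookup w) b′ pb′
        ... | ℓ , refl | ℓ′ , refl | i , refl | i′ , refl =
          shared ℓ ℓ′ i i′ (λ q → a≢ (cong ys q)) (λ q → b≢ (cong (lookup w) q))

    dense-pair : C4FreeSubgraph G k
    dense-pair =
      let (w , w-indep , w-inj , rich , not-bad) = good-tuple
          (ys , ys-in , ys-indep) = independent-representatives G s T s<T noK e lines<T
            (λ ℓ → trace G Y (inc ℓ) h w) (traces-large w rich not-bad)
      in assemble w w-indep w-inj ys ys-in ys-indep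

-- Orientations of bounded outdegree and random independent sets

record Orientation (G : Graph) (D : ℕ) : Set where
  field
    arc       : Fin (n G) → Fin (n G) → Bool
    arc⇒adj   : ∀ u v → arc u v ≡ true → Adj G u v ≡ true
    adj⇒arc   : ∀ u v → Adj G u v ≡ true → arc u v ≡ true ⊎ arc v u ≡ true
    outdegree : ∀ u → countF (arc u) ≤ D

PartialOrientation : (G : Graph) → ℕ → VSet G → Set
PartialOrientation G D X = ∃ λ (O : Fin (n G) → Fin (n G) → Bool) →
  (∀ u v → O u v ≡ true → Adj G u v ≡ true) ×
  (∀ u v → X u ≡ true → X v ≡ true → Adj G u v ≡ true → O u v ≡ true ⊎ O v u ≡ true) ×
  (∀ u → countF (O u) ≤ D)

_∖_ : ∀ {n} → (Fin n → Bool) → Fin n → Fin n → Bool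
(X ∖ v) x = X x ∧ not (v == x)

∖-split : ∀ {n} (X : Fin n → Bool) v x → X x ≡ true → v ≡ x ⊎ (X ∖ v) x ≡ true
∖-split X v x e with v == x in q
... | true  = inj₁ (==⇒≡ v x q)
... | false = inj₂ (∧-join e refl)

countF-∖ : ∀ {n} (X : Fin n → Bool) v → X v ≡ true → countF (X ∖ v) < countF X
countF-∖ X v xv = ≤-trans (≤-reflexive (sym (countF-insert v (X ∖ v) fresh)))
  (countF-mono {P = insert v (X ∖ v)} {Q = X} λ x e → case insert-elim v (X ∖ v) x e of λ
    { (inj₁ refl) → xv ; (inj₂ q) → proj₁ (∧-split q) })
  where
  fresh : (X ∖ v) v ≡ false
  fresh = ≢true⇒≡false λ e → true≢false (==-refl v) (not-true⁻¹ (proj₂ (∧-split {X v} e)))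

extend-orientation : ∀ G D X v → deg G X v ≤ D → PartialOrientation G D (X ∖ v) → PartialOrientation G D X
extend-orientation G D X v low (O′ , sub′ , total′ , out′) = O , sub , total , out
  where
  O : Fin (n G) → Fin (n G) → Bool
  O u w = if v == u then X w ∧ Adj G v w else O′ u w
  sub : ∀ u w → O u w ≡ true → Adj G u w ≡ true
  sub u w e with v == u in q
  ... | true  = subst (λ x → Adj G x w ≡ true) (==⇒≡ v u q) (proj₂ (∧-split {X w} e))
  ... | false = sub′ u w e
  out : ∀ u → countF (O u) ≤ D
  out u with v == u
  ... | true  = low
  ... | false = out′ u
  from-v : ∀ w → X w ≡ true → Adj G v w ≡ true → O v w ≡ true
  from-v w xw e rewrite ==-refl v = ∧-join xw e
  lift : ∀ u w → (X ∖ v) u ≡ true → O′ u w ≡ true → O u w ≡ true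
  lift u w xu e rewrite not-true⁻¹ (proj₂ (∧-split {X u} xu)) = e
  total : ∀ u w → X u ≡ true → X w ≡ true → Adj G u w ≡ true → O u w ≡ true ⊎ O w u ≡ true
  total u w xu xw e with ∖-split X v u xu | ∖-split X v w xw
  ... | inj₁ refl | _         = inj₁ (from-v w xw e)
  ... | inj₂ _    | inj₁ refl = inj₂ (from-v u xu (adj-sym G e))
  ... | inj₂ pu   | inj₂ pw with total′ u w pu pw e
  ...   | inj₁ o = inj₁ (lift u w pu o)
  ...   | inj₂ o = inj₂ (lift w u pw o)

-- Every nonempty set has a vertex of at most average degree, hence of degree at most `D` in it.
-- Such vertices are peeled off one by one, and an edge is oriented away from the end that is
-- removed first.
degenerate⇒orientation : ∀ G D → (∀ (Y : VSet G) → sumOver Y (deg G Y) ≤ D * countF Y) → Orientation G D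
degenerate⇒orientation G D mad =
  let (O , sub , total , out) = go (countF {n G} (λ _ → true)) (λ _ → true) ≤-refl
  in record { arc = O ; arc⇒adj = sub ; adj⇒arc = λ u v → total u v refl refl ; outdegree = out }
  where
  low-degree : ∀ X → 1 ≤ countF X → ∃ λ v → X v ≡ true × deg G X v < suc D
  low-degree X 1≤X = sumOver-<⇒∃< X (deg G X) (λ _ → suc D) (begin-strict
    sumOver X (deg G X) ≤⟨ mad X ⟩
    D * countF X <⟨ *-monoˡ-< (countF X) {{>-nonZero 1≤X}} (n<1+n D) ⟩
    suc D * countF X ≡⟨ *-comm (suc D) (countF X) ⟩
    countF X * suc D ≡⟨ sym (sumOver-const X (suc D)) ⟩
    sumOver X (λ _ → suc D) ∎)
    where open ≤-Reasoning
  go : ∀ c (X : VSet G) → countF X ≤ c → PartialOrientation G D X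
  go zero X le = (λ _ → ∅) , (λ _ _ ()) ,
    (λ u v xu → ⊥-elim (<⇒≱ (∃⇒1≤countF X u xu) le)) , (λ u → ≤-trans (≤-reflexive (countF-∅ (n G))) z≤n)
  go (suc c) X le with 1 ≤? countF X
  ... | no ¬1≤  = go c X (≤-trans (≤-pred (≰⇒> ¬1≤)) z≤n)
  ... | yes 1≤X = let (v , xv , low) = low-degree X 1≤X in
    extend-orientation G D X v (≤-pred low) (go c (X ∖ v) (≤-pred (≤-trans (countF-∖ X v xv) le)))

module Sampling (G : Graph) (D : ℕ) (𝒪 : Orientation G D) (B : VSet G) where

  open Orientation 𝒪

  kept : VSet G → VSet G
  kept S b = (B b ∧ S b) ∧ not (anyF (λ j → arc b j ∧ (B j ∧ S j)))

  kept⇒B : ∀ S b → kept S b ≡ true → B b ≡ true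
  kept⇒B S b e = proj₁ (∧-split {B b} (proj₁ (∧-split e)))

  kept⇒S : ∀ S b → kept S b ≡ true → S b ≡ true
  kept⇒S S b e = proj₂ (∧-split {B b} (proj₁ (∧-split e)))

  kept-no-arc : ∀ S u v → kept S u ≡ true → kept S v ≡ true → arc u v ≡ true → ⊥
  kept-no-arc S u v ku kv o = true≢false
    (anyF-intro (λ j → arc u j ∧ (B j ∧ S j)) v (∧-join o (proj₁ (∧-split kv))))
    (not-true⁻¹ (proj₂ (∧-split {B u ∧ S u} ku)))

  kept-independent : ∀ S → Independent G (kept S)
  kept-independent S u v ku kv = ≢true⇒≡false λ e → case adj⇒arc u v e of λ
    { (inj₁ o) → kept-no-arc S u v ku kv o ; (inj₂ o) → kept-no-arc S v u kv ku o }

  module Isolation (a : Fin (n G)) (I : VSet G) (I⊆ : ∀ b → I b ≡ true → B b ∧ Adj G a b ≡ true)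
    (I-indep : Independent G I) where

    -- Vertices whose sampling could spoil `I` as the kept neighbourhood of `a`: other neighbours of
    -- `a` in `B`, and out-neighbours of `I`. In-neighbours of `I` are harmless, since a sampled one
    -- is itself dropped; this is what makes the set small.
    forbidden : VSet G
    forbidden j = not (I j) ∧ ((B j ∧ Adj G a j) ∨ anyF (λ b → I b ∧ arc b j))

    isolates : VSet G → Bool
    isolates S = (I ⊆ᵇ S) ∧ not (anyF (λ j → forbidden j ∧ S j))

    isolates⇒ : ∀ S → isolates S ≡ true → ∀ b → (kept S b ∧ Adj G a b) ≡ I b
    isolates⇒ S e b = Bool-ext to from
      where
      none : ∀ j → forbidden j ≡ true → S j ≡ true → ⊥
      none j f q = true≢false (anyF-intro (λ j → forbidden j ∧ S j) j (∧-join f q))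
        (not-true⁻¹ (proj₂ (∧-split {I ⊆ᵇ S} e)))
      in-S : ∀ b → I b ≡ true → S b ≡ true
      in-S = ⊆ᵇ-elim I S (proj₁ (∧-split e))
      to : kept S b ∧ Adj G a b ≡ true → I b ≡ true
      to q with I b in ib
      ... | true  = refl
      ... | false = ⊥-elim (none b
        (∧-join (not-true ib) (∨-introˡ (∧-join (kept⇒B S b (proj₁ (∧-split q))) (proj₂ (∧-split {kept S b} q)))))
        (kept⇒S S b (proj₁ (∧-split q))))
      no-out : anyF (λ j → arc b j ∧ (B j ∧ S j)) ≡ true → I b ≡ true → ⊥
      no-out q ib with anyF-elim (λ j → arc b j ∧ (B j ∧ S j)) q
      ... | j , r with I j in ij
      ...   | true  = true≢false (arc⇒adj b j (proj₁ (∧-split r))) (I-indep b j ib ij)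
      ...   | false = none j
        (∧-join (not-true ij) (∨-introʳ {B j ∧ Adj G a j} (anyF-intro (λ b → I b ∧ arc b j) b (∧-join ib (proj₁ (∧-split r))))))
        (proj₂ (∧-split {B j} (proj₂ (∧-split {arc b j} r))))
      from : I b ≡ true → kept S b ∧ Adj G a b ≡ true
      from ib = ∧-join
        (∧-join (∧-join (proj₁ (∧-split (I⊆ b ib))) (in-S b ib)) (not-true (≢true⇒≡false λ q → no-out q ib)))
        (proj₂ (∧-split {B b} (I⊆ b ib)))

    forbidden-size : countF forbidden ≤ deg G B a + countF I * D
    forbidden-size = begin
      countF forbidden
        ≤⟨ sumF-mono pointwise ⟩
      sumF (λ j → 𝟙 (B j ∧ Adj G a j) + sumOver I (λ b → 𝟙 (arc b j)))
        ≡⟨ sumF-+ (λ j → 𝟙 (B j ∧ Adj G a j)) (λ j → sumOver I (λ b → 𝟙 (arc b j))) ⟩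
      deg G B a + sumF (λ j → sumOver I (λ b → 𝟙 (arc b j)))
        ≡⟨ cong (deg G B a +_) (sym (sumOver-sumF-swap I (λ b j → 𝟙 (arc b j)))) ⟩
      deg G B a + sumOver I (λ b → countF (arc b))
        ≤⟨ +-monoʳ-≤ (deg G B a) (sumOver-≤const I D (λ b _ → outdegree b)) ⟩
      deg G B a + countF I * D ∎
      where
      open ≤-Reasoning
      pointwise : ∀ j → 𝟙 (forbidden j) ≤ 𝟙 (B j ∧ Adj G a j) + sumOver I (λ b → 𝟙 (arc b j))
      pointwise j = 𝟙≤ (forbidden j) λ e → case ∨-elim {B j ∧ Adj G a j} (proj₂ (∧-split {not (I j)} e)) of λ
        { (inj₁ q) → ≤-trans (𝟙-true q) (m≤m+n _ _)
        ; (inj₂ q) → let (b , r) = anyF-elim (λ b → I b ∧ arc b j) q in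
            ≤-trans (≤-trans (hit (I b) (arc b j) r) (sumF-member (λ b → if I b then 𝟙 (arc b j) else 0) b)) (m≤n+m _ _) }
        where
        hit : ∀ x y → x ∧ y ≡ true → 1 ≤ (if x then 𝟙 y else 0)
        hit true true e = ≤-refl

    -- Given that `I` is sampled, each forbidden vertex is sampled with probability `1 / (1 + c)`;
    -- by the union bound all are missed with probability at least one half.
    isolates-𝔼 : ∀ c → 2 * countF forbidden ≤ suc c →
      suc c ^ n G ≤ 2 * (suc c ^ countF I * 𝔼 c (λ S → 𝟙 (isolates S)))
    isolates-𝔼 c small = *-cancelˡ-≤ M (+-cancelˡ-≤ (M * w) (M * w) (M * (2 * (Mᵣ * p))) (begin
      M * w + M * w
        ≡⟨ double (M * w) ⟩
      2 * (M * w)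
        ≡⟨ cong (λ x → 2 * (M * x)) (sym (trans (*-comm Mᵣ (𝔼 c (λ S → 𝟙 (I ⊆ᵇ S)))) (𝔼-⊆ c I))) ⟩
      2 * (M * (Mᵣ * 𝔼 c (λ S → 𝟙 (I ⊆ᵇ S))))
        ≤⟨ *-monoʳ-≤ 2 (*-monoʳ-≤ M (*-monoʳ-≤ Mᵣ union)) ⟩
      2 * (M * (Mᵣ * (p + sumOver forbidden (λ j → 𝔼 c (λ S → 𝟙 (insert j I ⊆ᵇ S))))))
        ≡⟨ expand M Mᵣ p (sumOver forbidden (λ j → 𝔼 c (λ S → 𝟙 (insert j I ⊆ᵇ S)))) ⟩
      2 * (M * Mᵣ * sumOver forbidden (λ j → 𝔼 c (λ S → 𝟙 (insert j I ⊆ᵇ S)))) + M * (2 * (Mᵣ * p))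
        ≡⟨ cong (λ x → 2 * x + M * (2 * (Mᵣ * p))) (trans
             (sym (sumOver-*ˡ forbidden (M * Mᵣ) (λ j → 𝔼 c (λ S → 𝟙 (insert j I ⊆ᵇ S)))))
             (trans (sumF-cong (λ j → one j (forbidden j) refl)) (sumOver-const forbidden w))) ⟩
      2 * (countF forbidden * w) + M * (2 * (Mᵣ * p))
        ≤⟨ +-monoˡ-≤ (M * (2 * (Mᵣ * p))) (≤-trans (≤-reflexive (sym (*-assoc 2 (countF forbidden) w))) (*-monoˡ-≤ w small)) ⟩
      M * w + M * (2 * (Mᵣ * p)) ∎))
      where
      open ≤-Reasoning
      M Mᵣ w p : ℕ
      M = suc c
      Mᵣ = suc c ^ countF I
      w = suc c ^ n G
      p = 𝔼 c (λ S → 𝟙 (isolates S))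
      double : ∀ x → x + x ≡ 2 * x
      double = solve-∀
      expand : ∀ M r p q → 2 * (M * (r * (p + q))) ≡ 2 * (M * r * q) + M * (2 * (r * p))
      expand = solve-∀
      one : ∀ j b → forbidden j ≡ b → (if b then M * Mᵣ * 𝔼 c (λ S → 𝟙 (insert j I ⊆ᵇ S)) else 0) ≡ (if b then w else 0)
      one j false e = refl
      one j true  e = trans (*-comm (M * Mᵣ) _)
        (trans (cong (λ x → 𝔼 c (λ S → 𝟙 (insert j I ⊆ᵇ S)) * suc c ^ x) (sym size-insert)) (𝔼-⊆ c (insert j I)))
        where
        size-insert : countF (insert j I) ≡ suc (countF I)
        size-insert = countF-insert j I (not-true⁻¹ (proj₁ (∧-split e)))
      pointwise : ∀ S → 𝟙 (I ⊆ᵇ S) ≤ 𝟙 (isolates S) + sumOver forbidden (λ j → 𝟙 (insert j I ⊆ᵇ S))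
      pointwise S with I ⊆ᵇ S in e₁
      ... | false = z≤n
      ... | true with anyF (λ j → forbidden j ∧ S j) in e₂
      ...   | false = m≤m+n 1 _
      ...   | true = let (j , q) = anyF-elim (λ j → forbidden j ∧ S j) e₂ in
        ≤-trans (hit (forbidden j) (proj₁ (∧-split q)) (inside j (proj₂ (∧-split {forbidden j} q))))
          (sumF-member (λ j → if forbidden j then 𝟙 (insert j I ⊆ᵇ S) else 0) j)
        where
        inside : ∀ j → S j ≡ true → (insert j I ⊆ᵇ S) ≡ true
        inside j sj = ⊆ᵇ-intro (insert j I) S λ i q → case insert-elim j I i q of λ
          { (inj₁ refl) → sj ; (inj₂ r) → ⊆ᵇ-elim I S e₁ i r }
        hit : ∀ x {y} → x ≡ true → y ≡ true → 1 ≤ (if x then 𝟙 y else 0)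
        hit true refl refl = ≤-refl
      union : 𝔼 c (λ S → 𝟙 (I ⊆ᵇ S)) ≤ p + sumOver forbidden (λ j → 𝔼 c (λ S → 𝟙 (insert j I ⊆ᵇ S)))
      union = begin
        𝔼 c (λ S → 𝟙 (I ⊆ᵇ S))
          ≤⟨ 𝔼-mono c pointwise ⟩
        𝔼 c (λ S → 𝟙 (isolates S) + sumOver forbidden (λ j → 𝟙 (insert j I ⊆ᵇ S)))
          ≡⟨ 𝔼-+ c (λ S → 𝟙 (isolates S)) (λ S → sumOver forbidden (λ j → 𝟙 (insert j I ⊆ᵇ S))) ⟩
        p + 𝔼 c (λ S → sumOver forbidden (λ j → 𝟙 (insert j I ⊆ᵇ S)))
          ≡⟨ cong (p +_) (𝔼-sumOver c forbidden (λ j S → 𝟙 (insert j I ⊆ᵇ S))) ⟩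
        p + sumOver forbidden (λ j → 𝔼 c (λ S → 𝟙 (insert j I ⊆ᵇ S))) ∎

  neighbourhood≡ : Fin (n G) → VSet G → VSet G → Bool
  neighbourhood≡ a I S = ((λ b → kept S b ∧ Adj G a b) ⊆ᵇ I) ∧ (I ⊆ᵇ (λ b → kept S b ∧ Adj G a b))

  neighbourhood≡⇒deg : ∀ a I S → neighbourhood≡ a I S ≡ true → deg G (kept S) a ≡ countF I
  neighbourhood≡⇒deg a I S e = countF-cong {P = N} {Q = I} λ b → Bool-ext
    (⊆ᵇ-elim N I (proj₁ (∧-split e)) b) (⊆ᵇ-elim I N (proj₂ (∧-split {N ⊆ᵇ I} e)) b)
    where
    N : VSet G
    N b = kept S b ∧ Adj G a b

  𝔼-exact-neighbourhood : ∀ c a (I : VSet G) m → (∀ b → I b ≡ true → B b ∧ Adj G a b ≡ true) → Independent G I →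
    countF I ≡ m → 2 * (deg G B a + m * D) ≤ suc c →
    suc c ^ n G ≤ 2 * (suc c ^ m * 𝔼 c (λ S → 𝟙 (neighbourhood≡ a I S)))
  𝔼-exact-neighbourhood c a I m I⊆ I-indep refl small = ≤-trans
    (isolates-𝔼 c (≤-trans (*-monoʳ-≤ 2 forbidden-size) small))
    (*-monoʳ-≤ 2 (*-monoʳ-≤ (suc c ^ m) (𝔼-mono c (λ S → 𝟙-mono (λ e → ∧-join
      (⊆ᵇ-intro (λ b → kept S b ∧ Adj G a b) I (λ b q → trans (sym (isolates⇒ S e b)) q))
      (⊆ᵇ-intro I (λ b → kept S b ∧ Adj G a b) (λ b q → trans (isolates⇒ S e b) q)))))))
    where open Isolation a I I⊆ I-indep

  𝔼-exact-degree : ∀ c a (I : VSet G) m → (∀ b → I b ≡ true → B b ∧ Adj G a b ≡ true) → Independent G I →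
    countF I ≡ m → 2 * (deg G B a + m * D) ≤ suc c →
    suc c ^ n G ≤ 2 * (suc c ^ m * 𝔼 c (λ S → 𝟙 (deg G (kept S) a ≡ᵇ m)))
  𝔼-exact-degree c a I m I⊆ I-indep size-I small = ≤-trans
    (𝔼-exact-neighbourhood c a I m I⊆ I-indep size-I small)
    (*-monoʳ-≤ 2 (*-monoʳ-≤ (suc c ^ m) (𝔼-mono c (λ S → 𝟙-mono (λ e →
      ≡ᵇ-intro (trans (neighbourhood≡⇒deg a I S e) size-I))))))

-- Lets an argument made for each vertex either stop at once with the desired subgraph or continue
-- with a property of all vertices.
sequence-⊎ : ∀ {n} {P : Set} {Q : Fin n → Set} → (∀ i → P ⊎ Q i) → P ⊎ (∀ i → Q i)
sequence-⊎ {zero}  f = inj₂ λ ()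
sequence-⊎ {suc n} f with f zero | sequence-⊎ (λ i → f (suc i))
... | inj₁ p | _      = inj₁ p
... | inj₂ _ | inj₁ p = inj₁ p
... | inj₂ q | inj₂ r = inj₂ λ { zero → q ; (suc i) → r i }

-- Sampling probabilities have the form `1 / suc c`, and those needed are negative powers of `T`.
pow-suc : ∀ T .{{_ : NonZero T}} r → ∃ λ c → suc c ≡ T ^ r
pow-suc T r with T ^ r | m^n>0 T r
... | suc c | _ = c , refl

turán-power : ∀ {n} T .{{_ : NonZero T}} r (Q : Fin n → Fin n → Bool) → (∀ v → Q v v ≡ false) → ∀ (C : Fin n → Bool) →
  ∃ λ (I : Fin n → Bool) → (∀ u → I u ≡ true → C u ≡ true) ×
    (∀ u v → I u ≡ true → I v ≡ true → Q u v ≡ false) ×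
    T ^ r * countF C ≤ T ^ r * T ^ r * countF I + conflicts Q C
turán-power T r Q irr C with pow-suc T r
... | c , e with turán Q irr C c
...   | I , I⊆C , indep , bound =
  I , I⊆C , indep , subst (λ x → x * countF C ≤ x * x * countF I + conflicts Q C) e bound

-- The paper's d is T^(5+R) up to a factor T, while s and the degree m are below T.  The exponent c is such that
-- the dense pair argument applies to sets of size T^c and density T^-a.
record Setting (G : Graph) (k : ℕ) : Set where
  field
    s T R a c : ℕ
    system       : LinearSystem k
    2≤k          : 2 ≤ k
    5≤T          : 5 ≤ T
    s<T          : s < T
    noK          : ¬ HasKss G s
    lines<T      : LinearSystem.lines system < T
    incidences≤T : LinearSystem.lines system * LinearSystem.points system ≤ T
    mad          : ∀ (Y : VSet G) → sumOver Y (deg G Y) ≤ T ^ (5 + R) * countF Y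
    denseX       : denseExponent (LinearSystem.points system) a + (2 * LinearSystem.points system + 3) ≤ c
    denseY       : denseExponent (LinearSystem.points system) a +
                   (LinearSystem.points system + suc (suc (LinearSystem.lines system))) ≤ c

  instance
    T≢0 : NonZero T
    T≢0 = >-nonZero (≤-trans (s≤s z≤n) s<T)

  2≤T : 2 ≤ T
  2≤T = ≤-trans (s≤s (s≤s z≤n)) 5≤T

  orientation : Orientation G (T ^ (5 + R))
  orientation = degenerate⇒orientation G (T ^ (5 + R)) mad

  dense⇒C4Free : ∀ (X Y : VSet G) → countF X * countF Y ≤ T ^ a * sumOver Y (deg G X) →
    T ^ c ≤ countF X → T ^ c ≤ countF Y → C4FreeSubgraph G k
  dense⇒C4Free X Y d x y = DensePair.dense-pair G s T k 2≤k system (≤-trans (s≤s (s≤s (s≤s z≤n))) 5≤T)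
    s<T noK lines<T incidences≤T a X Y d (≤-trans (^-monoʳ-≤ T denseX) x) (≤-trans (^-monoʳ-≤ T denseY) y)

-- The unbalanced outcome

UnbalancedPair : Graph → ℕ → ℕ → Set
UnbalancedPair G T m = Σ (VSet G) λ A → Σ (VSet G) λ B → (∀ v → A v ≡ true → B v ≡ false) ×
  Independent G A × Independent G B × 1 ≤ countF A × 2 ^ T * countF B ≤ countF A ×
  (∀ v → A v ≡ true → deg G B v ≡ m)

module Unbalanced {G : Graph} {k : ℕ} (σ : Setting G k) where

  open Setting σ

  -- Thinning `U` at rate `T ^ -r` leaves an independent set. If it has fewer than `m < T` elements,
  -- then `U` spans about `T ^ r * |U| / T` edges; since `|U| ≤ T ^ (8 + r)`, the pair of `U` with
  -- itself has density at least `T ^ -9` and is dense.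
  independent-subset : ∀ m r (U : VSet G) → m < T → 9 ≤ a → c ≤ 2 + r →
    T ^ (2 + r) ≤ countF U → countF U ≤ T ^ (8 + r) →
    C4FreeSubgraph G k ⊎ ∃ λ (I : VSet G) → (∀ b → I b ≡ true → U b ≡ true) × Independent G I × countF I ≡ m
  independent-subset m r U m<T 9≤a c≤ lower upper with turán-power T r (Adj G) (irrefl G) U
  ... | I , I⊆U , I-indep , bound with m ≤? countF I
  ...   | yes m≤I = let (f , f-inj , f-in) = ≤countF⇒injection I m m≤I in inj₂
    (image f , (λ b e → let (i , q) = image-elim f b e in subst (λ x → U x ≡ true) q (I⊆U (f i) (f-in i)))
    , (λ u v eu ev → let (i , p) = image-elim f u eu ; (j , q) = image-elim f v ev in
         subst₂ (λ x y → Adj G x y ≡ false) p q (I-indep (f i) (f j) (f-in i) (f-in j)))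
    , countF-image f f-inj)
  ...   | no m≰I = inj₁ (dense⇒C4Free U U dense (≤-trans (^-monoʳ-≤ T c≤) lower) (≤-trans (^-monoʳ-≤ T c≤) lower))
    where
    open ≤-Reasoning
    u i e L : ℕ
    u = countF U
    i = countF I
    e = sumOver U (deg G U)
    L = T ^ r
    Lu≤Te : L * u ≤ T * e
    Lu≤Te = absorb 2≤T (begin
      T * (L * u) ≤⟨ *-monoʳ-≤ T bound ⟩
      T * (L * L * i + e) ≡⟨ r₁ T L i e ⟩
      L * (T * L * i) + T * e ≤⟨ +-monoˡ-≤ (T * e) (*-monoʳ-≤ L (*-monoʳ-≤ (T * L) (<⇒≤ (<-trans (≰⇒> m≰I) m<T)))) ⟩
      L * (T * L * T) + T * e ≡⟨ cong (λ x → L * x + T * e) (r₂ T L) ⟩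
      L * (T ^ (2 + r)) + T * e ≤⟨ +-monoˡ-≤ (T * e) (*-monoʳ-≤ L lower) ⟩
      L * u + T * e ∎)
      where
      r₁ : ∀ T L i e → T * (L * L * i + e) ≡ L * (T * L * i) + T * e
      r₁ = solve-∀
      r₂ : ∀ T L → T * L * T ≡ T * (T * L)
      r₂ = solve-∀
    dense : u * u ≤ T ^ a * e
    dense = begin
      u * u ≤⟨ *-monoˡ-≤ u upper ⟩
      T ^ (8 + r) * u ≡⟨ cong (_* u) (^-distribˡ-+-* T 8 r) ⟩
      T ^ 8 * L * u ≡⟨ *-assoc (T ^ 8) L u ⟩
      T ^ 8 * (L * u) ≤⟨ *-monoʳ-≤ (T ^ 8) Lu≤Te ⟩
      T ^ 8 * (T * e) ≡⟨ trans (sym (*-assoc (T ^ 8) T e)) (cong (_* e) (*-comm (T ^ 8) T)) ⟩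
      T ^ 9 * e ≤⟨ *-monoˡ-≤ e (^-monoʳ-≤ T 9≤a) ⟩
      T ^ a * e ∎

  -- Twice the number of forbidden vertices for a set of size `m`: this fixes the sampling rate
  -- `T ^ -(8 + R)`.
  sample-bound : ∀ m d → m ≤ T → d ≤ T ^ (6 + R) → 2 * (d + m * T ^ (5 + R)) ≤ T ^ (8 + R)
  sample-bound m d m≤T d≤ = begin
    2 * (d + m * T ^ (5 + R)) ≤⟨ *-monoʳ-≤ 2 (+-mono-≤ d≤ (*-monoˡ-≤ (T ^ (5 + R)) m≤T)) ⟩
    2 * (T ^ (6 + R) + T ^ (6 + R)) ≡⟨ r (T ^ (6 + R)) ⟩
    2 * (2 * T ^ (6 + R)) ≤⟨ *-mono-≤ 2≤T (*-monoˡ-≤ (T ^ (6 + R)) 2≤T) ⟩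
    T ^ (8 + R) ∎
    where
    open ≤-Reasoning
    r : ∀ x → 2 * (x + x) ≡ 2 * (2 * x)
    r = solve-∀

  Unbalancing : Set
  Unbalancing = ∀ m → 1 ≤ m → m < T → (A B : VSet G) → 1 ≤ countF A →
    (∀ v → A v ≡ true → deg G B v ≤ T ^ (6 + R)) →
    (∀ v → A v ≡ true → ∃ λ (I : VSet G) →
      (∀ b → I b ≡ true → B b ∧ Adj G v b ≡ true) × Independent G I × countF I ≡ m) →
    T ^ (8 + R + (9 + R) * T) * countF B ≤ countF A → UnbalancedPair G T m

  unbalanced-sampling : ∀ c₁ → suc c₁ ≡ T ^ (8 + R) → Unbalancing
  unbalanced-sampling c₁ M≡ m 1≤m m<T A B 1≤A upper indep-nbrs ratio = result
    where
    open ≤-Reasoning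
    open Sampling G (T ^ (5 + R)) orientation B
    M w K : ℕ
    M = suc c₁
    w = M ^ n G
    -- The factor `T ^ (7 + R)` will be lost in passing from the candidates to an independent set of
    -- them; `2 ^ T` is the ratio to be reached.
    K = T ^ (7 + R) * 2 ^ T
    C : VSet G → VSet G
    C S v = A v ∧ (deg G (kept S) v ≡ᵇ m)
    p : Fin (n G) → ℕ
    p v = 𝔼 c₁ (λ S → 𝟙 (deg G (kept S) v ≡ᵇ m))
    E-C : 𝔼 c₁ (λ S → countF (C S)) ≡ sumOver A p
    E-C = trans (𝔼-cong c₁ (λ S → sumOver-∧ A (λ v → deg G (kept S) v ≡ᵇ m) (λ _ → 1)))
                (𝔼-sumOver c₁ A (λ v S → 𝟙 (deg G (kept S) v ≡ᵇ m)))
    E-B : M * 𝔼 c₁ (λ S → countF (λ v → B v ∧ S v)) ≡ countF B * w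
    E-B = trans (cong (M *_) (𝔼-cong c₁ (λ S → sumOver-∧ B S (λ _ → 1)))) (𝔼-members c₁ B)
    many : countF A * w ≤ 2 * (M ^ m * 𝔼 c₁ (λ S → countF (C S)))
    many = begin
      countF A * w
        ≤⟨ sumOver-≥const A w (λ v av → let (I , I⊆ , I-indep , size-I) = indep-nbrs v av in
             𝔼-exact-degree c₁ v I m I⊆ I-indep size-I
               (≤-trans (sample-bound m (deg G B v) (<⇒≤ m<T) (upper v av)) (≤-reflexive (sym M≡)))) ⟩
      sumOver A (λ v → 2 * (M ^ m * p v))
        ≡⟨ trans (sumOver-*ˡ A 2 (λ v → M ^ m * p v)) (cong (2 *_) (sumOver-*ˡ A (M ^ m) p)) ⟩
      2 * (M ^ m * sumOver A p)
        ≡⟨ cong (λ x → 2 * (M ^ m * x)) (sym E-C) ⟩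
      2 * (M ^ m * 𝔼 c₁ (λ S → countF (C S))) ∎
    -- The exponent collects 1 for the factor 2, `(8 + R) * T` for `M ^ m`, `7 + R` from `K` and `T`
    -- for `2 ^ T ≤ T ^ T`.
    cost : 2 * (M ^ m * K) ≤ T ^ (8 + R + (9 + R) * T)
    cost = begin
      2 * (M ^ m * (T ^ (7 + R) * 2 ^ T))
        ≤⟨ *-mono-≤ 2≤T (*-mono-≤ M^m (*-monoʳ-≤ (T ^ (7 + R)) (^-monoˡ-≤ T 2≤T))) ⟩
      T * (T ^ ((8 + R) * T) * (T ^ (7 + R) * T ^ T))
        ≡⟨ cong (λ x → T * (T ^ ((8 + R) * T) * x)) (sym (^-distribˡ-+-* T (7 + R) T)) ⟩
      T * (T ^ ((8 + R) * T) * T ^ (7 + R + T))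
        ≡⟨ cong (T *_) (sym (^-distribˡ-+-* T ((8 + R) * T) (7 + R + T))) ⟩
      T ^ (1 + ((8 + R) * T + (7 + R + T)))
        ≡⟨ cong (T ^_) (r R T) ⟩
      T ^ (8 + R + (9 + R) * T) ∎
      where
      r : ∀ R T → 1 + ((8 + R) * T + (7 + R + T)) ≡ 8 + R + (9 + R) * T
      r = solve-∀
      M^m : M ^ m ≤ T ^ ((8 + R) * T)
      M^m = ≤-trans (≤-reflexive (cong (_^ m) M≡)) (≤-trans (≤-reflexive (^-*-assoc T (8 + R) m))
        (^-monoʳ-≤ T (*-monoʳ-≤ (8 + R) (<⇒≤ m<T))))
    2≤M : 2 ≤ M
    2≤M = ≤-trans 2≤T (≤-trans (m≤m*n T (T ^ (7 + R)) {{m^n≢0 T (7 + R)}}) (≤-reflexive (sym M≡)))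
    expectation : 𝔼 c₁ (λ S → K * countF (λ v → B v ∧ S v)) < 𝔼 c₁ (λ S → countF (C S))
    expectation = *-cancelˡ-< (M * (2 * M ^ m)) _ _ (begin-strict
      M * (2 * M ^ m) * 𝔼 c₁ (λ S → K * countF (λ v → B v ∧ S v))
        ≡⟨ cong (M * (2 * M ^ m) *_) (𝔼-*ˡ c₁ K (λ S → countF (λ v → B v ∧ S v))) ⟩
      M * (2 * M ^ m) * (K * 𝔼 c₁ (λ S → countF (λ v → B v ∧ S v)))
        ≡⟨ r₁ M (M ^ m) K (𝔼 c₁ (λ S → countF (λ v → B v ∧ S v))) ⟩
      2 * (M ^ m * K) * (M * 𝔼 c₁ (λ S → countF (λ v → B v ∧ S v)))
        ≡⟨ cong (2 * (M ^ m * K) *_) E-B ⟩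
      2 * (M ^ m * K) * (countF B * w)
        ≡⟨ sym (*-assoc (2 * (M ^ m * K)) (countF B) w) ⟩
      2 * (M ^ m * K) * countF B * w
        ≤⟨ *-monoˡ-≤ w (≤-trans (*-monoˡ-≤ (countF B) cost) ratio) ⟩
      countF A * w
        ≡⟨ sym (*-identityˡ (countF A * w)) ⟩
      1 * (countF A * w)
        <⟨ *-monoˡ-< (countF A * w) {{m*n≢0 (countF A) w {{>-nonZero 1≤A}} {{m^n≢0 M (n G)}}}} 2≤M ⟩
      M * (countF A * w)
        ≤⟨ *-monoʳ-≤ M many ⟩
      M * (2 * (M ^ m * 𝔼 c₁ (λ S → countF (C S))))
        ≡⟨ r₂ M (M ^ m) (𝔼 c₁ (λ S → countF (C S))) ⟩
      M * (2 * M ^ m) * 𝔼 c₁ (λ S → countF (C S)) ∎)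
      where
      r₁ : ∀ M p K x → M * (2 * p) * (K * x) ≡ 2 * (p * K) * (M * x)
      r₁ = solve-∀
      r₂ : ∀ M p x → M * (2 * (p * x)) ≡ M * (2 * p) * x
      r₂ = solve-∀
    finish : ∀ S → K * countF (λ v → B v ∧ S v) < countF (C S) →
      (∃ λ (I : VSet G) → (∀ u → I u ≡ true → C S u ≡ true) × Independent G I ×
        T ^ (6 + R) * countF (C S) ≤ T ^ (6 + R) * T ^ (6 + R) * countF I + sumOver (C S) (deg G (C S))) →
      UnbalancedPair G T m
    finish S big (I , I⊆C , I-indep , bound) =
      I , kept S , disjoint , I-indep , kept-independent S , ≤-trans (s≤s z≤n) lt , size-bound , exact
      where
      L x : ℕ
      L = T ^ (6 + R)
      x = countF (C S)
      -- The average degree inside the candidates is at most `T ^ (5 + R)`, a `T`-th of `L`, so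
      -- thinning at rate `1 / L` loses little to internal edges.
      x≤ : L * x ≤ L * (T * L * countF I)
      x≤ = absorb 2≤T (begin
        T * (L * x) ≤⟨ *-monoʳ-≤ T bound ⟩
        T * (L * L * countF I + sumOver (C S) (deg G (C S))) ≤⟨ *-monoʳ-≤ T (+-monoʳ-≤ (L * L * countF I) (mad (C S))) ⟩
        T * (L * L * countF I + T ^ (5 + R) * x) ≡⟨ r T L (countF I) (T ^ (5 + R)) x ⟩
        L * x + L * (T * L * countF I) ∎)
        where
        r : ∀ T L i D x → T * (L * L * i + D * x) ≡ T * D * x + L * (T * L * i)
        r = solve-∀
      lt : 2 ^ T * countF (λ v → B v ∧ S v) < countF I
      lt = *-cancelˡ-< (T ^ (7 + R)) _ _ (begin-strict
        T ^ (7 + R) * (2 ^ T * countF (λ v → B v ∧ S v)) ≡⟨ sym (*-assoc (T ^ (7 + R)) (2 ^ T) _) ⟩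
        K * countF (λ v → B v ∧ S v) <⟨ big ⟩
        x ≤⟨ *-cancelˡ-≤ L {{m^n≢0 T (6 + R)}} x≤ ⟩
        T ^ (7 + R) * countF I ∎)
      size-bound : 2 ^ T * countF (kept S) ≤ countF I
      size-bound = ≤-trans (*-monoʳ-≤ (2 ^ T) (countF-mono {P = kept S} {Q = λ v → B v ∧ S v} (λ v e → proj₁ (∧-split e)))) (<⇒≤ lt)
      exact : ∀ v → I v ≡ true → deg G (kept S) v ≡ m
      exact v iv = ≡ᵇ-elim (proj₂ (∧-split {A v} (I⊆C v iv)))
      disjoint : ∀ v → I v ≡ true → kept S v ≡ false
      disjoint v iv = ≢true⇒≡false λ kv →
        let (b , q) = 1≤countF⇒∃ (λ b → kept S b ∧ Adj G v b) (subst (1 ≤_) (sym (exact v iv)) 1≤m) in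
        true≢false (proj₂ (∧-split {kept S b} q)) (kept-independent S v b kv (proj₁ (∧-split q)))
    result : UnbalancedPair G T m
    result =
      let (S , big) = 𝔼-<⇒∃< c₁ (λ S → K * countF (λ v → B v ∧ S v)) (λ S → countF (C S)) expectation
      in finish S big (turán-power T (6 + R) (Adj G) (irrefl G) (C S))

  unbalanced : Unbalancing
  unbalanced = unbalanced-sampling (proj₁ (pow-suc T (8 + R))) (proj₂ (pow-suc T (8 + R)))

-- Conflicts between candidates

module Conflicts (G : Graph) (D : ℕ) (𝒪 : Orientation G D) (A B : VSet G) (k : ℕ) where

  open Sampling G D 𝒪 B

  private
    V : Set
    V = Fin (n G)

  candidates : VSet G → VSet G
  candidates S v = A v ∧ (deg G (kept S) v ≡ᵇ k)

  twoCommon : VSet G → V → V → V → V → Bool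
  twoCommon S u v b b′ =
    not (b == b′) ∧ ((kept S b ∧ (Adj G u b ∧ Adj G v b)) ∧ (kept S b′ ∧ (Adj G u b′ ∧ Adj G v b′)))

  conflict : VSet G → V → V → Bool
  conflict S u v = not (u == v) ∧ (Adj G u v ∨ anyF (λ b → anyF (twoCommon S u v b)))

  conflict-irrefl : ∀ S v → conflict S v v ≡ false
  conflict-irrefl S v rewrite ==-refl v = refl

  nbrs : VSet G → V → VSet G
  nbrs X u v = X v ∧ Adj G u v

  common : V → V → VSet G
  common u v = nbrs (nbrs B u) v

  exclusive : V → V → VSet G
  exclusive u v b = (B b ∧ Adj G u b) ∧ not (Adj G v b)

  -- These dominate the three kinds of conflicts: adjacent candidates without a common sampled neighbour,
  -- adjacent candidates with one, and candidates with two common sampled neighbours.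
  separate overlaps sharing : V → V → VSet G → ℕ
  separate u v S = 𝟙 (k ≤ᵇ countF-∩ (exclusive u v) S) * 𝟙 (k ≤ᵇ countF-∩ (exclusive v u) S)
  overlaps u v S  = sumOver (common u v) (λ b → 𝟙 (S b))
  sharing u v S  = sumOver (common u v) (λ b → sumOver (common u v ∖ b) (λ b′ → 𝟙 (S b ∧ S b′)))

  losses₁ losses₂ losses₃ : VSet G → ℕ
  losses₁ S = sumOver A (λ u → sumOver (nbrs A u) (λ v → separate u v S))
  losses₂ S = sumOver A (λ u → sumOver (nbrs A u) (λ v → overlaps u v S))
  losses₃ S = sumOver A (λ u → sumOver A (λ v → sharing u v S))

  private
    if-hit : ∀ {b x} → b ≡ true → 1 ≤ x → 1 ≤ (if b then x else 0)
    if-hit refl h = h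

    sumOver-hit : ∀ (X : VSet G) (f : V → ℕ) v → X v ≡ true → 1 ≤ f v → 1 ≤ sumOver X f
    sumOver-hit X f v e h = ≤-trans (if-hit e h) (sumF-member (λ v → if X v then f v else 0) v)

  -- Without a common sampled neighbour, the `k` kept neighbours of each candidate lie among its
  -- exclusive neighbours.
  adjacent-loss : ∀ S u v → candidates S u ≡ true → candidates S v ≡ true →
    1 ≤ separate u v S + overlaps u v S
  adjacent-loss S u v cu cv with anyF (λ b → common u v b ∧ S b) in e
  ... | true  = let (b , q) = anyF-elim (λ b → common u v b ∧ S b) e in
    ≤-trans (sumOver-hit (common u v) (λ b → 𝟙 (S b)) b (proj₁ (∧-split q)) (𝟙-true (proj₂ (∧-split {common u v b} q))))
      (m≤n+m _ (separate u v S))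
  ... | false = ≤-trans (*-mono-≤ (𝟙-true (≤ᵇ-intro (many u v cu disjoint)))
                                  (𝟙-true (≤ᵇ-intro (many v u cv λ b bb p q → disjoint b bb q p)))) (m≤m+n _ (overlaps u v S))
    where
    disjoint : ∀ b → kept S b ≡ true → Adj G u b ≡ true → Adj G v b ≡ true → ⊥
    disjoint b kb p q = true≢false (∧-join (∧-join (∧-join (kept⇒B S b kb) p) q) (kept⇒S S b kb))
      (anyF-false (λ b → common u v b ∧ S b) e b)
    many : ∀ u v → candidates S u ≡ true →
      (∀ b → kept S b ≡ true → Adj G u b ≡ true → Adj G v b ≡ true → ⊥) → k ≤ countF-∩ (exclusive u v) S
    many u v cu d = ≤-trans (≤-reflexive (sym (≡ᵇ-elim (proj₂ (∧-split {A u} cu)))))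
      (countF-mono {P = λ b → kept S b ∧ Adj G u b} {Q = λ b → exclusive u v b ∧ S b} λ b q →
        let kb = proj₁ (∧-split q) ; ub = proj₂ (∧-split {kept S b} q) in
        ∧-join (∧-join (∧-join (kept⇒B S b kb) ub) (not-true (≢true⇒≡false (d b kb ub)))) (kept⇒S S b kb))

  sharing-loss : ∀ S u v → anyF (λ b → anyF (twoCommon S u v b)) ≡ true → 1 ≤ sharing u v S
  sharing-loss S u v e with anyF-elim (λ b → anyF (twoCommon S u v b)) e
  ... | b , e₁ with anyF-elim (twoCommon S u v b) e₁
  ...   | b′ , e₂ = sumOver-hit (common u v) (λ b → sumOver (common u v ∖ b) (λ b′ → 𝟙 (S b ∧ S b′))) b (in-common b kb ab)
      (sumOver-hit (common u v ∖ b) (λ b′ → 𝟙 (S b ∧ S b′)) b′ (∧-join (in-common b′ kb′ ab′) (proj₁ (∧-split e₂)))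
        (𝟙-true (∧-join (kept⇒S S b kb) (kept⇒S S b′ kb′))))
    where
    both = proj₂ (∧-split {not (b == b′)} e₂)
    at-b = proj₁ (∧-split {kept S b ∧ (Adj G u b ∧ Adj G v b)} both)
    at-b′ = proj₂ (∧-split {kept S b ∧ (Adj G u b ∧ Adj G v b)} both)
    kb : kept S b ≡ true
    kb = proj₁ (∧-split at-b)
    kb′ : kept S b′ ≡ true
    kb′ = proj₁ (∧-split at-b′)
    ab : Adj G u b ∧ Adj G v b ≡ true
    ab = proj₂ (∧-split {kept S b} at-b)
    ab′ : Adj G u b′ ∧ Adj G v b′ ≡ true
    ab′ = proj₂ (∧-split {kept S b′} at-b′)
    in-common : ∀ b → kept S b ≡ true → Adj G u b ∧ Adj G v b ≡ true → common u v b ≡ true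
    in-common b kb q = ∧-join (∧-join (kept⇒B S b kb) (proj₁ (∧-split q))) (proj₂ (∧-split {Adj G u b} q))

  conflicts≤losses : ∀ S → conflicts (conflict S) (candidates S) ≤ losses₁ S + losses₂ S + losses₃ S
  conflicts≤losses S = begin
    sumOver (candidates S) (λ u → countF (λ v → candidates S v ∧ conflict S u v))
      ≤⟨ sumOver-mono (candidates S) per-u ⟩
    sumOver (candidates S) total
      ≤⟨ sumOver-monoˢ total (λ u e → proj₁ (∧-split e)) ⟩
    sumOver A total
      ≡⟨ trans (sumOver-+ A (λ u → t₁ u + t₂ u) t₃) (cong (_+ sumOver A t₃) (sumOver-+ A t₁ t₂)) ⟩
    losses₁ S + losses₂ S + losses₃ S ∎
    where
    open ≤-Reasoning
    t₁ t₂ t₃ total : V → ℕ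
    t₁ u = sumOver (nbrs A u) (λ v → separate u v S)
    t₂ u = sumOver (nbrs A u) (λ v → overlaps u v S)
    t₃ u = sumOver A (λ v → sharing u v S)
    total u = t₁ u + t₂ u + t₃ u
    per-uv : ∀ u v → candidates S u ≡ true → 𝟙 (candidates S v ∧ conflict S u v) ≤
      (if nbrs A u v then separate u v S else 0) + (if nbrs A u v then overlaps u v S else 0) + (if A v then sharing u v S else 0)
    per-uv u v cu = 𝟙≤ (candidates S v ∧ conflict S u v) λ e →
      let cv = proj₁ (∧-split {candidates S v} e) ; av = proj₁ (∧-split {A v} cv) in
      case ∨-elim (proj₂ (∧-split {not (u == v)} (proj₂ (∧-split {candidates S v} e)))) of λ
        { (inj₁ adj) → ≤-trans (if-split (∧-join av adj) (adjacent-loss S u v cu cv)) (m≤m+n _ _)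
        ; (inj₂ two) → ≤-trans (if-hit av (sharing-loss S u v two)) (m≤n+m _ _) }
      where
      if-split : ∀ {b x y} → b ≡ true → 1 ≤ x + y → 1 ≤ (if b then x else 0) + (if b then y else 0)
      if-split refl h = h
    per-u : ∀ u → candidates S u ≡ true → countF (λ v → candidates S v ∧ conflict S u v) ≤ total u
    per-u u cu = begin
      countF (λ v → candidates S v ∧ conflict S u v)
        ≤⟨ sumF-mono (λ v → per-uv u v cu) ⟩
      sumF (λ v → (if nbrs A u v then separate u v S else 0) + (if nbrs A u v then overlaps u v S else 0) + (if A v then sharing u v S else 0))
        ≡⟨ trans (sumF-+ (λ v → (if nbrs A u v then separate u v S else 0) + (if nbrs A u v then overlaps u v S else 0)) (λ v → if A v then sharing u v S else 0))
             (cong (_+ t₃ u) (sumF-+ (λ v → if nbrs A u v then separate u v S else 0) (λ v → if nbrs A u v then overlaps u v S else 0))) ⟩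
      total u ∎

  -- The exclusive neighbourhoods are disjoint, so both events together have probability at most
  -- `(d / (1 + c)) ^ (2 * k)`. Obtaining the full exponent `2 * k` is the reason for treating
  -- overlaps separately.
  losses₁-𝔼 : ∀ c d → (∀ u → A u ≡ true → deg G B u ≤ d) →
    suc c ^ k * suc c ^ k * 𝔼 c losses₁ ≤ sumOver A (deg G A) * (d ^ k * (d ^ k * suc c ^ n G))
  losses₁-𝔼 c d upper = begin
    MM * 𝔼 c losses₁
      ≡⟨ trans (𝔼-*-sumOver c MM A (λ u S → sumOver (nbrs A u) (λ v → separate u v S)))
           (sumOver-cong A (λ u → 𝔼-*-sumOver c MM (nbrs A u) (separate u))) ⟩
    sumOver A (λ u → sumOver (nbrs A u) (λ v → MM * 𝔼 c (separate u v)))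
      ≤⟨ sumOver-mono A (λ u au → sumOver-≤const (nbrs A u) bound (λ v e → per-uv u v au (proj₁ (∧-split e)))) ⟩
    sumOver A (λ u → deg G A u * bound)
      ≡⟨ trans (sumOver-cong A (λ u → *-comm (deg G A u) bound))
           (trans (sumOver-*ˡ A bound (deg G A)) (*-comm bound _)) ⟩
    sumOver A (deg G A) * bound ∎
    where
    open ≤-Reasoning
    MM bound : ℕ
    MM = suc c ^ k * suc c ^ k
    bound = d ^ k * (d ^ k * suc c ^ n G)
    private-size : ∀ u v → A u ≡ true → countF (exclusive u v) ≤ d
    private-size u v au = ≤-trans (countF-mono {P = exclusive u v} {Q = nbrs B u} (λ b e → proj₁ (∧-split e))) (upper u au)
    per-uv : ∀ u v → A u ≡ true → A v ≡ true → MM * 𝔼 c (separate u v) ≤ bound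
    per-uv u v au av = begin
      MM * 𝔼 c (separate u v)
        ≡⟨ *-comm MM _ ⟩
      𝔼 c (separate u v) * MM
        ≤⟨ 𝔼-tails c k k (exclusive u v) (exclusive v u) (λ b e →
             ≢true⇒≡false λ q → true≢false (proj₂ (∧-split {B b} (proj₁ (∧-split {B b ∧ Adj G v b} q))))
               (not-true⁻¹ (proj₂ (∧-split {B b ∧ Adj G u b} e)))) ⟩
      countF (exclusive u v) ^ k * (countF (exclusive v u) ^ k * suc c ^ n G)
        ≤⟨ *-mono-≤ (^-monoˡ-≤ k (private-size u v au)) (*-monoˡ-≤ (suc c ^ n G) (^-monoˡ-≤ k (private-size v u av))) ⟩
      bound ∎

  losses₂-𝔼 : ∀ c → suc c * 𝔼 c losses₂ ≡ sumOver A (λ u → sumOver (nbrs A u) (deg G (nbrs B u))) * suc c ^ n G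
  losses₂-𝔼 c = begin
    suc c * 𝔼 c losses₂
      ≡⟨ trans (𝔼-*-sumOver c (suc c) A (λ u S → sumOver (nbrs A u) (λ v → overlaps u v S)))
           (sumOver-cong A (λ u → 𝔼-*-sumOver c (suc c) (nbrs A u) (overlaps u))) ⟩
    sumOver A (λ u → sumOver (nbrs A u) (λ v → suc c * 𝔼 c (overlaps u v)))
      ≡⟨ sumOver-cong A (λ u → trans
           (sumOver-cong (nbrs A u) (λ v → trans (𝔼-members c (common u v)) (*-comm (deg G (nbrs B u) v) w)))
           (sumOver-*ˡ (nbrs A u) w (deg G (nbrs B u)))) ⟩
    sumOver A (λ u → w * sumOver (nbrs A u) (deg G (nbrs B u)))
      ≡⟨ trans (sumOver-*ˡ A w (λ u → sumOver (nbrs A u) (deg G (nbrs B u)))) (*-comm w _) ⟩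
    sumOver A (λ u → sumOver (nbrs A u) (deg G (nbrs B u))) * w ∎
    where
    open ≡-Reasoning
    w : ℕ
    w = suc c ^ n G

  -- Two distinct common neighbours are both sampled with probability `(1 + c) ^ -2`, and there are
  -- at most codegree squared ordered choices of them.
  losses₃-𝔼 : ∀ c → suc c * suc c * 𝔼 c losses₃ ≤
    sumOver A (λ u → sumOver A (λ v → deg G (nbrs B u) v * deg G (nbrs B u) v)) * suc c ^ n G
  losses₃-𝔼 c = begin
    MM * 𝔼 c losses₃
      ≡⟨ trans (𝔼-*-sumOver c MM A (λ u S → sumOver A (λ v → sharing u v S)))
           (sumOver-cong A (λ u → 𝔼-*-sumOver c MM A (sharing u))) ⟩
    sumOver A (λ u → sumOver A (λ v → MM * 𝔼 c (sharing u v)))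
      ≤⟨ sumOver-mono A (λ u _ → sumOver-mono A (λ v _ → per-uv u v)) ⟩
    sumOver A (λ u → sumOver A (λ v → w * (t u v * t u v)))
      ≡⟨ sumOver-cong A (λ u → sumOver-*ˡ A w (λ v → t u v * t u v)) ⟩
    sumOver A (λ u → w * sumOver A (λ v → t u v * t u v))
      ≡⟨ trans (sumOver-*ˡ A w (λ u → sumOver A (λ v → t u v * t u v))) (*-comm w _) ⟩
    sumOver A (λ u → sumOver A (λ v → t u v * t u v)) * w ∎
    where
    open ≤-Reasoning
    MM w : ℕ
    MM = suc c * suc c
    w  = suc c ^ n G
    t : V → V → ℕ
    t u v = deg G (nbrs B u) v
    inner : ∀ u v b → MM * 𝔼 c (λ S → sumOver (common u v ∖ b) (λ b′ → 𝟙 (S b ∧ S b′))) ≤ t u v * w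
    inner u v b = begin
      MM * 𝔼 c (λ S → sumOver (common u v ∖ b) (λ b′ → 𝟙 (S b ∧ S b′)))
        ≡⟨ 𝔼-*-sumOver c MM (common u v ∖ b) (λ b′ S → 𝟙 (S b ∧ S b′)) ⟩
      sumOver (common u v ∖ b) (λ b′ → MM * 𝔼 {n G} c (λ S → 𝟙 (S b ∧ S b′)))
        ≤⟨ sumOver-≤const (common u v ∖ b) w (λ b′ e → ≤-reflexive (trans (*-comm MM _)
             (𝔼-pair c b b′ (==false⇒≢ (not-true⁻¹ (proj₂ (∧-split {common u v b′} e))))))) ⟩
      countF (common u v ∖ b) * w
        ≤⟨ *-monoˡ-≤ w (countF-mono {P = common u v ∖ b} {Q = common u v} (λ b′ e → proj₁ (∧-split e))) ⟩
      t u v * w ∎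
    per-uv : ∀ u v → MM * 𝔼 c (sharing u v) ≤ w * (t u v * t u v)
    per-uv u v = begin
      MM * 𝔼 c (sharing u v)
        ≡⟨ 𝔼-*-sumOver c MM (common u v) (λ b S → sumOver (common u v ∖ b) (λ b′ → 𝟙 (S b ∧ S b′))) ⟩
      sumOver (common u v) (λ b → MM * 𝔼 {n G} c (λ S → sumOver (common u v ∖ b) (λ b′ → 𝟙 (S b ∧ S b′))))
        ≤⟨ sumOver-≤const (common u v) (t u v * w) (λ b _ → inner u v b) ⟩
      t u v * (t u v * w)
        ≡⟨ r (t u v) w ⟩
      w * (t u v * t u v) ∎
      where
      r : ∀ t w → t * (t * w) ≡ w * (t * t)
      r = solve-∀

-- Ordered k-tuples of independent neighbours are counted; the set of entries of such a tuple is the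
-- neighbourhood of a in the kept set for at most kᵏ of them.
𝔼-candidate : ∀ G D 𝒪 (B : VSet G) (let open Sampling G D 𝒪 B) k c a → 2 * (deg G B a + k * D) ≤ suc c →
  sumT k (λ w → 𝟙 (independentTuple G (λ b → B b ∧ Adj G a b) w)) * suc c ^ n G
    ≤ 2 * (suc c ^ k * (k ^ k * 𝔼 c (λ S → 𝟙 (deg G (kept S) a ≡ᵇ k))))
𝔼-candidate G D 𝒪 B k c a small = begin
  sumT k good * w
    ≡⟨ trans (*-comm (sumT k good) w) (sym (sumT-*ˡ k w good)) ⟩
  sumT k (λ t → w * good t)
    ≤⟨ sumT-mono k (λ t → per-tuple t (independentTuple G U t) refl) ⟩
  sumT k (λ t → 2 * (M^k * 𝔼 c (λ S → good t * hit t S)))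
    ≡⟨ trans (sumT-*ˡ k 2 (λ t → M^k * 𝔼 c (λ S → good t * hit t S)))
         (cong (2 *_) (sumT-*ˡ k M^k (λ t → 𝔼 c (λ S → good t * hit t S)))) ⟩
  2 * (M^k * sumT k (λ t → 𝔼 c (λ S → good t * hit t S)))
    ≡⟨ cong (λ x → 2 * (M^k * x)) (sym (𝔼-sumT c k (λ t S → good t * hit t S))) ⟩
  2 * (M^k * 𝔼 c (λ S → sumT k (λ t → good t * hit t S)))
    ≤⟨ *-monoʳ-≤ 2 (*-monoʳ-≤ M^k (𝔼-mono c (λ S → pointwise S))) ⟩
  2 * (M^k * 𝔼 c (λ S → k ^ k * 𝟙 (deg G (kept S) a ≡ᵇ k)))
    ≡⟨ cong (λ x → 2 * (M^k * x)) (𝔼-*ˡ c (k ^ k) (λ S → 𝟙 (deg G (kept S) a ≡ᵇ k))) ⟩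
  2 * (M^k * (k ^ k * 𝔼 c (λ S → 𝟙 (deg G (kept S) a ≡ᵇ k)))) ∎
  where
  open ≤-Reasoning
  open Sampling G D 𝒪 B
  V : Set
  V = Fin (n G)
  U : VSet G
  U b = B b ∧ Adj G a b
  w M^k : ℕ
  w = suc c ^ n G
  M^k = suc c ^ k
  good : Vec V k → ℕ
  good t = 𝟙 (independentTuple G U t)
  hit : Vec V k → VSet G → ℕ
  hit t S = 𝟙 (neighbourhood≡ a (image (lookup t)) S)
  N : VSet G → VSet G
  N S b = kept S b ∧ Adj G a b
  per-tuple : ∀ t b → independentTuple G U t ≡ b → w * 𝟙 b ≤ 2 * (M^k * 𝔼 c (λ S → 𝟙 b * hit t S))
  per-tuple t false e = ≤-trans (≤-reflexive (*-zeroʳ w)) z≤n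
  per-tuple t true  e = begin
    w * 1 ≡⟨ *-identityʳ w ⟩
    w ≤⟨ 𝔼-exact-neighbourhood c a (image (lookup t)) k inside indep
               (countF-image (lookup t) (independentTuple-injective G U t e)) small ⟩
    2 * (M^k * 𝔼 c (λ S → hit t S))
      ≡⟨ cong (λ x → 2 * (M^k * x)) (𝔼-cong c (λ S → sym (*-identityˡ (hit t S)))) ⟩
    2 * (M^k * 𝔼 c (λ S → 1 * hit t S)) ∎
    where
    inside : ∀ b → image (lookup t) b ≡ true → U b ≡ true
    inside b q = let (i , r) = image-elim (lookup t) b q in
      subst (λ x → U x ≡ true) r (independentTuple-in G U t e i)
    indep : Independent G (image (lookup t))
    indep u v p q = let (i , r) = image-elim (lookup t) u p ; (j , r′) = image-elim (lookup t) v q in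
      subst₂ (λ x y → Adj G x y ≡ false) r r′ (independentTuple-adj G U t e i j)
  pointwise : ∀ S → sumT k (λ t → good t * hit t S) ≤ k ^ k * 𝟙 (deg G (kept S) a ≡ᵇ k)
  pointwise S = cases (deg G (kept S) a ≡ᵇ k) refl
    where
    cases : ∀ b → (deg G (kept S) a ≡ᵇ k) ≡ b → sumT k (λ t → good t * hit t S) ≤ k ^ k * 𝟙 b
    cases true e = begin
      sumT k (λ t → good t * hit t S) ≤⟨ sumT-mono k (λ t → entries t) ⟩
      sumT k (λ t → 𝟙 (inAll (N S) t)) ≡⟨ sumT-inAll k (N S) ⟩
      countF (N S) ^ k ≡⟨ cong (_^ k) (≡ᵇ-elim e) ⟩
      k ^ k ≡⟨ sym (*-identityʳ (k ^ k)) ⟩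
      k ^ k * 1 ∎
      where
      entries : ∀ t → good t * hit t S ≤ 𝟙 (inAll (N S) t)
      entries t = ≤-trans (*-monoˡ-≤ (hit t S) (𝟙≤1 (independentTuple G U t))) (≤-trans (≤-reflexive (*-identityˡ (hit t S)))
        (𝟙-mono (λ q → inAll-intro (N S) t (λ i →
          ⊆ᵇ-elim (image (lookup t)) (N S) (proj₂ (∧-split {N S ⊆ᵇ image (lookup t)} q)) (lookup t i) (image-intro (lookup t) i)))))
    cases false e = ≤-trans (≤-reflexive (trans (sumT-cong k (λ t → vanish t)) (sumT-zero {n G} k))) z≤n
      where
      vanish : ∀ t → good t * hit t S ≡ 0
      vanish t = trans (sym (𝟙-∧ (independentTuple G U t) _)) (cong 𝟙 (≢true⇒≡false λ q →
        true≢false (≡ᵇ-intro (trans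
            (neighbourhood≡⇒deg a (image (lookup t)) S (proj₂ (∧-split {independentTuple G U t} q)))
            (countF-image (lookup t) (independentTuple-injective G U t (proj₁ (∧-split q)))))) e))

member-⊎ : ∀ {n} {P : Set} (X : Fin n → Bool) {Q : Fin n → Set} → (∀ i → X i ≡ true → P ⊎ Q i) →
  P ⊎ (∀ i → X i ≡ true → Q i)
member-⊎ {P = P} X {Q} f = sequence-⊎ λ i → aux i (X i) refl
  where
  aux : ∀ i b → X i ≡ b → P ⊎ (X i ≡ true → Q i)
  aux i false e = inj₂ λ q → ⊥-elim (true≢false q e)
  aux i true  e with f i e
  ... | inj₁ p = inj₁ p
  ... | inj₂ q = inj₂ λ _ → q

-- Sparse pairs of neighbourhoods

module _ {G : Graph} {k : ℕ} (σ : Setting G k) where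

  open Setting σ

  -- If the bound fails, the many edges force density at least `T ^ -(ε + 2)`, because
  -- `|X| ≤ T ^ (6 + R)` and `|Y| ≤ z`. They also force both sets to be large: `|X|` is at least
  -- edges over `z`, and `|Y|` at least edges over `T ^ (6 + R)`. Measuring against `z` rather than
  -- `|Y|` covers small `Y`.
  sparse-or-dense : ∀ ε (X Y : VSet G) z → ε + 2 ≤ a → c + (ε + 2) ≤ 4 + R → countF X ≤ T ^ (6 + R) →
    countF Y ≤ z → T ^ (c + (ε + 2)) ≤ z →
    C4FreeSubgraph G k ⊎ T ^ ε * sumOver Y (deg G X) ≤ T ^ (4 + R) * z
  sparse-or-dense ε X Y z ε≤a c≤ X≤ Y≤z z-large with T ^ ε * sumOver Y (deg G X) ≤? T ^ (4 + R) * z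
  ... | yes p = inj₂ p
  ... | no ¬p = inj₁ (dense⇒C4Free X Y dense X-large Y-large)
    where
    open ≤-Reasoning
    e : ℕ
    e = sumOver Y (deg G X)
    many : T ^ (4 + R) * z ≤ T ^ ε * e
    many = <⇒≤ (≰⇒> ¬p)
    e≤ : e ≤ countF Y * countF X
    e≤ = sumOver-≤const Y (countF X) (λ u _ → countF-mono {P = λ v → X v ∧ Adj G u v} {Q = X} (λ v q → proj₁ (∧-split q)))
    dense : countF X * countF Y ≤ T ^ a * e
    dense = begin
      countF X * countF Y ≤⟨ *-mono-≤ X≤ Y≤z ⟩
      T ^ (6 + R) * z ≡⟨ trans (cong (_* z) (^-distribˡ-+-* T 2 (4 + R))) (*-assoc (T ^ 2) (T ^ (4 + R)) z) ⟩
      T ^ 2 * (T ^ (4 + R) * z) ≤⟨ *-monoʳ-≤ (T ^ 2) many ⟩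
      T ^ 2 * (T ^ ε * e) ≡⟨ trans (sym (*-assoc (T ^ 2) (T ^ ε) e)) (cong (_* e) (trans (sym (^-distribˡ-+-* T 2 ε)) (cong (T ^_) (+-comm 2 ε)))) ⟩
      T ^ (ε + 2) * e ≤⟨ *-monoˡ-≤ e (^-monoʳ-≤ T ε≤a) ⟩
      T ^ a * e ∎
    instance
      z≢0 : NonZero z
      z≢0 = >-nonZero (≤-trans (m^n>0 T (c + (ε + 2))) z-large)
    X-large : T ^ c ≤ countF X
    X-large = *-cancelˡ-≤ (T ^ ε) {{m^n≢0 T ε}} (begin
      T ^ ε * T ^ c ≡⟨ trans (sym (^-distribˡ-+-* T ε c)) (cong (T ^_) (+-comm ε c)) ⟩
      T ^ (c + ε) ≤⟨ ^-monoʳ-≤ T (≤-trans (+-monoʳ-≤ c (m≤m+n ε 2)) c≤) ⟩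
      T ^ (4 + R) ≤⟨ *-cancelʳ-≤ (T ^ (4 + R)) (T ^ ε * countF X) z (begin
        T ^ (4 + R) * z ≤⟨ many ⟩
        T ^ ε * e ≤⟨ *-monoʳ-≤ (T ^ ε) (≤-trans e≤ (*-monoˡ-≤ (countF X) Y≤z)) ⟩
        T ^ ε * (z * countF X) ≡⟨ trans (cong (T ^ ε *_) (*-comm z (countF X))) (sym (*-assoc (T ^ ε) (countF X) z)) ⟩
        T ^ ε * countF X * z ∎) ⟩
      T ^ ε * countF X ∎)
    Y-large : T ^ c ≤ countF Y
    Y-large = *-cancelˡ-≤ (T ^ (ε + 2)) {{m^n≢0 T (ε + 2)}} (*-cancelˡ-≤ (T ^ (4 + R)) {{m^n≢0 T (4 + R)}} (begin
      T ^ (4 + R) * (T ^ (ε + 2) * T ^ c)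
        ≡⟨ cong (T ^ (4 + R) *_) (trans (sym (^-distribˡ-+-* T (ε + 2) c)) (cong (T ^_) (+-comm (ε + 2) c))) ⟩
      T ^ (4 + R) * T ^ (c + (ε + 2)) ≤⟨ *-monoʳ-≤ (T ^ (4 + R)) z-large ⟩
      T ^ (4 + R) * z ≤⟨ many ⟩
      T ^ ε * e ≤⟨ *-monoʳ-≤ (T ^ ε) (≤-trans e≤ (*-monoʳ-≤ (countF Y) X≤)) ⟩
      T ^ ε * (countF Y * T ^ (6 + R)) ≡⟨ cong (λ q → T ^ ε * (countF Y * q)) (^-distribˡ-+-* T 2 (4 + R)) ⟩
      T ^ ε * (countF Y * (T ^ 2 * T ^ (4 + R))) ≡⟨ r (T ^ ε) (countF Y) (T ^ 2) (T ^ (4 + R)) ⟩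
      T ^ (4 + R) * (T ^ ε * T ^ 2 * countF Y) ≡⟨ cong (λ q → T ^ (4 + R) * (q * countF Y)) (sym (^-distribˡ-+-* T ε 2)) ⟩
      T ^ (4 + R) * (T ^ (ε + 2) * countF Y) ∎))
      where
      r : ∀ p y q s → p * (y * (q * s)) ≡ s * (p * q * y)
      r = solve-∀

≤-by : ∀ {a b} d → b ≡ a + d → a ≤ b
≤-by {a} d refl = m≤m+n a d

-- The balanced outcome

module _ {G : Graph} {k : ℕ} (σ : Setting G k) where

  open Setting σ

  -- A and B span an almost regular bipartite graph: degrees into B lie between T^R and T^(6+R), and
  -- degrees into A₀ ⊇ A lie between T^j and T^(1+j).  B is sampled with probability T^-(5+R+e₁), and the
  -- conflict graph on the candidates is thinned out with probability T^-x.
  module Balanced (A₀ A B : VSet G)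
    (e₁ j j′ x c₁ : ℕ) (M≡ : suc c₁ ≡ T ^ (5 + R + e₁)) (j≡ : j ≡ 2 + R + j′)
    (e₁≡ : e₁ ≡ 2 * (k * k) + 12 * k + 14) (x≡ : x + k * e₁ ≡ j + 5 + (k * k + 7 * k))
    (k^k≤T : 2 * k ^ k ≤ T) (2k≤R : 2 * k ≤ R)
    (1≤A : 1 ≤ countF A) (A⊆A₀ : ∀ v → A v ≡ true → A₀ v ≡ true)
    (lower-B : ∀ v → A v ≡ true → T ^ R ≤ deg G B v)
    (upper-B : ∀ v → A v ≡ true → deg G B v ≤ T ^ (6 + R))
    (upper-A₀ : ∀ b → B b ≡ true → deg G A₀ b ≤ T ^ (1 + j))
    (size-B : T ^ j * countF B ≤ T ^ (12 + R) * countF A)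
    (sparse₁ : ∀ u → A u ≡ true →
      T ^ (2 * (k * e₁)) * sumOver (λ v → A v ∧ Adj G u v) (deg G (λ b → B b ∧ Adj G u b)) ≤ T ^ (4 + R) * T ^ (6 + R))
    (sparse₂ : ∀ u → A u ≡ true → ∀ b → B b ∧ Adj G u b ≡ true →
      T ^ (2 * (k * e₁)) * sumOver (λ v → A₀ v ∧ Adj G b v) (deg G (λ b → B b ∧ Adj G u b)) ≤ T ^ (4 + R) * (T * deg G A₀ b))
    where

    open Conflicts G (T ^ (5 + R)) orientation A B k
    open Sampling G (T ^ (5 + R)) orientation B using (kept; kept⇒B; kept⇒S; kept-independent)

    private
      V : Set
      V = Fin (n G)
      m g ε w p : ℕ
      m = 5 + R + e₁
      -- A vertex of `A` becomes a candidate with probability at least `T ^ -g`: `k * k` for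
      -- independence of the tuple, 1 for the factor `2 * k ^ k`, and `5 + e₁` for each of `k`
      -- sampled vertices among at least `T ^ R`.
      g = k * k + 1 + k * (5 + e₁)
      ε = 2 * (k * e₁)
      w = suc c₁ ^ n G
      p = countF A * w
      gain cost : ℕ
      gain = 𝔼 c₁ (λ S → countF (candidates S))
      cost = 𝔼 c₁ (λ S → sumOver B (λ v → 𝟙 (S v)))
      M^k≡ : suc c₁ ^ k ≡ T ^ (m * k)
      M^k≡ = trans (cong (_^ k) M≡) (^-*-assoc T m k)

      candidate-bound : ∀ v → A v ≡ true → w ≤ T ^ g * 𝔼 c₁ (λ S → 𝟙 (deg G (kept S) v ≡ᵇ k))
      candidate-bound v av = ≤-trans (≤-reflexive (sym (+-identityʳ w))) (rescale T (R * k) (k * k + (1 + m * k)) 0 g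
        (begin
          T ^ (R * k) * w
            ≡⟨ cong (_* w) (sym (^-*-assoc T R k)) ⟩
          (T ^ R) ^ k * w
            ≤⟨ *-monoˡ-≤ w (^-monoˡ-≤ k (lower-B v av)) ⟩
          deg G B v ^ k * w
            ≤⟨ *-monoˡ-≤ w (many-independentTuples G s T 2≤T s<T noK k U
                 (≤-trans (^-monoʳ-≤ T 2k≤R) (lower-B v av))) ⟩
          T ^ (k * k) * sumT k (λ t → 𝟙 (independentTuple G U t)) * w
            ≡⟨ *-assoc (T ^ (k * k)) (sumT k (λ t → 𝟙 (independentTuple G U t))) w ⟩
          T ^ (k * k) * (sumT k (λ t → 𝟙 (independentTuple G U t)) * w)
            ≤⟨ *-monoʳ-≤ (T ^ (k * k)) (𝔼-candidate G (T ^ (5 + R)) orientation B k c₁ v small) ⟩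
          T ^ (k * k) * (2 * (suc c₁ ^ k * (k ^ k * q)))
            ≡⟨ cong (T ^ (k * k) *_) (r (suc c₁ ^ k) (k ^ k) q) ⟩
          T ^ (k * k) * (2 * k ^ k * suc c₁ ^ k * q)
            ≤⟨ *-monoʳ-≤ (T ^ (k * k)) (*-monoˡ-≤ q (*-mono-≤ k^k≤T (≤-reflexive M^k≡))) ⟩
          T ^ (k * k) * (T ^ (1 + m * k) * q)
            ≡⟨ trans (sym (*-assoc (T ^ (k * k)) (T ^ (1 + m * k)) q)) (cong (_* q) (sym (^-distribˡ-+-* T (k * k) (1 + m * k)))) ⟩
          T ^ (k * k + (1 + m * k)) * q ∎)
        (≤-reflexive (exponent k R e₁)))
        where
        open ≤-Reasoning
        q : ℕ
        q = 𝔼 c₁ (λ S → 𝟙 (deg G (kept S) v ≡ᵇ k))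
        U : VSet G
        U b = B b ∧ Adj G v b
        k≤T : k ≤ T
        k≤T = ≤-trans (≤-trans (k≤k^k k 2≤k) (m≤n*m (k ^ k) 2)) k^k≤T
          where
          k≤k^k : ∀ k → 2 ≤ k → k ≤ k ^ k
          k≤k^k (suc k) _ = m≤m*n (suc k) (suc k ^ k) {{m^n≢0 (suc k) k}}
        small : 2 * (deg G B v + k * T ^ (5 + R)) ≤ suc c₁
        small = ≤-trans (Unbalanced.sample-bound σ k (deg G B v) k≤T (upper-B v av))
          (≤-trans (^-monoʳ-≤ T (≤-trans (≤-reflexive (+-comm 3 (5 + R))) (+-monoʳ-≤ (5 + R) 3≤e₁))) (≤-reflexive (sym M≡)))
          where
          3≤e₁ : 3 ≤ e₁
          3≤e₁ = ≤-trans (≤-trans (s≤s (s≤s (s≤s z≤n))) (m≤n+m 14 (2 * (k * k) + 12 * k))) (≤-reflexive (sym e₁≡))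
        r : ∀ M K q → 2 * (M * (K * q)) ≡ 2 * K * M * q
        r = solve-∀
        exponent : ∀ k R e₁ → 0 + (k * k + (1 + (5 + R + e₁) * k)) ≡ k * k + 1 + k * (5 + e₁) + R * k
        exponent = solve-∀

      gain-bound : p ≤ T ^ g * gain
      gain-bound = begin
        countF A * w
          ≤⟨ sumOver-≥const A w candidate-bound ⟩
        sumOver A (λ v → T ^ g * 𝔼 c₁ (λ S → 𝟙 (deg G (kept S) v ≡ᵇ k)))
          ≡⟨ sumOver-*ˡ A (T ^ g) (λ v → 𝔼 c₁ (λ S → 𝟙 (deg G (kept S) v ≡ᵇ k))) ⟩
        T ^ g * sumOver A (λ v → 𝔼 c₁ (λ S → 𝟙 (deg G (kept S) v ≡ᵇ k)))
          ≡⟨ cong (T ^ g *_) (sym (trans (𝔼-cong c₁ (λ S → sumOver-∧ A (λ v → deg G (kept S) v ≡ᵇ k) (λ _ → 1)))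
               (𝔼-sumOver c₁ A (λ v S → 𝟙 (deg G (kept S) v ≡ᵇ k))))) ⟩
        T ^ g * gain ∎
        where open ≤-Reasoning

      pull : ∀ a b q r → T ^ a * (T ^ b * q) ≡ r → T ^ (a + b) * q ≡ r
      pull a b q r e = trans (cong (_* q) (^-distribˡ-+-* T a b)) (trans (*-assoc (T ^ a) (T ^ b) q) e)

      -- This fixes the `5 + (k * k + 7 * k)` in `x≡`: for `j′` equal to 0 the exponents on both
      -- sides agree.
      loss₁ : T ^ (1 + g) * 𝔼 c₁ losses₁ ≤ T ^ x * p
      loss₁ = rescale T (m * k + m * k) (5 + R + ((6 + R) * k + (6 + R) * k)) (1 + g) x
        (begin
          T ^ (m * k + m * k) * 𝔼 c₁ losses₁
            ≡⟨ cong (_* 𝔼 c₁ losses₁) (trans (^-distribˡ-+-* T (m * k) (m * k)) (cong₂ _*_ (sym M^k≡) (sym M^k≡))) ⟩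
          suc c₁ ^ k * suc c₁ ^ k * 𝔼 c₁ losses₁
            ≤⟨ losses₁-𝔼 c₁ (T ^ (6 + R)) upper-B ⟩
          sumOver A (deg G A) * ((T ^ (6 + R)) ^ k * ((T ^ (6 + R)) ^ k * w))
            ≤⟨ *-mono-≤ (mad A) (≤-reflexive (cong₂ (λ y z → y * (z * w)) (^-*-assoc T (6 + R) k) (^-*-assoc T (6 + R) k))) ⟩
          T ^ (5 + R) * countF A * (T ^ ((6 + R) * k) * (T ^ ((6 + R) * k) * w))
            ≡⟨ r (T ^ (5 + R)) (countF A) (T ^ ((6 + R) * k)) w ⟩
          T ^ (5 + R) * (T ^ ((6 + R) * k) * (T ^ ((6 + R) * k) * p))
            ≡⟨ sym (pull (5 + R) ((6 + R) * k + (6 + R) * k) p _ (cong (T ^ (5 + R) *_) (pull ((6 + R) * k) ((6 + R) * k) p _ refl))) ⟩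
          T ^ (5 + R + ((6 + R) * k + (6 + R) * k)) * p ∎)
        (≤-by j′ (begin-equality
          x + (m * k + m * k) ≡⟨ exponent₁ x k e₁ R ⟩
          (x + k * e₁) + (2 * (k * (5 + R)) + k * e₁) ≡⟨ cong (_+ (2 * (k * (5 + R)) + k * e₁)) (trans x≡ (cong (λ y → y + 5 + (k * k + 7 * k)) j≡)) ⟩
          2 + R + j′ + 5 + (k * k + 7 * k) + (2 * (k * (5 + R)) + k * e₁) ≡⟨ exponent₂ j′ k e₁ R ⟩
          1 + g + (5 + R + ((6 + R) * k + (6 + R) * k)) + j′ ∎))
        where
        open ≤-Reasoning
        r : ∀ d a t w → d * a * (t * (t * w)) ≡ d * (t * (t * (a * w)))
        r = solve-∀
        exponent₁ : ∀ x k e₁ R → x + ((5 + R + e₁) * k + (5 + R + e₁) * k) ≡ (x + k * e₁) + (2 * (k * (5 + R)) + k * e₁)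
        exponent₁ = solve-∀
        exponent₂ : ∀ j′ k e₁ R → 2 + R + j′ + 5 + (k * k + 7 * k) + (2 * (k * (5 + R)) + k * e₁)
          ≡ 1 + (k * k + 1 + k * (5 + e₁)) + (5 + R + ((6 + R) * k + (6 + R) * k)) + j′
        exponent₂ = solve-∀

      -- The sparsity exponent `ε` is twice `k * e₁`, since `k * e₁` is subtracted in `x` and occurs
      -- once more in `g`.
      loss₂ : T ^ (1 + g) * 𝔼 c₁ losses₂ ≤ T ^ x * p
      loss₂ = rescale T (ε + m) (4 + R + (6 + R)) (1 + g) x
        (begin
          T ^ (ε + m) * 𝔼 c₁ losses₂
            ≡⟨ pull ε m (𝔼 c₁ losses₂) _ (cong (T ^ ε *_) (trans (cong (_* 𝔼 c₁ losses₂) (sym M≡)) (losses₂-𝔼 c₁))) ⟩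
          T ^ ε * (sumOver A (λ u → sumOver (nbrs A u) (deg G (nbrs B u))) * w)
            ≡⟨ trans (sym (*-assoc (T ^ ε) _ w)) (cong (_* w) (sym (sumOver-*ˡ A (T ^ ε) (λ u → sumOver (nbrs A u) (deg G (nbrs B u)))))) ⟩
          sumOver A (λ u → T ^ ε * sumOver (nbrs A u) (deg G (nbrs B u))) * w
            ≤⟨ *-monoˡ-≤ w (sumOver-≤const A (T ^ (4 + R) * T ^ (6 + R)) sparse₁) ⟩
          countF A * (T ^ (4 + R) * T ^ (6 + R)) * w
            ≡⟨ r (countF A) (T ^ (4 + R) * T ^ (6 + R)) w ⟩
          T ^ (4 + R) * T ^ (6 + R) * p
            ≡⟨ cong (_* p) (sym (^-distribˡ-+-* T (4 + R) (6 + R))) ⟩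
          T ^ (4 + R + (6 + R)) * p ∎)
        (≤-by (2 * k + e₁ + j′) (begin-equality
          x + (ε + m) ≡⟨ exponent₁ x k e₁ R ⟩
          (x + k * e₁) + (k * e₁ + (5 + R + e₁)) ≡⟨ cong (_+ (k * e₁ + (5 + R + e₁))) (trans x≡ (cong (λ y → y + 5 + (k * k + 7 * k)) j≡)) ⟩
          2 + R + j′ + 5 + (k * k + 7 * k) + (k * e₁ + (5 + R + e₁)) ≡⟨ exponent₂ j′ k e₁ R ⟩
          1 + g + (4 + R + (6 + R)) + (2 * k + e₁ + j′) ∎))
        where
        open ≤-Reasoning
        r : ∀ a t w → a * t * w ≡ t * (a * w)
        r = solve-∀
        exponent₁ : ∀ x k e₁ R → x + (2 * (k * e₁) + (5 + R + e₁)) ≡ (x + k * e₁) + (k * e₁ + (5 + R + e₁))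
        exponent₁ = solve-∀
        exponent₂ : ∀ j′ k e₁ R → 2 + R + j′ + 5 + (k * k + 7 * k) + (k * e₁ + (5 + R + e₁))
          ≡ 1 + (k * k + 1 + k * (5 + e₁)) + (4 + R + (6 + R)) + (2 * k + e₁ + j′)
        exponent₂ = solve-∀

      -- One of the two common neighbours is moved to the front: for each `b` next to `u`, codegrees
      -- are summed over the neighbours of `b`. These are taken in `A₀`, because the degrees of `B`
      -- are controlled into `A₀` and not into `A`.
      codegree-squares : ∀ u → sumOver A (λ v → deg G (nbrs B u) v * deg G (nbrs B u) v)
        ≤ sumOver (nbrs B u) (λ b → sumOver (nbrs A₀ b) (deg G (nbrs B u)))
      codegree-squares u = begin
        sumOver A (λ v → t v * t v)
          ≡⟨ sumOver-cong A (λ v →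
               trans (sym (sumOver-const (common u v) (t v))) (sumOver-∧ (nbrs B u) (Adj G v) (λ _ → t v))) ⟩
        sumOver A (λ v → sumOver (nbrs B u) (λ b → if Adj G v b then t v else 0))
          ≡⟨ sumOver-swap A (nbrs B u) (λ v b → if Adj G v b then t v else 0) ⟩
        sumOver (nbrs B u) (λ b → sumOver A (λ v → if Adj G v b then t v else 0))
          ≤⟨ sumOver-mono (nbrs B u) (λ b _ → ≤-trans (≤-reflexive (sym (sumOver-∧ A (λ v → Adj G v b) t)))
               (sumOver-monoˢ {X = λ v → A v ∧ Adj G v b} {Y = nbrs A₀ b} t
                 (λ v e → ∧-join (A⊆A₀ v (proj₁ (∧-split e))) (adj-sym G (proj₂ (∧-split {A v} e)))))) ⟩
        sumOver (nbrs B u) (λ b → sumOver (nbrs A₀ b) t) ∎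
        where
        open ≤-Reasoning
        t : V → ℕ
        t = deg G (nbrs B u)

      loss₃ : T ^ (1 + g) * 𝔼 c₁ losses₃ ≤ T ^ x * p
      loss₃ = rescale T (ε + (m + m)) (6 + R + (6 + R + j)) (1 + g) x
        (begin
          T ^ (ε + (m + m)) * 𝔼 c₁ losses₃
            ≡⟨ pull ε (m + m) (𝔼 c₁ losses₃) _ refl ⟩
          T ^ ε * (T ^ (m + m) * 𝔼 c₁ losses₃)
            ≡⟨ cong (λ y → T ^ ε * (y * 𝔼 c₁ losses₃)) (trans (^-distribˡ-+-* T m m) (cong₂ _*_ (sym M≡) (sym M≡))) ⟩
          T ^ ε * (suc c₁ * suc c₁ * 𝔼 c₁ losses₃)
            ≤⟨ *-monoʳ-≤ (T ^ ε) (losses₃-𝔼 c₁) ⟩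
          T ^ ε * (sumOver A (λ u → sumOver A (λ v → deg G (nbrs B u) v * deg G (nbrs B u) v)) * w)
            ≡⟨ trans (sym (*-assoc (T ^ ε) _ w)) (cong (_* w) (sym (sumOver-*ˡ A (T ^ ε) (λ u → sumOver A (λ v → deg G (nbrs B u) v * deg G (nbrs B u) v))))) ⟩
          sumOver A (λ u → T ^ ε * sumOver A (λ v → deg G (nbrs B u) v * deg G (nbrs B u) v)) * w
            ≤⟨ *-monoˡ-≤ w (sumOver-≤const A (T ^ (6 + R) * T ^ (6 + R + j)) per-u) ⟩
          countF A * (T ^ (6 + R) * T ^ (6 + R + j)) * w
            ≡⟨ r (countF A) (T ^ (6 + R) * T ^ (6 + R + j)) w ⟩
          T ^ (6 + R) * T ^ (6 + R + j) * p
            ≡⟨ cong (_* p) (sym (^-distribˡ-+-* T (6 + R) (6 + R + j))) ⟩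
          T ^ (6 + R + (6 + R + j)) * p ∎)
        (≤-by (2 * k + 1 + e₁ + e₁) (begin-equality
          x + (ε + (m + m)) ≡⟨ exponent₁ x k e₁ R ⟩
          (x + k * e₁) + (k * e₁ + 2 * (5 + R + e₁)) ≡⟨ cong (_+ (k * e₁ + 2 * (5 + R + e₁))) x≡ ⟩
          j + 5 + (k * k + 7 * k) + (k * e₁ + 2 * (5 + R + e₁)) ≡⟨ exponent₂ j k e₁ R ⟩
          1 + g + (6 + R + (6 + R + j)) + (2 * k + 1 + e₁ + e₁) ∎))
        where
        open ≤-Reasoning
        r : ∀ a t w → a * t * w ≡ t * (a * w)
        r = solve-∀
        exponent₁ : ∀ x k e₁ R → x + (2 * (k * e₁) + (5 + R + e₁ + (5 + R + e₁))) ≡ (x + k * e₁) + (k * e₁ + 2 * (5 + R + e₁))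
        exponent₁ = solve-∀
        exponent₂ : ∀ j k e₁ R → j + 5 + (k * k + 7 * k) + (k * e₁ + 2 * (5 + R + e₁))
          ≡ 1 + (k * k + 1 + k * (5 + e₁)) + (6 + R + (6 + R + j)) + (2 * k + 1 + e₁ + e₁)
        exponent₂ = solve-∀
        per-b : ∀ u → A u ≡ true → ∀ b → nbrs B u b ≡ true →
          T ^ ε * sumOver (nbrs A₀ b) (deg G (nbrs B u)) ≤ T ^ (6 + R + j)
        per-b u au b e = begin
          T ^ ε * sumOver (nbrs A₀ b) (deg G (nbrs B u)) ≤⟨ sparse₂ u au b e ⟩
          T ^ (4 + R) * (T * deg G A₀ b) ≤⟨ *-monoʳ-≤ (T ^ (4 + R)) (*-monoʳ-≤ T (upper-A₀ b (proj₁ (∧-split e)))) ⟩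
          T ^ (4 + R) * T ^ (2 + j) ≡⟨ sym (^-distribˡ-+-* T (4 + R) (2 + j)) ⟩
          T ^ (4 + R + (2 + j)) ≡⟨ cong (T ^_) (r₂ R j) ⟩
          T ^ (6 + R + j) ∎
          where
          r₂ : ∀ R j → 4 + R + (2 + j) ≡ 6 + R + j
          r₂ = solve-∀
        per-u : ∀ u → A u ≡ true → T ^ ε * sumOver A (λ v → deg G (nbrs B u) v * deg G (nbrs B u) v) ≤ T ^ (6 + R) * T ^ (6 + R + j)
        per-u u au = begin
          T ^ ε * sumOver A (λ v → deg G (nbrs B u) v * deg G (nbrs B u) v)
            ≤⟨ *-monoʳ-≤ (T ^ ε) (codegree-squares u) ⟩
          T ^ ε * sumOver (nbrs B u) (λ b → sumOver (nbrs A₀ b) (deg G (nbrs B u)))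
            ≡⟨ sym (sumOver-*ˡ (nbrs B u) (T ^ ε) (λ b → sumOver (nbrs A₀ b) (deg G (nbrs B u)))) ⟩
          sumOver (nbrs B u) (λ b → T ^ ε * sumOver (nbrs A₀ b) (deg G (nbrs B u)))
            ≤⟨ sumOver-≤const (nbrs B u) (T ^ (6 + R + j)) (per-b u au) ⟩
          deg G B u * T ^ (6 + R + j)
            ≤⟨ *-monoˡ-≤ (T ^ (6 + R + j)) (upper-B u au) ⟩
          T ^ (6 + R) * T ^ (6 + R + j) ∎

      -- The sample counts with weight `T ^ (2 * x)`, so here `x` must not be too large. Together
      -- with the value of `x` that `loss₁` needs, this determines `e₁`: the exponents are equal,
      -- without slack.
      loss₄ : T ^ (1 + g) * (T ^ x * T ^ x * cost) ≤ T ^ x * p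
      loss₄ = begin
        T ^ (1 + g) * (T ^ x * T ^ x * cost) ≡⟨ r (T ^ (1 + g)) (T ^ x) cost ⟩
        T ^ x * (T ^ (1 + g) * (T ^ x * cost)) ≡⟨ cong (T ^ x *_) (sym (pull (1 + g) x cost _ refl)) ⟩
        T ^ x * (T ^ (1 + g + x) * cost) ≤⟨ *-monoʳ-≤ (T ^ x) (≤-trans
          (rescale T (j + m) (12 + R) (1 + g + x) 0 scaled exponent) (≤-reflexive (+-identityʳ p))) ⟩
        T ^ x * p ∎
        where
        open ≤-Reasoning
        r : ∀ a b c → a * (b * b * c) ≡ b * (a * (b * c))
        r = solve-∀
        scaled : T ^ (j + m) * cost ≤ T ^ (12 + R) * p
        scaled = begin
          T ^ (j + m) * cost ≡⟨ pull j m cost _ (cong (T ^ j *_) (trans (cong (_* cost) (sym M≡)) (𝔼-members c₁ B))) ⟩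
          T ^ j * (countF B * w) ≡⟨ sym (*-assoc (T ^ j) (countF B) w) ⟩
          T ^ j * countF B * w ≤⟨ *-monoˡ-≤ w size-B ⟩
          T ^ (12 + R) * countF A * w ≡⟨ *-assoc (T ^ (12 + R)) (countF A) w ⟩
          T ^ (12 + R) * p ∎
        exponent : 1 + g + x + (12 + R) ≤ 0 + (j + m)
        exponent = +-cancelʳ-≤ (k * e₁) (1 + g + x + (12 + R)) (j + m) (≤-reflexive (begin-equality
          1 + g + x + (12 + R) + k * e₁ ≡⟨ exponent₁ x k e₁ R ⟩
          (x + k * e₁) + (14 + R + (k * k + 5 * k + k * e₁)) ≡⟨ cong (_+ (14 + R + (k * k + 5 * k + k * e₁))) x≡ ⟩
          j + 5 + (k * k + 7 * k) + (14 + R + (k * k + 5 * k + k * e₁)) ≡⟨ exponent₂ j k e₁ R ⟩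
          j + (5 + R + (2 * (k * k) + 12 * k + 14)) + k * e₁ ≡⟨ cong (λ y → j + (5 + R + y) + k * e₁) (sym e₁≡) ⟩
          j + m + k * e₁ ∎))
          where
          exponent₁ : ∀ x k e₁ R → 1 + (k * k + 1 + k * (5 + e₁)) + x + (12 + R) + k * e₁
            ≡ (x + k * e₁) + (14 + R + (k * k + 5 * k + k * e₁))
          exponent₁ = solve-∀
          exponent₂ : ∀ j k e₁ R → j + 5 + (k * k + 7 * k) + (14 + R + (k * k + 5 * k + k * e₁))
            ≡ j + (5 + R + (2 * (k * k) + 12 * k + 14)) + k * e₁
          exponent₂ = solve-∀

      loss : VSet G → ℕ
      loss S = conflicts (conflict S) (candidates S) + T ^ x * T ^ x * sumOver B (λ v → 𝟙 (S v))

      -- Each of the four losses is at most a `T`-th of the lower bound for the gain, and `5 ≤ T`.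
      loss<gain : 𝔼 c₁ loss < 𝔼 c₁ (λ S → T ^ x * countF (candidates S))
      loss<gain = *-cancelˡ-< (T ^ (1 + g)) _ _ (begin-strict
        T ^ (1 + g) * 𝔼 c₁ loss
          ≤⟨ *-monoʳ-≤ (T ^ (1 + g)) (begin
               𝔼 c₁ loss
                 ≤⟨ 𝔼-mono c₁ (λ S → +-monoˡ-≤ (T ^ x * T ^ x * sumOver B (λ v → 𝟙 (S v))) (conflicts≤losses S)) ⟩
               𝔼 c₁ (λ S → losses₁ S + losses₂ S + losses₃ S + T ^ x * T ^ x * sumOver B (λ v → 𝟙 (S v)))
                 ≡⟨ 𝔼-+ c₁ (λ S → losses₁ S + losses₂ S + losses₃ S) (λ S → T ^ x * T ^ x * sumOver B (λ v → 𝟙 (S v))) ⟩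
               𝔼 c₁ (λ S → losses₁ S + losses₂ S + losses₃ S) + 𝔼 c₁ (λ S → T ^ x * T ^ x * sumOver B (λ v → 𝟙 (S v)))
                 ≡⟨ cong₂ _+_ (trans (𝔼-+ c₁ (λ S → losses₁ S + losses₂ S) losses₃) (cong (_+ 𝔼 c₁ losses₃) (𝔼-+ c₁ losses₁ losses₂)))
                      (𝔼-*ˡ c₁ (T ^ x * T ^ x) (λ S → sumOver B (λ v → 𝟙 (S v)))) ⟩
               𝔼 c₁ losses₁ + 𝔼 c₁ losses₂ + 𝔼 c₁ losses₃ + T ^ x * T ^ x * cost ∎) ⟩
        T ^ (1 + g) * (𝔼 c₁ losses₁ + 𝔼 c₁ losses₂ + 𝔼 c₁ losses₃ + T ^ x * T ^ x * cost)
          ≡⟨ r (T ^ (1 + g)) (𝔼 c₁ losses₁) (𝔼 c₁ losses₂) (𝔼 c₁ losses₃) (T ^ x * T ^ x * cost) ⟩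
        T ^ (1 + g) * 𝔼 c₁ losses₁ + T ^ (1 + g) * 𝔼 c₁ losses₂ + T ^ (1 + g) * 𝔼 c₁ losses₃ + T ^ (1 + g) * (T ^ x * T ^ x * cost)
          ≤⟨ +-mono-≤ (+-mono-≤ (+-mono-≤ loss₁ loss₂) loss₃) loss₄ ⟩
        T ^ x * p + T ^ x * p + T ^ x * p + T ^ x * p
          ≡⟨ four (T ^ x * p) ⟩
        4 * (T ^ x * p)
          <⟨ *-monoˡ-< (T ^ x * p) {{m*n≢0 (T ^ x) p {{m^n≢0 T x}} {{m*n≢0 (countF A) w {{>-nonZero 1≤A}} {{m^n≢0 (suc c₁) (n G)}}}}}} 5≤T ⟩
        T * (T ^ x * p)
          ≤⟨ *-monoʳ-≤ T (*-monoʳ-≤ (T ^ x) gain-bound) ⟩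
        T * (T ^ x * (T ^ g * gain))
          ≡⟨ r₂ T (T ^ x) (T ^ g) gain ⟩
        T ^ (1 + g) * (T ^ x * gain)
          ≡⟨ cong (T ^ (1 + g) *_) (sym (𝔼-*ˡ c₁ (T ^ x) (λ S → countF (candidates S)))) ⟩
        T ^ (1 + g) * 𝔼 c₁ (λ S → T ^ x * countF (candidates S)) ∎)
        where
        open ≤-Reasoning
        r : ∀ t a b c d → t * (a + b + c + d) ≡ t * a + t * b + t * c + t * d
        r = solve-∀
        r₂ : ∀ T x g e → T * (x * (g * e)) ≡ T * g * (x * e)
        r₂ = solve-∀
        four : ∀ y → y + y + y + y ≡ 4 * y
        four = solve-∀

      assemble : ∀ S → loss S < T ^ x * countF (candidates S) →
        (∃ λ (I : VSet G) → (∀ u → I u ≡ true → candidates S u ≡ true) ×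
          (∀ u v → I u ≡ true → I v ≡ true → conflict S u v ≡ false) ×
          T ^ x * countF (candidates S) ≤ T ^ x * T ^ x * countF I + conflicts (conflict S) (candidates S)) →
        C4FreeSubgraph G k
      assemble S lt (I , I⊆ , I-free , bound) =
        C4FreeSubgraph-intro G k I (kept S) disjoint indep (kept-independent S)
          (λ v iv → ≤-reflexive (sym (exact v iv))) (<⇒≤ smaller) (≤-trans (s≤s z≤n) smaller) linear
        where
        open ≤-Reasoning
        exact : ∀ v → I v ≡ true → deg G (kept S) v ≡ k
        exact v iv = ≡ᵇ-elim (proj₂ (∧-split {A v} (I⊆ v iv)))
        -- The conflicts occur both in `loss S` and in the thinning bound and cancel, leaving the
        -- sample against `I` with the common weight `T ^ (2 * x)`.
        smaller : countF (kept S) < countF I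
        smaller = ≤-<-trans
          (≤-trans (countF-mono {P = kept S} {Q = λ v → B v ∧ S v} (λ v e → ∧-join (kept⇒B S v e) (kept⇒S S v e)))
            (≤-reflexive (sumOver-∧ B S (λ _ → 1))))
          (*-cancelˡ-< (T ^ x * T ^ x) _ _ (+-cancelˡ-< (conflicts (conflict S) (candidates S)) _ _ (begin-strict
            loss S <⟨ lt ⟩
            T ^ x * countF (candidates S) ≤⟨ bound ⟩
            T ^ x * T ^ x * countF I + conflicts (conflict S) (candidates S) ≡⟨ +-comm (T ^ x * T ^ x * countF I) _ ⟩
            conflicts (conflict S) (candidates S) + T ^ x * T ^ x * countF I ∎)))
        distinct-free : ∀ u v → I u ≡ true → I v ≡ true → u ≢ v → Adj G u v ∨ anyF (λ b → anyF (twoCommon S u v b)) ≡ false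
        distinct-free u v iu iv u≢v = trans (sym (cong (λ b → not b ∧ (Adj G u v ∨ anyF (λ b → anyF (twoCommon S u v b)))) (≢⇒==false u≢v)))
          (I-free u v iu iv)
        indep : Independent G I
        indep u v iu iv = ≢true⇒≡false λ e → true≢false (∨-introˡ e) (distinct-free u v iu iv (adj⇒≢ G e))
        disjoint : ∀ v → I v ≡ true → kept S v ≡ false
        disjoint v iv = ≢true⇒≡false λ kv →
          let (b , q) = 1≤countF⇒∃ (λ b → kept S b ∧ Adj G v b) (subst (1 ≤_) (sym (exact v iv)) (≤-trans (s≤s z≤n) 2≤k)) in
          true≢false (proj₂ (∧-split {kept S b} q)) (kept-independent S v b kv (proj₁ (∧-split q)))
        linear : ∀ u u′ b b′ → I u ≡ true → I u′ ≡ true → kept S b ≡ true → kept S b′ ≡ true → u ≢ u′ → b ≢ b′ →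
          Adj G u b ≡ true → Adj G u b′ ≡ true → Adj G u′ b ≡ true → Adj G u′ b′ ≡ true → ⊥
        linear u u′ b b′ iu iu′ kb kb′ u≢ b≢ ub ub′ u′b u′b′ = true≢false
          (∨-introʳ {Adj G u u′} (anyF-intro (λ b → anyF (twoCommon S u u′ b)) b (anyF-intro (twoCommon S u u′ b) b′
            (∧-join (not-true (≢⇒==false b≢)) (∧-join (∧-join kb (∧-join ub u′b)) (∧-join kb′ (∧-join ub′ u′b′)))))))
          (distinct-free u u′ iu iu′ u≢)

    balanced : C4FreeSubgraph G k
    balanced = let (S , lt) = 𝔼-<⇒∃< c₁ loss (λ S → T ^ x * countF (candidates S)) loss<gain in
      assemble S lt (turán-power T x (conflict S) (conflict-irrefl S) (candidates S))

𝟙-split : ∀ a b → 𝟙 a ≤ 𝟙 (a ∧ b) + 𝟙 (a ∧ not b)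
𝟙-split false b     = z≤n
𝟙-split true  true  = ≤-refl
𝟙-split true  false = ≤-refl

if-split : ∀ a b {x y z : ℕ} → (b ≡ false → x ≤ y) → (a ≡ true → x ≤ z) →
  (if a then x else 0) ≤ (if a then y else 0) + (if a ∧ b then z else 0)
if-split false b     f g = z≤n
if-split true  false f g = ≤-trans (f refl) (m≤m+n _ 0)
if-split true  true  f g = ≤-trans (g refl) (m≤n+m _ _)

≰ᵇ⇒≥ : ∀ a b → (a ≤ᵇ b) ≡ false → b ≤ a
≰ᵇ⇒≥ a b e = <⇒≤ (≰⇒> λ l → true≢false (≤ᵇ-intro l) e)

-- Degree classes of an extremal set

module _ {G : Graph} {k : ℕ} (σ : Setting G k) where

  open Setting σ

  module Dichotomy 
    (e₁ : ℕ) (e₁≡ : e₁ ≡ 2 * (k * k) + 12 * k + 14)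
    (k^k≤T : 2 * k ^ k ≤ T) (2k≤R : 2 * k ≤ R) (R≤T : 30 + R ≤ T)
    (9≤a : 9 ≤ a) (ε≤a : 2 * (k * e₁) + 2 ≤ a) (c≤R : c + (2 * (k * e₁) + 2) ≤ R)
    (m : ℕ) (1≤m : 1 ≤ m) (m<T : m < T)
    (X : VSet G) (1≤X : 1 ≤ countF X) (min-degree : ∀ v → X v ≡ true → T ^ (4 + R) ≤ deg G X v) where

    private
      ε : ℕ
      ε = 2 * (k * e₁)

      A₀ : VSet G
      A₀ v = X v ∧ (deg G X v ≤ᵇ T ^ (6 + R))

      -- Markov's inequality: the average degree in `X` is at most `T ^ (5 + R)`, so at most a
      -- `T`-th of the vertices exceed `T ^ (6 + R)`.
      X≤TA₀ : countF X ≤ T * countF A₀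
      X≤TA₀ = absorb 2≤T (begin
        T * countF X ≤⟨ *-monoʳ-≤ T (sumF-mono split) ⟩
        T * sumF (λ v → 𝟙 (A₀ v) + 𝟙 (H v)) ≡⟨ cong (T *_) (sumF-+ (λ v → 𝟙 (A₀ v)) (λ v → 𝟙 (H v))) ⟩
        T * (countF A₀ + countF H) ≡⟨ trans (*-distribˡ-+ T (countF A₀) (countF H)) (+-comm (T * countF A₀) _) ⟩
        T * countF H + T * countF A₀ ≤⟨ +-monoˡ-≤ (T * countF A₀) TH≤X ⟩
        countF X + T * countF A₀ ∎)
        where
        open ≤-Reasoning
        H : VSet G
        H v = X v ∧ not (deg G X v ≤ᵇ T ^ (6 + R))
        split : ∀ v → 𝟙 (X v) ≤ 𝟙 (A₀ v) + 𝟙 (H v)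
        split v = 𝟙-split (X v) (deg G X v ≤ᵇ T ^ (6 + R))
        TH≤X : T * countF H ≤ countF X
        TH≤X = *-cancelˡ-≤ (T ^ (5 + R)) {{m^n≢0 T (5 + R)}} (begin
          T ^ (5 + R) * (T * countF H) ≡⟨ r (T ^ (5 + R)) T (countF H) ⟩
          countF H * T ^ (6 + R) ≤⟨ sumOver-≥const H (T ^ (6 + R)) (λ v e → <⇒≤ (≰⇒> λ q →
            true≢false (≤ᵇ-intro q) (not-true⁻¹ (proj₂ (∧-split {X v} e))))) ⟩
          sumOver H (deg G X) ≤⟨ sumOver-monoˢ (deg G X) (λ v e → proj₁ (∧-split e)) ⟩
          sumOver X (deg G X) ≤⟨ mad X ⟩
          T ^ (5 + R) * countF X ∎)
          where
          r : ∀ t T h → t * (T * h) ≡ h * (T * t)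
          r = solve-∀

      1≤A₀ : 1 ≤ countF A₀
      1≤A₀ with countF A₀ | X≤TA₀
      ... | zero  | q = ⊥-elim (<⇒≱ 1≤X (≤-trans q (≤-reflexive (*-zeroʳ T))))
      ... | suc _ | _ = s≤s z≤n

      above class : ℕ → VSet G
      above i b = X b ∧ (T ^ i ≤ᵇ deg G A₀ b)
      class i b = above i b ∧ (deg G A₀ b ≤ᵇ T ^ (1 + i))

      edges-above : ℕ → ℕ
      edges-above i = sumOver (above i) (deg G A₀)

      γ : ℕ
      γ = countF A₀ * T ^ (1 + R)

      -- Vertices of `X` with fewer than `T ^ (2 + R)` neighbours in `A₀` account for at most a
      -- `T`-th of the edges. The factor `T * T` is the number of alternatives in the search for a
      -- class.
      many-edges : T * T * γ ≤ edges-above (2 + R)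
      many-edges = ≤-trans (≤-reflexive (r₀ T (countF A₀) (T ^ (1 + R)))) (absorb 2≤T (begin
        T * y ≡⟨ r₁ T (countF A₀) (T ^ (3 + R)) ⟩
        countF A₀ * T ^ (4 + R) ≤⟨ sumOver-≥const A₀ (T ^ (4 + R)) (λ v e → min-degree v (proj₁ (∧-split e))) ⟩
        sumOver A₀ (deg G X) ≡⟨ sumOver-deg-comm G X A₀ ⟩
        sumOver X (deg G A₀) ≤⟨ sumF-mono split ⟩
        sumF (λ b → (if X b then T ^ (2 + R) else 0) + (if above (2 + R) b then deg G A₀ b else 0))
          ≡⟨ sumF-+ (λ b → if X b then T ^ (2 + R) else 0) (λ b → if above (2 + R) b then deg G A₀ b else 0) ⟩
        sumOver X (λ _ → T ^ (2 + R)) + edges-above (2 + R)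
          ≡⟨ cong (_+ edges-above (2 + R)) (sumOver-const X (T ^ (2 + R))) ⟩
        countF X * T ^ (2 + R) + edges-above (2 + R)
          ≤⟨ +-monoˡ-≤ (edges-above (2 + R)) (≤-trans (*-monoˡ-≤ (T ^ (2 + R)) X≤TA₀) (≤-reflexive (r₂ T (countF A₀) (T ^ (2 + R))))) ⟩
        y + edges-above (2 + R) ∎))
        where
        open ≤-Reasoning
        y : ℕ
        y = countF A₀ * T ^ (3 + R)
        r₀ : ∀ T a t → T * T * (a * t) ≡ a * (T * (T * t))
        r₀ = solve-∀
        r₁ : ∀ T a t → T * (a * t) ≡ a * (T * t)
        r₁ = solve-∀
        r₂ : ∀ T a t → T * a * t ≡ a * (T * t)
        r₂ = solve-∀
        split : ∀ b → (if X b then deg G A₀ b else 0) ≤ (if X b then T ^ (2 + R) else 0) + (if above (2 + R) b then deg G A₀ b else 0)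
        split b = if-split (X b) (T ^ (2 + R) ≤ᵇ deg G A₀ b) (≰ᵇ⇒≥ (T ^ (2 + R)) (deg G A₀ b)) (λ _ → ≤-refl)

      edges-split : ∀ i → edges-above i ≤ sumOver (class i) (deg G A₀) + edges-above (suc i)
      edges-split i = ≤-trans (sumF-mono split) (≤-reflexive
        (sumF-+ (λ b → if class i b then deg G A₀ b else 0) (λ b → if above (suc i) b then deg G A₀ b else 0)))
        where
        step : ∀ a b q r x → (q ≡ false → r ≡ true) →
          (if a ∧ b then x else 0) ≤ (if (a ∧ b) ∧ q then x else 0) + (if a ∧ r then x else 0)
        step false b     q     r x h = z≤n
        step true  false q     r x h = z≤n
        step true  true  true  r x h = m≤m+n x _
        step true  true  false r x h rewrite h refl = ≤-refl
        split : ∀ b → (if above i b then deg G A₀ b else 0) ≤ (if class i b then deg G A₀ b else 0) + (if above (suc i) b then deg G A₀ b else 0)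
        split b = step (X b) (T ^ i ≤ᵇ deg G A₀ b) (deg G A₀ b ≤ᵇ T ^ (1 + i)) (T ^ suc i ≤ᵇ deg G A₀ b) (deg G A₀ b)
          (λ q → ≤ᵇ-intro (≰ᵇ⇒≥ (deg G A₀ b) (T ^ (1 + i)) q))

      -- Pigeonhole over `d` consecutive classes and the tail above them; a class with fewer than
      -- `γ` edges uses up one copy of `γ`.
      find-class : ∀ d i → suc d * γ ≤ edges-above i →
        (∃ λ j → i ≤ j × γ ≤ sumOver (class j) (deg G A₀)) ⊎ γ ≤ edges-above (d + i)
      find-class zero    i h = inj₂ (≤-trans (≤-reflexive (sym (+-identityʳ γ))) h)
      find-class (suc d) i h = cases (γ ≤? sumOver (class i) (deg G A₀))
        where
        later : (∃ λ j → suc i ≤ j × γ ≤ sumOver (class j) (deg G A₀)) ⊎ γ ≤ edges-above (d + suc i) →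
          (∃ λ j → i ≤ j × γ ≤ sumOver (class j) (deg G A₀)) ⊎ γ ≤ edges-above (suc d + i)
        later (inj₁ (j , i≤j , q)) = inj₁ (j , ≤-trans (n≤1+n i) i≤j , q)
        later (inj₂ q) = inj₂ (subst (λ l → γ ≤ edges-above l) (+-suc d i) q)
        cases : Dec (γ ≤ sumOver (class i) (deg G A₀)) →
          (∃ λ j → i ≤ j × γ ≤ sumOver (class j) (deg G A₀)) ⊎ γ ≤ edges-above (suc d + i)
        cases (yes p) = inj₁ (i , ≤-refl , p)
        cases (no ¬p) = later (find-class d (suc i) (+-cancelˡ-≤ γ (suc d * γ) (edges-above (suc i))
          (≤-trans h (≤-trans (edges-split i) (+-monoˡ-≤ (edges-above (suc i)) (<⇒≤ (≰⇒> ¬p)))))))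

      module Class (B : VSet G) (j : ℕ) (B⊆X : ∀ b → B b ≡ true → X b ≡ true)
        (lower-A₀ : ∀ b → B b ≡ true → T ^ j ≤ deg G A₀ b) (γ≤ : γ ≤ sumOver B (deg G A₀)) where

        A : VSet G
        A v = A₀ v ∧ (T ^ R ≤ᵇ deg G B v)

        A⊆A₀ : ∀ v → A v ≡ true → A₀ v ≡ true
        A⊆A₀ v e = proj₁ (∧-split e)

        A₀⊆X : ∀ v → A₀ v ≡ true → X v ≡ true
        A₀⊆X v e = proj₁ (∧-split e)

        upper-X : ∀ v → A₀ v ≡ true → deg G X v ≤ T ^ (6 + R)
        upper-X v e = ≤ᵇ-elim (proj₂ (∧-split {X v} e))

        upper-B₀ : ∀ v → A₀ v ≡ true → deg G B v ≤ T ^ (6 + R)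
        upper-B₀ v e = ≤-trans (deg-mono G v B⊆X) (upper-X v e)

        upper-B : ∀ v → A v ≡ true → deg G B v ≤ T ^ (6 + R)
        upper-B v e = upper-B₀ v (A⊆A₀ v e)

        upper-A : ∀ v → A v ≡ true → deg G A v ≤ T ^ (6 + R)
        upper-A v e = ≤-trans (deg-mono G v (λ u q → A₀⊆X u (A⊆A₀ u q))) (upper-X v (A⊆A₀ v e))

        lower-B : ∀ v → A v ≡ true → T ^ R ≤ deg G B v
        lower-B v e = ≤ᵇ-elim (proj₂ (∧-split {A₀ v} e))

        -- Vertices of `A₀` with fewer than `T ^ R` neighbours in `B` carry at most a `T`-th of `γ`
        -- edges, so the rest must come from `A`, where degrees are at most `T ^ (6 + R)`.
        A₀≤A : countF A₀ ≤ T ^ 6 * countF A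
        A₀≤A = *-cancelʳ-≤ (countF A₀) (T ^ 6 * countF A) (T ^ R) {{m^n≢0 T R}} (absorb 2≤T (begin
          T * (countF A₀ * T ^ R) ≡⟨ r₁ T (countF A₀) (T ^ R) ⟩
          γ ≤⟨ γ≤ ⟩
          sumOver B (deg G A₀) ≡⟨ sumOver-deg-comm G A₀ B ⟩
          sumOver A₀ (deg G B) ≤⟨ sumF-mono split ⟩
          sumF (λ v → (if A₀ v then T ^ R else 0) + (if A v then T ^ (6 + R) else 0))
            ≡⟨ trans (sumF-+ (λ v → if A₀ v then T ^ R else 0) (λ v → if A v then T ^ (6 + R) else 0))
                 (cong₂ _+_ (sumOver-const A₀ (T ^ R)) (sumOver-const A (T ^ (6 + R)))) ⟩
          countF A₀ * T ^ R + countF A * T ^ (6 + R) ≡⟨ cong (countF A₀ * T ^ R +_)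
            (trans (cong (countF A *_) (^-distribˡ-+-* T 6 R)) (r₂ (countF A) (T ^ 6) (T ^ R))) ⟩
          countF A₀ * T ^ R + T ^ 6 * countF A * T ^ R ∎))
          where
          open ≤-Reasoning
          r₁ : ∀ T a t → T * (a * t) ≡ a * (T * t)
          r₁ = solve-∀
          r₂ : ∀ a s t → a * (s * t) ≡ s * a * t
          r₂ = solve-∀
          split : ∀ v → (if A₀ v then deg G B v else 0) ≤ (if A₀ v then T ^ R else 0) + (if A v then T ^ (6 + R) else 0)
          split v = if-split (A₀ v) (T ^ R ≤ᵇ deg G B v) (≰ᵇ⇒≥ (T ^ R) (deg G B v)) (upper-B₀ v)

        1≤A : 1 ≤ countF A
        1≤A with countF A | A₀≤A
        ... | zero  | q = ⊥-elim (<⇒≱ 1≤A₀ (≤-trans q (≤-reflexive (*-zeroʳ (T ^ 6)))))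
        ... | suc _ | _ = s≤s z≤n

        size-B : T ^ j * countF B ≤ T ^ (12 + R) * countF A
        size-B = begin
          T ^ j * countF B ≡⟨ *-comm (T ^ j) (countF B) ⟩
          countF B * T ^ j ≤⟨ sumOver-≥const B (T ^ j) lower-A₀ ⟩
          sumOver B (deg G A₀) ≡⟨ sumOver-deg-comm G A₀ B ⟩
          sumOver A₀ (deg G B) ≤⟨ sumOver-≤const A₀ (T ^ (6 + R)) upper-B₀ ⟩
          countF A₀ * T ^ (6 + R) ≤⟨ *-monoˡ-≤ (T ^ (6 + R)) A₀≤A ⟩
          T ^ 6 * countF A * T ^ (6 + R) ≡⟨ r (T ^ 6) (countF A) (T ^ (6 + R)) ⟩
          T ^ 6 * T ^ (6 + R) * countF A ≡⟨ cong (_* countF A) (sym (^-distribˡ-+-* T 6 (6 + R))) ⟩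
          T ^ (12 + R) * countF A ∎
          where
          open ≤-Reasoning
          r : ∀ s a t → s * a * t ≡ s * t * a
          r = solve-∀

      2≤R : 2 ≤ R
      2≤R = ≤-trans 2≤k (≤-trans (m≤n*m k 2) 2k≤R)

      -- The tail begins after `T * T - 1` classes, so its degree exponent is quadratic in `T`,
      -- whereas exact neighbourhoods of size below `T` and the ratio `2 ^ T` cost an exponent
      -- linear in `T`. The `12 + R` is the loss in `size-B`.
      high-exponent : ∀ d → suc d ≡ T * T → 8 + R + (9 + R) * T + (12 + R) ≤ d + (2 + R)
      high-exponent d d≡ = ≤-pred (begin
        1 + (8 + R + (9 + R) * T + (12 + R)) ≡⟨ r₁ R T ⟩
        21 + R + (9 + R) * T + R ≤⟨ +-monoˡ-≤ R (+-monoˡ-≤ ((9 + R) * T) (≤-trans (+-monoˡ-≤ R (m≤m+n 21 9)) R≤T)) ⟩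
        T + (9 + R) * T + R ≤⟨ +-monoˡ-≤ R (*-monoˡ-≤ T (≤-trans (+-monoˡ-≤ R (m≤m+n 10 20)) R≤T)) ⟩
        T * T + R ≤⟨ +-monoʳ-≤ (T * T) (m≤n+m R 2) ⟩
        T * T + (2 + R) ≡⟨ cong (_+ (2 + R)) (sym d≡) ⟩
        suc (d + (2 + R)) ∎)
        where
        open ≤-Reasoning
        r₁ : ∀ R T → 1 + (8 + R + (9 + R) * T + (12 + R)) ≡ 21 + R + (9 + R) * T + R
        r₁ = solve-∀

      high-case : ∀ j → 8 + R + (9 + R) * T + (12 + R) ≤ j → γ ≤ edges-above j → C4FreeSubgraph G k ⊎ UnbalancedPair G T m
      high-case j exponent h = conclude (member-⊎ A λ v e →
          independent-subset m (R ∸ 2) (λ b → B b ∧ Adj G v b) m<T 9≤a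
            (≤-trans (m+n≤o⇒m≤o c c≤R) (≤-reflexive (sym (m+[n∸m]≡n 2≤R))))
            (≤-trans (≤-reflexive (cong (T ^_) (m+[n∸m]≡n 2≤R))) (lower-B v e))
            (≤-trans (upper-B v e) (≤-reflexive (cong (λ x → T ^ (6 + x)) (sym (m+[n∸m]≡n 2≤R))))))
        where
        open Unbalanced σ
        B : VSet G
        B = above j
        open Class B j (λ b e → proj₁ (∧-split e)) (λ b e → ≤ᵇ-elim (proj₂ (∧-split {X b} e))) h
        conclude : C4FreeSubgraph G k ⊎ (∀ v → A v ≡ true → ∃ λ (I : VSet G) →
          (∀ b → I b ≡ true → B b ∧ Adj G v b ≡ true) × Independent G I × countF I ≡ m) →
          C4FreeSubgraph G k ⊎ UnbalancedPair G T m
        conclude (inj₁ p) = inj₁ p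
        conclude (inj₂ q) = inj₂ (unbalanced m 1≤m m<T A B 1≤A upper-B q
          (≤-trans (rescale T j (12 + R) (8 + R + (9 + R) * T) 0 size-B exponent) (≤-reflexive (+-identityʳ (countF A)))))

      -- Sparsity between the neighbourhoods of `u` in `B` and in `A` controls the overlaps of
      -- adjacent candidates; sparsity towards the neighbourhood of each `b` next to `u` controls
      -- the squares of codegrees.
      mid-case : ∀ j → 2 + R ≤ j → γ ≤ sumOver (class j) (deg G A₀) → C4FreeSubgraph G k
      mid-case j R≤j h = combine
        (member-⊎ A λ u e → sparse-or-dense σ ε (λ b → B b ∧ Adj G u b) (λ v → A v ∧ Adj G u v) (T ^ (6 + R)) ε≤a
          (≤-trans c≤R (m≤n+m R 4)) (upper-B u e) (upper-A u e) (^-monoʳ-≤ T (≤-trans c≤R (m≤n+m R 6))))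
        (member-⊎ A λ u e → member-⊎ (λ b → B b ∧ Adj G u b) λ b q →
          let bb = proj₁ (∧-split q) in
          sparse-or-dense σ ε (λ b → B b ∧ Adj G u b) (λ v → A₀ v ∧ Adj G b v) (T * deg G A₀ b) ε≤a
            (≤-trans c≤R (m≤n+m R 4)) (upper-B u e) (m≤n*m (deg G A₀ b) T)
            (≤-trans (^-monoʳ-≤ T (≤-trans c≤R (≤-trans (m≤n+m R 2) R≤j))) (≤-trans (lower-A₀ b bb) (m≤n*m (deg G A₀ b) T))))
        where
        B : VSet G
        B = class j
        lower-A₀ : ∀ b → B b ≡ true → T ^ j ≤ deg G A₀ b
        lower-A₀ b e = ≤ᵇ-elim (proj₂ (∧-split {X b} (proj₁ (∧-split {above j b} e))))
        upper-A₀ : ∀ b → B b ≡ true → deg G A₀ b ≤ T ^ (1 + j)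
        upper-A₀ b e = ≤ᵇ-elim (proj₂ (∧-split {above j b} e))
        open Class B j (λ b e → proj₁ (∧-split (proj₁ (∧-split {above j b} e)))) lower-A₀ h
        j′ x : ℕ
        j′ = j ∸ (2 + R)
        -- The truncated subtraction is exact, as `k * e₁` is at most `R` and hence at most `j`.
        x = j + 5 + (k * k + 7 * k) ∸ k * e₁
        x≡ : x + k * e₁ ≡ j + 5 + (k * k + 7 * k)
        x≡ = m∸n+n≡m (≤-trans (≤-trans (m≤n*m (k * e₁) 2) (≤-trans (m≤m+n ε 2) (m+n≤o⇒n≤o c c≤R)))
          (≤-trans (≤-trans (m≤n+m R 2) R≤j) (≤-trans (m≤m+n j 5) (m≤m+n (j + 5) (k * k + 7 * k)))))
        combine :
          C4FreeSubgraph G k ⊎ (∀ u → A u ≡ true →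
            T ^ ε * sumOver (λ v → A v ∧ Adj G u v) (deg G (λ b → B b ∧ Adj G u b)) ≤ T ^ (4 + R) * T ^ (6 + R)) →
          C4FreeSubgraph G k ⊎ (∀ u → A u ≡ true → ∀ b → B b ∧ Adj G u b ≡ true →
            T ^ ε * sumOver (λ v → A₀ v ∧ Adj G b v) (deg G (λ b → B b ∧ Adj G u b)) ≤ T ^ (4 + R) * (T * deg G A₀ b)) →
          C4FreeSubgraph G k
        combine (inj₁ p) _ = p
        combine (inj₂ _) (inj₁ p) = p
        combine (inj₂ s₁) (inj₂ s₂) = Balanced.balanced σ A₀ A B e₁ j j′ x
          (proj₁ (pow-suc T (5 + R + e₁))) (proj₂ (pow-suc T (5 + R + e₁))) (sym (m+[n∸m]≡n R≤j))
          e₁≡ x≡ k^k≤T 2k≤R 1≤A A⊆A₀ lower-B upper-B upper-A₀ size-B s₁ s₂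

    dichotomy : C4FreeSubgraph G k ⊎ UnbalancedPair G T m
    dichotomy with pow-suc T 2
    ... | d , d≡ with find-class d (2 + R) (≤-trans (≤-reflexive (cong (_* γ) (trans d≡ (cong (T *_) (*-identityʳ T))))) many-edges)
    ...   | inj₁ (j , R≤j , h) = inj₁ (mid-case j R≤j h)
    ...   | inj₂ h = high-case (d + (2 + R)) (high-exponent d (trans d≡ (cong (T *_) (*-identityʳ T)))) h

-- Rational parameters

find-floor : ∀ (f : ℕ → ℕ) x → f 0 ≤ x → ∀ N → x < f N → ∃ λ t → f t ≤ x × x < f (suc t)
find-floor f x f0 zero    lt = contradiction f0 (<⇒≱ lt)
find-floor f x f0 (suc N) lt with f N ≤? x
... | yes p = N , p , lt
... | no ¬p = find-floor f x f0 N (≰⇒> ¬p)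

^-cancelˡ-< : ∀ q {a b} → a ^ q < b ^ q → a < b
^-cancelˡ-< q {a} {b} h = ≰⇒> λ b≤a → <⇒≱ h (^-monoˡ-≤ q b≤a)

^-cancelˡ-≤ : ∀ q .{{_ : NonZero q}} {a b} → a ^ q ≤ b ^ q → a ≤ b
^-cancelˡ-≤ q {a} {b} h = ≮⇒≥ λ b<a → <⇒≱ (^-monoˡ-< q b<a) h

n≤n^q : ∀ n q → 1 ≤ q → n ≤ n ^ q
n≤n^q zero        q       1≤q = z≤n
n≤n^q n@(suc _)   (suc q) 1≤q = m≤m*n n (n ^ q) {{m^n≢0 n q}}

monomial : ℕ → ℕ → List ℕ
monomial zero    C = C ∷ []
monomial (suc r) C = 0 ∷ monomial r C

evalPoly-monomial : ∀ r C x → evalPoly (monomial r C) x ≡ C * x ^ r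
evalPoly-monomial zero    C x = trans (cong (C +_) (*-zeroʳ x)) (trans (+-identityʳ C) (sym (*-identityʳ C)))
evalPoly-monomial (suc r) C x = trans (cong (x *_) (evalPoly-monomial r C x)) (swap₃ x C (x ^ r))
  where
  swap₃ : ∀ a b c → a * (b * c) ≡ b * (a * c)
  swap₃ = solve-∀

size-tabulate : ∀ {m} (P : Fin m → Bool) → size (tabulate P) ≡ countF P
size-tabulate P = countF-cong (lookup∘tabulate P)

degIn-tabulate : ∀ G (P : VSet G) u → degIn G (tabulate P) u ≡ deg G P u
degIn-tabulate G P u = countF-cong (λ v → cong (_∧ Adj G u v) (lookup∘tabulate P v))

degSum-tabulate : ∀ G (P : VSet G) → degSum G (tabulate P) ≡ sumOver P (deg G P)
degSum-tabulate G P = sumF-cong (λ u → cong₂ (λ b x → if b then x else 0) (lookup∘tabulate P u) (degIn-tabulate G P u))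

mad-bound : ∀ G dn dd → IsMad G dn dd → ∀ (Y : VSet G) → sumOver Y (deg G Y) * dd ≤ dn * countF Y
mad-bound G dn dd (_ , _ , upper) Y with 1 ≤? countF Y
... | yes p = subst₂ (λ a b → a * dd ≤ dn * b) (degSum-tabulate G Y) (size-tabulate Y)
  (upper (tabulate Y) (≤-trans p (≤-reflexive (sym (size-tabulate Y)))))
... | no ¬p = ≤-trans (*-monoˡ-≤ dd (≤-trans (sumOver-≤const Y 0 (λ u yu → contradiction (∃⇒1≤countF Y u yu) ¬p))
  (≤-reflexive (*-zeroʳ (countF Y))))) z≤n

-- Removing a vertex cannot increase the average degree above dn/dd.
extremal-degree : ∀ G dn dd → IsMad G dn dd → ∀ (X : VSet G) → sumOver X (deg G X) * dd ≡ dn * countF X →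
  ∀ v → X v ≡ true → dn ≤ 2 * deg G X v * dd
extremal-degree G dn dd mad X attained v xv = +-cancelˡ-≤ (dn * countF Y) dn (2 * deg G X v * dd) (begin
  dn * countF Y + dn ≡⟨ trans (+-comm (dn * countF Y) dn) (sym (*-suc dn (countF Y))) ⟩
  dn * suc (countF Y) ≤⟨ *-monoʳ-≤ dn (countF-∖ X v xv) ⟩
  dn * countF X ≡⟨ sym attained ⟩
  sumOver X (deg G X) * dd ≤⟨ *-monoˡ-≤ dd removal ⟩
  (sumOver Y (deg G Y) + 2 * deg G X v) * dd ≡⟨ *-distribʳ-+ dd (sumOver Y (deg G Y)) (2 * deg G X v) ⟩
  sumOver Y (deg G Y) * dd + 2 * deg G X v * dd ≤⟨ +-monoˡ-≤ (2 * deg G X v * dd) (mad-bound G dn dd mad Y) ⟩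
  dn * countF Y + 2 * deg G X v * dd ∎)
  where
  open ≤-Reasoning
  Y : VSet G
  Y = X ∖ v
  Y⊆X : ∀ u → Y u ≡ true → X u ≡ true
  Y⊆X u e = proj₁ (∧-split e)
  one : countF (λ x → v == x) ≤ 1
  one = ≤-trans (countF-mono {P = λ x → v == x} {Q = insert v ∅} (λ x e → ∨-introˡ e))
    (≤-reflexive (trans (countF-insert v ∅ refl) (cong suc (countF-∅ (n G)))))
  split-deg : ∀ u → deg G X u ≤ deg G Y u + 𝟙 (Adj G u v)
  split-deg u = ≤-trans (sumF-mono pointwise) (≤-trans (≤-reflexive (sumF-+ (λ x → 𝟙 (Y x ∧ Adj G u x)) (λ x → 𝟙 ((v == x) ∧ Adj G u v))))
    (+-monoʳ-≤ (deg G Y u) (≤-trans (≤-reflexive (trans (sumF-cong (λ x → 𝟙-∧ (v == x) (Adj G u v))) (sumF-*ʳ (λ x → 𝟙 (v == x)) (𝟙 (Adj G u v)))))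
      (≤-trans (*-monoˡ-≤ (𝟙 (Adj G u v)) one) (≤-reflexive (*-identityˡ _))))))
    where
    pointwise : ∀ x → 𝟙 (X x ∧ Adj G u x) ≤ 𝟙 (Y x ∧ Adj G u x) + 𝟙 ((v == x) ∧ Adj G u v)
    pointwise x = 𝟙≤ (X x ∧ Adj G u x) λ e → case ∖-split X v x (proj₁ (∧-split e)) of λ
      { (inj₁ refl) → ≤-trans (𝟙-true (∧-join (==-refl v) (proj₂ (∧-split {X x} e)))) (m≤n+m _ _)
      ; (inj₂ yx) → ≤-trans (𝟙-true (∧-join yx (proj₂ (∧-split {X x} e)))) (m≤m+n _ _) }
  removal : sumOver X (deg G X) ≤ sumOver Y (deg G Y) + 2 * deg G X v
  removal = begin
    sumOver X (deg G X)
      ≤⟨ sumF-mono pointwise ⟩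
    sumF (λ u → (if Y u then deg G X u else 0) + (if v == u then deg G X v else 0))
      ≡⟨ sumF-+ (λ u → if Y u then deg G X u else 0) (λ u → if v == u then deg G X v else 0) ⟩
    sumOver Y (deg G X) + sumOver (λ u → v == u) (λ _ → deg G X v)
      ≤⟨ +-mono-≤ (sumOver-mono Y (λ u _ → split-deg u)) (≤-trans (≤-reflexive (sumOver-const (λ u → v == u) (deg G X v))) (*-monoˡ-≤ (deg G X v) one)) ⟩
    sumOver Y (λ u → deg G Y u + 𝟙 (Adj G u v)) + 1 * deg G X v
      ≡⟨ cong (_+ 1 * deg G X v) (sumOver-+ Y (deg G Y) (λ u → 𝟙 (Adj G u v))) ⟩
    sumOver Y (deg G Y) + sumOver Y (λ u → 𝟙 (Adj G u v)) + 1 * deg G X v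
      ≤⟨ +-monoˡ-≤ (1 * deg G X v) (+-monoʳ-≤ (sumOver Y (deg G Y)) to-v) ⟩
    sumOver Y (deg G Y) + deg G X v + 1 * deg G X v
      ≡⟨ r (sumOver Y (deg G Y)) (deg G X v) ⟩
    sumOver Y (deg G Y) + 2 * deg G X v ∎
    where
    r : ∀ a b → a + b + 1 * b ≡ a + 2 * b
    r = solve-∀
    to-v : sumOver Y (λ u → 𝟙 (Adj G u v)) ≤ deg G X v
    to-v = ≤-trans (≤-reflexive (sym (sumOver-∧ Y (λ u → Adj G u v) (λ _ → 1))))
      (countF-mono {P = λ u → Y u ∧ Adj G u v} {Q = λ u → X u ∧ Adj G v u} λ u e →
        ∧-join (Y⊆X u (proj₁ (∧-split e))) (adj-sym G (proj₂ (∧-split {Y u} e))))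
    pointwise : ∀ u → (if X u then deg G X u else 0) ≤ (if Y u then deg G X u else 0) + (if v == u then deg G X v else 0)
    pointwise u = aux (X u) refl
      where
      pick : ∀ {b x} → b ≡ true → x ≤ (if b then x else 0)
      pick refl = ≤-refl
      aux : ∀ b → X u ≡ b → (if b then deg G X u else 0) ≤ (if Y u then deg G X u else 0) + (if v == u then deg G X v else 0)
      aux false e = z≤n
      aux true  e = case ∖-split X v u e of λ
        { (inj₁ refl) → ≤-trans (pick (==-refl v)) (m≤n+m _ _)
        ; (inj₂ yu) → ≤-trans (pick yu) (m≤m+n _ _) }

-- With ε equal to `1 / (2 * Q)`, the exponent d^(2ε) is the `Q`-th root of d and thus at most `T`.
-- So each admissible `a` is at most `T * b`, and the `b`-th power of the hypothesis suffices.
GeqExpTimes-intro : ∀ dn dd Q .{{_ : NonZero Q}} T x y → 1 ≤ dd → dn ≤ T ^ Q * dd → 2 ^ T * y ≤ x →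
  GeqExpTimes dn dd 1 (2 * Q) x y
GeqExpTimes-intro dn dd Q T x y 1≤dd dn≤ h a b 1≤b le = begin
  2 ^ a * y ^ b ≤⟨ *-monoˡ-≤ (y ^ b) (^-monoʳ-≤ 2 a≤Tb) ⟩
  2 ^ (T * b) * y ^ b ≡⟨ cong (_* y ^ b) (sym (^-*-assoc 2 T b)) ⟩
  (2 ^ T) ^ b * y ^ b ≡⟨ sym (^-distribʳ-* b (2 ^ T) y) ⟩
  (2 ^ T * y) ^ b ≤⟨ ^-monoˡ-≤ b h ⟩
  x ^ b ∎
  where
  open ≤-Reasoning
  instance
    dd≢0 : NonZero dd
    dd≢0 = >-nonZero 1≤dd
  a≤Tb : a ≤ T * b
  a≤Tb = ^-cancelˡ-≤ (2 * Q) {{m*n≢0 2 Q}} (*-cancelʳ-≤ (a ^ (2 * Q)) ((T * b) ^ (2 * Q)) (dd ^ 2) {{m^n≢0 dd 2}} (begin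
    a ^ (2 * Q) * dd ^ 2 ≤⟨ le ⟩
    dn ^ 2 * b ^ (2 * Q) ≤⟨ *-monoˡ-≤ (b ^ (2 * Q)) (^-monoˡ-≤ 2 dn≤) ⟩
    (T ^ Q * dd) ^ 2 * b ^ (2 * Q) ≡⟨ cong (_* b ^ (2 * Q)) (^-distribʳ-* 2 (T ^ Q) dd) ⟩
    (T ^ Q) ^ 2 * dd ^ 2 * b ^ (2 * Q) ≡⟨ cong (λ z → z * dd ^ 2 * b ^ (2 * Q)) (trans (^-*-assoc T Q 2) (cong (T ^_) (*-comm Q 2))) ⟩
    T ^ (2 * Q) * dd ^ 2 * b ^ (2 * Q) ≡⟨ r (T ^ (2 * Q)) (dd ^ 2) (b ^ (2 * Q)) ⟩
    T ^ (2 * Q) * b ^ (2 * Q) * dd ^ 2 ≡⟨ cong (_* dd ^ 2) (sym (^-distribʳ-* (2 * Q) T b)) ⟩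
    (T * b) ^ (2 * Q) * dd ^ 2 ∎))
    where
    r : ∀ t d b → t * d * b ≡ t * b * d
    r = solve-∀

Outcome : (k s : ℕ) (G : Graph) (dn dd q : ℕ) → Set
Outcome k s G dn dd q =
  (Σ (Subset (n G)) λ X → (1 ≤ size X) × IsBipartiteIn G X × ¬ HasC4In G X × (k * size X ≤ degSum G X))
  ⊎
  (Σ (Subset (n G)) λ X → Σ (Subset (n G)) λ A → Σ (Subset (n G)) λ B →
    IsBipartition G X A B × (1 ≤ size X) × GeqExpTimes dn dd 1 q (size A) (size B) ×
    Σ ℕ λ m → IsFloorPow dn dd 1 q s m × (∀ a → a ∈ₛ A → degIn G B a ≡ m))

-- Parameters and conclusion

module Main (k : ℕ) (system : LinearSystem (suc k)) (1≤k : 1 ≤ k) (e₁ a c R b : ℕ)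
  (e₁≡ : e₁ ≡ 2 * (suc k * suc k) + 12 * suc k + 14)
  (9≤a : 9 ≤ a) (ε≤a : 2 * (suc k * e₁) + 2 ≤ a)
  (denseX : denseExponent (LinearSystem.points system) a + (2 * LinearSystem.points system + 3) ≤ c)
  (denseY : denseExponent (LinearSystem.points system) a +
    (LinearSystem.points system + suc (suc (LinearSystem.lines system))) ≤ c)
  (c≤R : c + (2 * (suc k * e₁) + 2) ≤ R) (2k≤R : 2 * suc k ≤ R)
  (5≤b : 5 ≤ b) (lines<b : LinearSystem.lines system < b)
  (incidences≤b : LinearSystem.lines system * LinearSystem.points system ≤ b)
  (k^k≤b : 2 * suc k ^ suc k ≤ b) (R≤b : 30 + R ≤ b) (2^Q≤b : 2 ^ (6 + R) ≤ b) where

  Q : ℕ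
  Q = 5 + R

  module _ (s : ℕ) (1≤s : 1 ≤ s) (G : Graph) (noK : ¬ HasKss G s) (dn dd : ℕ) (mad : IsMad G dn dd)
    (large : b ^ Q * s ^ (8 * Q) * dd ≤ dn) where

    private
      instance
        s≢0 : NonZero s
        s≢0 = >-nonZero 1≤s
        b≢0 : NonZero b
        b≢0 = >-nonZero (≤-trans (s≤s z≤n) 5≤b)
        dd≢0 : NonZero dd
        dd≢0 = >-nonZero (proj₁ mad)

      module WithT (t : ℕ) (t≤ : t ^ Q * dd ≤ dn) (<T : dn < suc t ^ Q * dd)
        (m : ℕ) (m≤ : (m * s ^ 4) ^ (2 * Q) * dd ^ 1 ≤ dn ^ 1) (<m : dn ^ 1 < (suc m * s ^ 4) ^ (2 * Q) * dd ^ 1) where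

        T : ℕ
        T = suc t

        bs<T : b * s < T
        bs<T = ^-cancelˡ-< Q (*-cancelʳ-< dd ((b * s) ^ Q) (T ^ Q) (begin-strict
          (b * s) ^ Q * dd ≡⟨ cong (_* dd) (^-distribʳ-* Q b s) ⟩
          b ^ Q * s ^ Q * dd ≤⟨ *-monoˡ-≤ dd (*-monoʳ-≤ (b ^ Q) (^-monoʳ-≤ s (m≤n*m Q 8))) ⟩
          b ^ Q * s ^ (8 * Q) * dd ≤⟨ large ⟩
          dn <⟨ <T ⟩
          T ^ Q * dd ∎))
          where open ≤-Reasoning
        b≤T : b ≤ T
        b≤T = ≤-trans (m≤m*n b s) (<⇒≤ bs<T)
        s<T : s < T
        s<T = ≤-<-trans (m≤n*m s b) bs<T

        -- Here the degree `8 * Q` of the polynomial is used: it makes the `2 * Q`-th root of d at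
        -- least `s ^ 4`.
        1≤m : 1 ≤ m
        1≤m = positive m <m
          where
          open ≤-Reasoning
          positive : ∀ m → dn ^ 1 < (suc m * s ^ 4) ^ (2 * Q) * dd ^ 1 → 1 ≤ m
          positive (suc m) h = s≤s z≤n
          positive zero    h = contradiction (begin
            (1 * s ^ 4) ^ (2 * Q) * dd ^ 1 ≡⟨ cong₂ _*_ (trans (cong (_^ (2 * Q)) (*-identityˡ (s ^ 4))) (trans (^-*-assoc s 4 (2 * Q)) (cong (s ^_) (r Q)))) (*-identityʳ dd) ⟩
            s ^ (8 * Q) * dd ≤⟨ *-monoˡ-≤ dd (m≤n*m (s ^ (8 * Q)) (b ^ Q) {{m^n≢0 b Q}}) ⟩
            b ^ Q * s ^ (8 * Q) * dd ≤⟨ large ⟩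
            dn ≡⟨ sym (*-identityʳ dn) ⟩
            dn ^ 1 ∎) (<⇒≱ h)
            where
            r : ∀ Q → 4 * (2 * Q) ≡ 8 * Q
            r = solve-∀

        m<T : m < T
        m<T = ^-cancelˡ-< Q (*-cancelʳ-< dd (m ^ Q) (T ^ Q) (begin-strict
          m ^ Q * dd ≤⟨ *-monoˡ-≤ dd (^-monoʳ-≤ m (m≤n*m Q 2)) ⟩
          m ^ (2 * Q) * dd ≤⟨ *-monoˡ-≤ dd (^-monoˡ-≤ (2 * Q) (m≤m*n m (s ^ 4) {{m^n≢0 s 4}})) ⟩
          (m * s ^ 4) ^ (2 * Q) * dd ≡⟨ cong ((m * s ^ 4) ^ (2 * Q) *_) (sym (*-identityʳ dd)) ⟩
          (m * s ^ 4) ^ (2 * Q) * dd ^ 1 ≤⟨ m≤ ⟩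
          dn ^ 1 ≡⟨ *-identityʳ dn ⟩
          dn <⟨ <T ⟩
          T ^ Q * dd ∎))
          where
          open ≤-Reasoning
          instance
            m≢0 : NonZero m
            m≢0 = >-nonZero 1≤m

        mad-T : ∀ (Y : VSet G) → sumOver Y (deg G Y) ≤ T ^ Q * countF Y
        mad-T Y = *-cancelʳ-≤ (sumOver Y (deg G Y)) (T ^ Q * countF Y) dd (begin
          sumOver Y (deg G Y) * dd ≤⟨ mad-bound G dn dd mad Y ⟩
          dn * countF Y ≤⟨ *-monoˡ-≤ (countF Y) (<⇒≤ <T) ⟩
          T ^ Q * dd * countF Y ≡⟨ r (T ^ Q) dd (countF Y) ⟩
          T ^ Q * countF Y * dd ∎)
          where
          open ≤-Reasoning
          r : ∀ x y z → x * y * z ≡ x * z * y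
          r = solve-∀

        σ : Setting G (suc k)
        σ = record
          { s = s ; T = T ; R = R ; a = a ; c = c ; system = system
          ; 2≤k = s≤s 1≤k ; 5≤T = ≤-trans 5≤b b≤T ; s<T = s<T ; noK = noK
          ; lines<T = ≤-trans lines<b b≤T ; incidences≤T = ≤-trans incidences≤b b≤T
          ; mad = mad-T ; denseX = denseX ; denseY = denseY }

        X : VSet G
        X = lookup (proj₁ (proj₁ (proj₂ mad)))

        -- Rounding costs `2 ^ Q` because `T ≤ 2 * t`, and extremality gives only half of d. Since
        -- `2 ^ (6 + R) ≤ T`, both losses fit into one factor `T`.
        min-degree : ∀ v → X v ≡ true → T ^ (4 + R) ≤ deg G X v
        min-degree v xv = *-cancelˡ-≤ T (begin
          T ^ Q ≤⟨ ^-monoˡ-≤ Q (≤-trans (+-monoˡ-≤ t 1≤t) (≤-reflexive (cong (t +_) (sym (+-identityʳ t))))) ⟩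
          (2 * t) ^ Q ≡⟨ ^-distribʳ-* Q 2 t ⟩
          2 ^ Q * t ^ Q ≤⟨ *-monoʳ-≤ (2 ^ Q) (*-cancelʳ-≤ (t ^ Q) (2 * deg G X v) dd (≤-trans t≤
            (extremal-degree G dn dd mad X (proj₂ (proj₂ (proj₁ (proj₂ mad)))) v xv))) ⟩
          2 ^ Q * (2 * deg G X v) ≡⟨ r (2 ^ Q) (deg G X v) ⟩
          2 ^ (6 + R) * deg G X v ≤⟨ *-monoˡ-≤ (deg G X v) (≤-trans 2^Q≤b b≤T) ⟩
          T * deg G X v ∎)
          where
          open ≤-Reasoning
          1≤t : 1 ≤ t
          1≤t = ≤-pred (≤-trans (s≤s (s≤s z≤n)) (≤-trans 5≤b b≤T))
          r : ∀ x d → x * (2 * d) ≡ 2 * x * d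
          r = solve-∀

        translate : C4FreeSubgraph G (suc k) ⊎ UnbalancedPair G T m → Outcome k s G dn dd (2 * Q)
        translate (inj₁ (X , 1≤X , bip , noC4 , dense)) =
          inj₁ (X , 1≤X , bip , noC4 , ≤-trans (*-monoˡ-≤ (size X) (n≤1+n k)) dense)
        translate (inj₂ (A , B , disj , indA , indB , 1≤A , ratio , exact)) = inj₂
          ( tabulate (λ v → A v ∨ B v) , tabulate A , tabulate B
          , IsBipartition-tabulate G A B disj indA indB
          , ≤-trans 1≤A (≤-trans (countF-mono {P = A} {Q = λ v → A v ∨ B v} (λ v e → ∨-introˡ e))
              (≤-reflexive (sym (size-tabulate (λ v → A v ∨ B v)))))
          , GeqExpTimes-intro dn dd Q T (size (tabulate A)) (size (tabulate B)) (proj₁ mad) (<⇒≤ <T)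
              (subst₂ (λ x y → 2 ^ T * y ≤ x) (sym (size-tabulate A)) (sym (size-tabulate B)) ratio)
          , m , (m≤ , <m)
          , λ v e → trans (degIn-tabulate G B v) (exact v (trans (sym (lookup∘tabulate A v)) e)) )

        result : Outcome k s G dn dd (2 * Q)
        result = translate (Dichotomy.dichotomy σ e₁ e₁≡ (≤-trans k^k≤b b≤T) 2k≤R (≤-trans R≤b b≤T)
          9≤a ε≤a c≤R m 1≤m m<T X (proj₁ (proj₂ (proj₁ (proj₂ mad)))) min-degree)

      exceeds : ∀ y → 1 ≤ y → dn < (suc dn * y) ^ (2 * Q) * dd
      exceeds y 1≤y = ≤-trans (≤-trans (m≤m*n (suc dn) y {{>-nonZero 1≤y}}) (n≤n^q (suc dn * y) (2 * Q) (s≤s z≤n)))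
        (m≤m*n ((suc dn * y) ^ (2 * Q)) dd)

    main : Outcome k s G dn dd (2 * Q)
    main =
      let (t , t≤ , <t) = find-floor (λ t → t ^ Q * dd) dn z≤n (suc dn)
            (≤-trans (n≤n^q (suc dn) Q (s≤s z≤n)) (m≤m*n (suc dn ^ Q) dd))
          (m , m≤ , <m) = find-floor (λ m → (m * s ^ 4) ^ (2 * Q) * dd ^ 1) (dn ^ 1) z≤n (suc dn)
            (subst₂ (λ x y → x < (suc dn * s ^ 4) ^ (2 * Q) * y) (sym (*-identityʳ dn)) (sym (*-identityʳ dd)) (exceeds (s ^ 4) (m^n>0 s 4)))
      in WithT.result t t≤ <t m m≤ <m

theorem3p6 : ∀ (k : ℕ) → 1 ≤ k →
  Σ ℕ λ p → Σ ℕ λ q → (1 ≤ p) × (1 ≤ q) × Σ (List ℕ) λ P →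
    ∀ (s : ℕ) → 1 ≤ s → ∀ (G : Graph) → ¬ HasKss G s →
    ∀ (dn dd : ℕ) → IsMad G dn dd → evalPoly P s * dd ≤ dn →
      (Σ (Subset (n G)) λ X →
         (1 ≤ size X) × IsBipartiteIn G X × ¬ HasC4In G X × (k * size X ≤ degSum G X))
      ⊎
      (Σ (Subset (n G)) λ X → Σ (Subset (n G)) λ A → Σ (Subset (n G)) λ B →
         IsBipartition G X A B × (1 ≤ size X) ×
         GeqExpTimes dn dd p q (size A) (size B) ×
         Σ ℕ λ m → IsFloorPow dn dd p q s m × (∀ a → a ∈ₛ A → degIn G B a ≡ m))

theorem3p6 k 1≤k =
  1 , 2 * Q , s≤s z≤n , s≤s z≤n , monomial (8 * Q) (b ^ Q) , λ s 1≤s G noK dn dd mad large →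
    main s 1≤s G noK dn dd mad (subst (λ x → x * dd ≤ dn) (evalPoly-monomial (8 * Q) (b ^ Q) s) large)
  where
  -- Working with `suc k` ensures two points on each line even for `k` equal to 1.
  system : LinearSystem (suc k)
  system = linearSystem (suc k) (s≤s z≤n)
  open LinearSystem system using (points; lines)
  e₁ ε a c cX cY R b₁ b₂ b₃ b₄ b₅ b₆ b : ℕ
  e₁ = 2 * (suc k * suc k) + 12 * suc k + 14
  ε  = 2 * (suc k * e₁)
  a  = 9 + (ε + 2)
  cX = denseExponent points a + (2 * points + 3)
  cY = denseExponent points a + (points + suc (suc lines))
  c  = cX + cY
  R  = c + (ε + 2) + 2 * suc k
  b₁ = 5
  b₂ = suc lines
  b₃ = lines * points
  b₄ = 2 * suc k ^ suc k
  b₅ = 30 + R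
  b₆ = 2 ^ (6 + R)
  -- A sum, so that each requirement on `b` follows by dropping the other summands.
  b  = b₁ + (b₂ + (b₃ + (b₄ + (b₅ + b₆))))
  open Main k system 1≤k e₁ a c R b refl (m≤m+n 9 (ε + 2)) (m≤n+m (ε + 2) 9) (m≤m+n cX cY) (m≤n+m cY cX)
    (m≤m+n (c + (ε + 2)) (2 * suc k)) (m≤n+m (2 * suc k) (c + (ε + 2)))
    (m≤m+n b₁ _)
    (m≤n⇒m≤o+n b₁ (m≤m+n b₂ _))
    (m≤n⇒m≤o+n b₁ (m≤n⇒m≤o+n b₂ (m≤m+n b₃ _)))
    (m≤n⇒m≤o+n b₁ (m≤n⇒m≤o+n b₂ (m≤n⇒m≤o+n b₃ (m≤m+n b₄ _))))
    (m≤n⇒m≤o+n b₁ (m≤n⇒m≤o+n b₂ (m≤n⇒m≤o+n b₃ (m≤n⇒m≤o+n b₄ (m≤m+n b₅ b₆)))))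
    (m≤n⇒m≤o+n b₁ (m≤n⇒m≤o+n b₂ (m≤n⇒m≤o+n b₃ (m≤n⇒m≤o+n b₄ (m≤n+m b₆ b₅)))))
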